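{- For every integer $m\ge 0$ and every integer $k\ge 2$, the series below converges and $$\frac{1}{\pi}=\frac{(1/2)_{m+k}}{2^{2m}}\,\frac{(2m)!}{m!}\,\sum_{n=0}^\infty \frac{(m+1/2)_n\,\langle m-1/2\rangle_n\,(m+1/2)_{k+n}\,(k+m+2n+1/2)}{n!\,(k+n)!\,(2m+k+n)!}.$$
   Context: For a number $x$ and a non-negative integer $n$, the rising factorial is $(x)_0=1$, $(x)_n=x(x+1)(x+2)\cdots(x+n-1)$ for $n\ge 1$, and the falling factorial is $\langle x\rangle_0=1$, $\langle x\rangle_n=x(x-1)(x-2)\cdots(x-n+1)$ for $n\ge 1$. In the summand, $(k+m+2n+1/2)$ is an ordinary factor (not a rising factorial). -}

module Defs where

open import Data.Bool using (if_then_else_)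
open import Data.Nat as ℕ using (ℕ; zero; suc; z≤n; s≤s; _!)
import Data.Nat.Properties as ℕₚ
open import Data.Integer as ℤ using (+_; +[1+_]; -[1+_])
import Data.Integer.Properties as ℤₚ
open import Data.Rational as ℚ using (ℚ; 0ℚ; 1ℚ; ½; mkℚ)
import Data.Rational.Properties as ℚₚ
import Data.Rational.Unnormalised as ℚᵘ
import Data.Rational.Unnormalised.Properties as ℚᵘₚ
import Data.Nat.Solver as ℕ-Solver
open import Data.Rational.Solver using (module +-*-Solver)
open import Data.Product using (∃; _×_; _,_)
open import Data.Sum using (inj₁; inj₂)
open import Data.Empty using (⊥-elim)
open import Relation.Nullary using (Dec; yes; no; does)
open import Relation.Binary.PropositionalEquality
  using (_≡_; refl; sym; trans; cong; cong₂; subst; subst₂)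

module RationalLemmas where
  module Algebra where
    open +-*-Solver

    a+b-b : ∀ a b → a ℚ.+ b ℚ.- b ≡ a
    a+b-b = solve 2 (λ a b → a :+ b :- b := a) refl

    a-b+b : ∀ a b → a ℚ.- b ℚ.+ b ≡ a
    a-b+b = solve 2 (λ a b → a :- b :+ b := a) refl

    a+b-a : ∀ a b → a ℚ.+ b ℚ.- a ≡ b
    a+b-a = solve 2 (λ a b → a :+ b :- a := b) refl

    neg-sub : ∀ a b → ℚ.- (a ℚ.- b) ≡ b ℚ.- a
    neg-sub = solve 2 (λ a b → :- (a :- b) := b :- a) refl

    sub-neg : ∀ a b → b ℚ.- a ≡ (ℚ.- a) ℚ.- (ℚ.- b)
    sub-neg = solve 2 (λ a b → b :- a := (:- a) :- (:- b)) refl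

    add-sub : ∀ a b c d → (a ℚ.- b) ℚ.+ (c ℚ.- d) ≡ (a ℚ.+ c) ℚ.- (b ℚ.+ d)
    add-sub = solve 4 (λ a b c d → (a :- b) :+ (c :- d) := (a :+ c) :- (b :+ d)) refl

    mul-sub : ∀ a b c d → a ℚ.* (c ℚ.- d) ℚ.+ d ℚ.* (a ℚ.- b) ≡ a ℚ.* c ℚ.- b ℚ.* d
    mul-sub = solve 4 (λ a b c d → a :* (c :- d) :+ d :* (a :- b) := a :* c :- b :* d) refl

    recip-sub : ∀ a b u v → (u ℚ.- v) ℚ.* (a ℚ.* b) ≡ (a ℚ.* u) ℚ.* b ℚ.- (b ℚ.* v) ℚ.* a
    recip-sub = solve 4 (λ a b u v →
      (u :- v) :* (a :* b) := (a :* u) :* b :- (b :* v) :* a) refl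

  open Algebra public

  half+half : ∀ ε → ε ℚ.* ½ ℚ.+ ε ℚ.* ½ ≡ ε
  half+half ε = trans (sym (ℚₚ.*-distribˡ-+ ε ½ ½)) (ℚₚ.*-identityʳ ε)

  *-pos : ∀ {p q} → 0ℚ ℚ.< p → 0ℚ ℚ.< q → 0ℚ ℚ.< p ℚ.* q
  *-pos {p} {q} 0<p 0<q =
    ℚₚ.positive⁻¹ (p ℚ.* q)
      {{ℚₚ.pos*pos⇒pos p {{ℚ.positive 0<p}} q {{ℚ.positive 0<q}}}}

  0<½ : 0ℚ ℚ.< ½
  0<½ = ℚₚ.positive⁻¹ ½

  half-pos : ∀ {ε} → 0ℚ ℚ.< ε → 0ℚ ℚ.< ε ℚ.* ½
  half-pos 0<ε = *-pos 0<ε 0<½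

  *-mono-≤₀ : ∀ {a b c d} → 0ℚ ℚ.≤ c → 0ℚ ℚ.≤ b →
              a ℚ.≤ b → c ℚ.≤ d → a ℚ.* c ℚ.≤ b ℚ.* d
  *-mono-≤₀ {a} {b} {c} {d} 0≤c 0≤b a≤b c≤d =
    ℚₚ.≤-trans (ℚₚ.*-monoʳ-≤-nonNeg c {{ℚ.nonNegative 0≤c}} a≤b)
               (ℚₚ.*-monoˡ-≤-nonNeg b {{ℚ.nonNegative 0≤b}} c≤d)

  p≤∣p∣ : ∀ p → p ℚ.≤ ℚ.∣ p ∣
  p≤∣p∣ p with ℚₚ.≤-total 0ℚ p
  ... | inj₁ 0≤p = ℚₚ.≤-reflexive (sym (ℚₚ.0≤p⇒∣p∣≡p 0≤p))
  ... | inj₂ p≤0 = ℚₚ.≤-trans p≤0 (ℚₚ.0≤∣p∣ p)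

  ∣p∣<-intro : ∀ {p ε} → p ℚ.< ε → ℚ.- p ℚ.< ε → ℚ.∣ p ∣ ℚ.< ε
  ∣p∣<-intro {p} p<ε -p<ε with ℚₚ.∣p∣≡p∨∣p∣≡-p p
  ... | inj₁ e = subst (ℚ._< _) (sym e) p<ε
  ... | inj₂ e = subst (ℚ._< _) (sym e) -p<ε

  ∣p-q∣≡∣q-p∣ : ∀ p q → ℚ.∣ p ℚ.- q ∣ ≡ ℚ.∣ q ℚ.- p ∣
  ∣p-q∣≡∣q-p∣ p q = trans (sym (ℚₚ.∣-p∣≡∣p∣ (p ℚ.- q))) (cong ℚ.∣_∣ (neg-sub p q))

  ∣p∣-∣q∣≤∣p-q∣ : ∀ p q → ℚ.∣ p ∣ ℚ.- ℚ.∣ q ∣ ℚ.≤ ℚ.∣ p ℚ.- q ∣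
  ∣p∣-∣q∣≤∣p-q∣ p q = subst₂ ℚ._≤_
    (cong (λ z → ℚ.∣ z ∣ ℚ.- ℚ.∣ q ∣) (a-b+b p q))
    (a+b-b ℚ.∣ p ℚ.- q ∣ ℚ.∣ q ∣)
    (ℚₚ.+-monoˡ-≤ (ℚ.- ℚ.∣ q ∣) (ℚₚ.∣p+q∣≤∣p∣+∣q∣ (p ℚ.- q) q))

  ∣∣p∣-∣q∣∣≤∣p-q∣ : ∀ p q → ℚ.∣ ℚ.∣ p ∣ ℚ.- ℚ.∣ q ∣ ∣ ℚ.≤ ℚ.∣ p ℚ.- q ∣
  ∣∣p∣-∣q∣∣≤∣p-q∣ p q with ℚₚ.∣p∣≡p∨∣p∣≡-p (ℚ.∣ p ∣ ℚ.- ℚ.∣ q ∣)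
  ... | inj₁ e = subst (ℚ._≤ ℚ.∣ p ℚ.- q ∣) (sym e) (∣p∣-∣q∣≤∣p-q∣ p q)
  ... | inj₂ e = subst₂ ℚ._≤_
    (trans (sym (neg-sub ℚ.∣ p ∣ ℚ.∣ q ∣)) (sym e)) (∣p-q∣≡∣q-p∣ q p)
    (∣p∣-∣q∣≤∣p-q∣ q p)

open RationalLemmas

-- The existential is a Σ-type, so a proof of IsCauchy carries a modulus.
IsCauchy : (ℕ → ℚ) → Set
IsCauchy x = ∀ ε → 0ℚ ℚ.< ε →
  ∃ λ N → ∀ m n → N ℕ.≤ m → N ℕ.≤ n → ℚ.∣ x m ℚ.- x n ∣ ℚ.< ε

record ℝ : Set where
  field
    seq    : ℕ → ℚ
    cauchy : IsCauchy seq

open ℝ public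

infix 4 _≃_ _<_

-- Equality of reals; Agda's _≡_ would compare representing sequences.
_≃_ : ℝ → ℝ → Set
x ≃ y = ∀ ε → 0ℚ ℚ.< ε →
  ∃ λ N → ∀ n → N ℕ.≤ n → ℚ.∣ seq x n ℚ.- seq y n ∣ ℚ.< ε

_<_ : ℝ → ℝ → Set
x < y = ∃ λ δ → 0ℚ ℚ.< δ ×
  ∃ λ N → ∀ n → N ℕ.≤ n → seq x n ℚ.+ δ ℚ.≤ seq y n

fromℚ : ℚ → ℝ
fromℚ q = record
  { seq    = λ _ → q
  ; cauchy = λ ε 0<ε → 0 , λ _ _ _ _ →
      subst (λ z → ℚ.∣ z ∣ ℚ.< ε) (sym (ℚₚ.+-inverseʳ q)) 0<ε
  }

infix  8 -_
infixl 7 _*_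
infixl 6 _+_ _-_

_+_ : ℝ → ℝ → ℝ
x + y = record { seq = λ n → seq x n ℚ.+ seq y n ; cauchy = c }
  where
    c : IsCauchy (λ n → seq x n ℚ.+ seq y n)
    c ε 0<ε =
      let N₁ , h₁ = cauchy x (ε ℚ.* ½) (half-pos 0<ε)
          N₂ , h₂ = cauchy y (ε ℚ.* ½) (half-pos 0<ε)
      in N₁ ℕ.⊔ N₂ , λ m n N≤m N≤n →
      subst₂ (λ a b → ℚ.∣ a ∣ ℚ.< b)
        (add-sub (seq x m) (seq x n) (seq y m) (seq y n))
        (half+half ε)
        (ℚₚ.≤-<-trans
          (ℚₚ.∣p+q∣≤∣p∣+∣q∣ (seq x m ℚ.- seq x n) (seq y m ℚ.- seq y n))
          (ℚₚ.+-mono-<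
            (h₁ m n (ℕₚ.m⊔n≤o⇒m≤o N₁ N₂ N≤m) (ℕₚ.m⊔n≤o⇒m≤o N₁ N₂ N≤n))
            (h₂ m n (ℕₚ.m⊔n≤o⇒n≤o N₁ N₂ N≤m) (ℕₚ.m⊔n≤o⇒n≤o N₁ N₂ N≤n))))

-_ : ℝ → ℝ
- x = record { seq = λ n → ℚ.- seq x n ; cauchy = c }
  where
    c : IsCauchy (λ n → ℚ.- seq x n)
    c ε 0<ε with cauchy x ε 0<ε
    ... | N , h = N , λ m n N≤m N≤n →
      subst (λ z → ℚ.∣ z ∣ ℚ.< ε)
        (sub-neg (seq x m) (seq x n))
        (h n m N≤n N≤m)

_-_ : ℝ → ℝ → ℝ
x - y = x + (- y)

∣_∣ : ℝ → ℝ
∣ x ∣ = record { seq = λ n → ℚ.∣ seq x n ∣ ; cauchy = c }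
  where
    c : IsCauchy (λ n → ℚ.∣ seq x n ∣)
    c ε 0<ε with cauchy x ε 0<ε
    ... | N , h = N , λ m n N≤m N≤n →
      ℚₚ.≤-<-trans (∣∣p∣-∣q∣∣≤∣p-q∣ (seq x m) (seq x n)) (h m n N≤m N≤n)

module BoundLemmas where
  bounded : ∀ x → ∃ λ B → 0ℚ ℚ.< B ×
    ∃ λ N → ∀ n → N ℕ.≤ n → ℚ.∣ seq x n ∣ ℚ.≤ B
  bounded x with cauchy x 1ℚ (ℚₚ.positive⁻¹ 1ℚ)
  ... | N , h = 1ℚ ℚ.+ ℚ.∣ seq x N ∣
    , ℚₚ.+-mono-<-≤ (ℚₚ.positive⁻¹ 1ℚ) (ℚₚ.0≤∣p∣ (seq x N))
    , N , λ n N≤n →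
      subst (λ z → ℚ.∣ z ∣ ℚ.≤ 1ℚ ℚ.+ ℚ.∣ seq x N ∣)
        (a-b+b (seq x n) (seq x N))
        (ℚₚ.≤-trans (ℚₚ.∣p+q∣≤∣p∣+∣q∣ (seq x n ℚ.- seq x N) (seq x N))
          (ℚₚ.+-monoˡ-≤ ℚ.∣ seq x N ∣ (ℚₚ.<⇒≤ (h n N N≤n ℕₚ.≤-refl))))

  scale : ∀ B → 0ℚ ℚ.< B → ∀ ε → 0ℚ ℚ.< ε → ∃ λ δ → 0ℚ ℚ.< δ × B ℚ.* δ ≡ ε
  scale B 0<B ε 0<ε = (ℚ.1/ B) ℚ.* ε
    , *-pos (ℚₚ.positive⁻¹ (ℚ.1/ B) {{ℚₚ.1/pos⇒pos B}}) 0<ε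
    , trans (sym (ℚₚ.*-assoc B (ℚ.1/ B) ε))
        (trans (cong (ℚ._* ε) (ℚₚ.*-inverseʳ B)) (ℚₚ.*-identityˡ ε))
    where
      instance
        B-pos : ℚ.Positive B
        B-pos = ℚ.positive 0<B
        B-nz : ℚ.NonZero B
        B-nz = ℚₚ.pos⇒nonZero B

  ∣p*q∣< : ∀ p q {B δ ε} → 0ℚ ℚ.< B → B ℚ.* δ ≡ ε →
           ℚ.∣ p ∣ ℚ.≤ B → ℚ.∣ q ∣ ℚ.< δ → ℚ.∣ p ℚ.* q ∣ ℚ.< ε
  ∣p*q∣< p q {B} 0<B eq p≤B q<δ = subst₂ ℚ._<_ (sym (ℚₚ.∣p*q∣≡∣p∣*∣q∣ p q)) eq
    (ℚₚ.≤-<-trans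
      (ℚₚ.*-monoʳ-≤-nonNeg ℚ.∣ q ∣ {{ℚₚ.∣-∣-nonNeg q}} p≤B)
      (ℚₚ.*-monoʳ-<-pos B {{ℚ.positive 0<B}} q<δ))

open BoundLemmas

_*_ : ℝ → ℝ → ℝ
x * y = record { seq = λ n → seq x n ℚ.* seq y n ; cauchy = c }
  where
    c : IsCauchy (λ n → seq x n ℚ.* seq y n)
    c ε 0<ε =
      let B , 0<B , N₁ , hB = bounded x
          C , 0<C , N₂ , hC = bounded y
          δ , 0<δ , eB = scale B 0<B (ε ℚ.* ½) (half-pos 0<ε)
          γ , 0<γ , eC = scale C 0<C (ε ℚ.* ½) (half-pos 0<ε)
          N₃ , hy = cauchy y δ 0<δ
          N₄ , hx = cauchy x γ 0<γ
      in N₁ ℕ.⊔ N₂ ℕ.⊔ (N₃ ℕ.⊔ N₄) , λ m n N≤m N≤n →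
      let m₁₂ = ℕₚ.m⊔n≤o⇒m≤o (N₁ ℕ.⊔ N₂) (N₃ ℕ.⊔ N₄) N≤m
          n₁₂ = ℕₚ.m⊔n≤o⇒m≤o (N₁ ℕ.⊔ N₂) (N₃ ℕ.⊔ N₄) N≤n
          m₃₄ = ℕₚ.m⊔n≤o⇒n≤o (N₁ ℕ.⊔ N₂) (N₃ ℕ.⊔ N₄) N≤m
          n₃₄ = ℕₚ.m⊔n≤o⇒n≤o (N₁ ℕ.⊔ N₂) (N₃ ℕ.⊔ N₄) N≤n
          xm = seq x m ; xn = seq x n ; ym = seq y m ; yn = seq y n
          dy = hy m n (ℕₚ.m⊔n≤o⇒m≤o N₃ N₄ m₃₄) (ℕₚ.m⊔n≤o⇒m≤o N₃ N₄ n₃₄)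
          dx = hx m n (ℕₚ.m⊔n≤o⇒n≤o N₃ N₄ m₃₄) (ℕₚ.m⊔n≤o⇒n≤o N₃ N₄ n₃₄)
      in subst₂ (λ a b → ℚ.∣ a ∣ ℚ.< b) (mul-sub xm xn ym yn) (half+half ε)
           (ℚₚ.≤-<-trans
             (ℚₚ.∣p+q∣≤∣p∣+∣q∣ (xm ℚ.* (ym ℚ.- yn)) (yn ℚ.* (xm ℚ.- xn)))
             (ℚₚ.+-mono-<
               (∣p*q∣< xm (ym ℚ.- yn) 0<B eB (hB m (ℕₚ.m⊔n≤o⇒m≤o N₁ N₂ m₁₂)) dy)
               (∣p*q∣< yn (xm ℚ.- xn) 0<C eC (hC n (ℕₚ.m⊔n≤o⇒n≤o N₁ N₂ n₁₂)) dx)))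

module RecipLemmas where
  ⊔-pos : ∀ q {δ} → 0ℚ ℚ.< δ → ℚ.Positive (q ℚ.⊔ δ)
  ⊔-pos q {δ} 0<δ = ℚ.positive (ℚₚ.<-≤-trans 0<δ (ℚₚ.p≤q⊔p q δ))

  recip₊ : ∀ q → .(ℚ.Positive q) → ℚ
  recip₊ q q>0 = (ℚ.1/ q) {{ℚₚ.pos⇒nonZero q {{q>0}}}}

  recip₊-close : ∀ {δ ε} a b .(a>0 : ℚ.Positive a) .(b>0 : ℚ.Positive b) →
    0ℚ ℚ.< δ → δ ℚ.≤ a → δ ℚ.≤ b → 0ℚ ℚ.< ε →
    ℚ.∣ a ℚ.- b ∣ ℚ.< ε ℚ.* (δ ℚ.* δ) →
    ℚ.∣ recip₊ a a>0 ℚ.- recip₊ b b>0 ∣ ℚ.< ε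
  recip₊-close {δ} {ε} a b a>0 b>0 0<δ δ≤a δ≤b 0<ε h =
    ℚₚ.*-cancelʳ-<-nonNeg (a ℚ.* b) {{ℚₚ.pos⇒nonNeg (a ℚ.* b)}}
      (ℚₚ.<-≤-trans (subst (ℚ._< ε ℚ.* (δ ℚ.* δ)) (sym e) h)
        (ℚₚ.*-monoˡ-≤-nonNeg ε {{ℚₚ.pos⇒nonNeg ε {{ℚ.positive 0<ε}}}}
          (*-mono-≤₀ (ℚₚ.<⇒≤ 0<δ) (ℚₚ.≤-trans (ℚₚ.<⇒≤ 0<δ) δ≤a) δ≤a δ≤b)))
    where
      instance
        a-pos : ℚ.Positive a
        a-pos = ℚ.positive (ℚₚ.<-≤-trans 0<δ δ≤a)
        b-pos : ℚ.Positive b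
        b-pos = ℚ.positive (ℚₚ.<-≤-trans 0<δ δ≤b)
        a-nz : ℚ.NonZero a
        a-nz = ℚₚ.pos⇒nonZero a
        b-nz : ℚ.NonZero b
        b-nz = ℚₚ.pos⇒nonZero b
        ab-pos : ℚ.Positive (a ℚ.* b)
        ab-pos = ℚₚ.pos*pos⇒pos a b
      1/a = ℚ.1/ a
      1/b = ℚ.1/ b
      alg : (1/a ℚ.- 1/b) ℚ.* (a ℚ.* b) ≡ b ℚ.- a
      alg = trans
        (recip-sub a b 1/a 1/b)
        (cong₂ ℚ._-_
          (trans (cong (ℚ._* b) (ℚₚ.*-inverseʳ a)) (ℚₚ.*-identityˡ b))
          (trans (cong (ℚ._* a) (ℚₚ.*-inverseʳ b)) (ℚₚ.*-identityˡ a)))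
      e : ℚ.∣ 1/a ℚ.- 1/b ∣ ℚ.* (a ℚ.* b) ≡ ℚ.∣ a ℚ.- b ∣
      e = trans (cong (ℚ.∣ 1/a ℚ.- 1/b ∣ ℚ.*_)
                  (sym (ℚₚ.0≤p⇒∣p∣≡p (ℚₚ.<⇒≤ (ℚₚ.positive⁻¹ (a ℚ.* b))))))
            (trans (sym (ℚₚ.∣p*q∣≡∣p∣*∣q∣ (1/a ℚ.- 1/b) (a ℚ.* b)))
              (trans (cong ℚ.∣_∣ alg) (∣p-q∣≡∣q-p∣ b a)))

open RecipLemmas

-- Eventually δ ≤ seq x n, so truncating below at δ changes only finitely
-- many terms and keeps every reciprocal defined.
recip : (x : ℝ) → fromℚ 0ℚ < x → ℝ
recip x (δ , 0<δ , N , h) = record { seq = r ; cauchy = c }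
  where
    r : ℕ → ℚ
    r n = recip₊ (seq x n ℚ.⊔ δ) (⊔-pos (seq x n) 0<δ)
    tail : ∀ n → N ℕ.≤ n → seq x n ℚ.⊔ δ ≡ seq x n
    tail n N≤n = ℚₚ.p≥q⇒p⊔q≡p (subst (ℚ._≤ seq x n) (ℚₚ.+-identityˡ δ) (h n N≤n))
    c : IsCauchy r
    c ε 0<ε =
      let M , k = cauchy x (ε ℚ.* (δ ℚ.* δ)) (*-pos 0<ε (*-pos 0<δ 0<δ))
      in N ℕ.⊔ M , λ m n N≤m N≤n →
      recip₊-close (seq x m ℚ.⊔ δ) (seq x n ℚ.⊔ δ)
        (⊔-pos (seq x m) 0<δ) (⊔-pos (seq x n) 0<δ)
        0<δ (ℚₚ.p≤q⊔p (seq x m) δ) (ℚₚ.p≤q⊔p (seq x n) δ) 0<ε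
        (subst₂ (λ a b → ℚ.∣ a ℚ.- b ∣ ℚ.< ε ℚ.* (δ ℚ.* δ))
          (sym (tail m (ℕₚ.m⊔n≤o⇒m≤o N M N≤m)))
          (sym (tail n (ℕₚ.m⊔n≤o⇒m≤o N M N≤n)))
          (k m n (ℕₚ.m⊔n≤o⇒n≤o N M N≤m) (ℕₚ.m⊔n≤o⇒n≤o N M N≤n)))

infix 4 _⟶_ _sumsTo_

_⟶_ : (ℕ → ℝ) → ℝ → Set
X ⟶ s = ∀ ε → 0ℚ ℚ.< ε →
  ∃ λ N → ∀ n → N ℕ.≤ n → ∣ X n - s ∣ < fromℚ ε

partialSum : (ℕ → ℚ) → ℕ → ℚ
partialSum a zero    = 0ℚ
partialSum a (suc n) = partialSum a n ℚ.+ a n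

_sumsTo_ : (ℕ → ℚ) → ℝ → Set
a sumsTo s = (λ n → fromℚ (partialSum a n)) ⟶ s

∑ : ℕ → (ℕ → ℕ) → ℕ
∑ zero    f = 0
∑ (suc n) f = ∑ n f ℕ.+ f n

indicator : {P : Set} → Dec P → ℕ
indicator d = if does d then 1 else 0

inDisc : ℕ → ℕ → ℕ → ℕ
inDisc N i j = indicator (i ℕ.* i ℕ.+ j ℕ.* j ℕ.≤? N ℕ.* N)

-- The number of cells [i/N,(i+1)/N] × [j/N,(j+1)/N] with i, j ≥ 0 contained
-- in the unit disc: a cell lies in the disc iff its far corner does.
cells : ℕ → ℕ
cells N = ∑ N λ i → ∑ N λ j → inDisc N (suc i) (suc j)

-- The total area of the cells of the mesh of width 1/N, N = n + 1, contained
-- in the unit disc, which by symmetry is four times that in one quadrant.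
discArea : ℕ → ℚ
discArea n = + (4 ℕ.* cells (suc n)) ℚ./ (suc n ℕ.* suc n)

module DiscLemmas where
  ∑-mono : ∀ n {f g} → (∀ i → f i ℕ.≤ g i) → ∑ n f ℕ.≤ ∑ n g
  ∑-mono zero    h = z≤n
  ∑-mono (suc n) h = ℕₚ.+-mono-≤ (∑-mono n h) (h n)

  ∑-const : ∀ n c → ∑ n (λ _ → c) ≡ c ℕ.* n
  ∑-const zero    c = sym (ℕₚ.*-zeroʳ c)
  ∑-const (suc n) c = trans (cong (ℕ._+ c) (∑-const n c))
    (trans (ℕₚ.+-comm (c ℕ.* n) c) (sym (ℕₚ.*-suc c n)))

  ∑-*ʳ : ∀ n f c → ∑ n (λ i → f i ℕ.* c) ≡ ∑ n f ℕ.* c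
  ∑-*ʳ zero    f c = refl
  ∑-*ʳ (suc n) f c = trans (cong (ℕ._+ f n ℕ.* c) (∑-*ʳ n f c))
    (sym (ℕₚ.*-distribʳ-+ c (∑ n f) (f n)))

  ∑-cong : ∀ n {f g} → (∀ i → f i ≡ g i) → ∑ n f ≡ ∑ n g
  ∑-cong zero    h = refl
  ∑-cong (suc n) h = cong₂ ℕ._+_ (∑-cong n h) (h n)

  ∑-append : ∀ m n f → ∑ (n ℕ.+ m) f ≡ ∑ m f ℕ.+ ∑ n (λ i → f (i ℕ.+ m))
  ∑-append m zero    f = sym (ℕₚ.+-identityʳ _)
  ∑-append m (suc n) f = trans (cong (ℕ._+ f (n ℕ.+ m)) (∑-append m n f))
    (ℕₚ.+-assoc (∑ m f) _ _)

  ∑-blocks : ∀ n M f → ∑ (n ℕ.* M) f ≡ ∑ n (λ i → ∑ M (λ a → f (a ℕ.+ i ℕ.* M)))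
  ∑-blocks zero    M f = refl
  ∑-blocks (suc n) M f = trans (∑-append (n ℕ.* M) M f)
    (cong (ℕ._+ ∑ M (λ a → f (a ℕ.+ n ℕ.* M))) (∑-blocks n M f))

  ∑-shift : ∀ n f → ∑ n f ℕ.≤ f 0 ℕ.+ ∑ n (λ i → f (suc i))
  ∑-shift zero    f = z≤n
  ∑-shift (suc n) f = ℕₚ.≤-trans (ℕₚ.≤-reflexive (eq n)) (ℕₚ.+-monoʳ-≤ (f 0) (ℕₚ.m≤m+n _ _))
    where
      eq : ∀ n → ∑ n f ℕ.+ f n ≡ f 0 ℕ.+ ∑ n (λ i → f (suc i))
      eq zero    = sym (ℕₚ.+-identityʳ _)
      eq (suc n) = trans (cong (ℕ._+ f (suc n)) (eq n)) (ℕₚ.+-assoc (f 0) _ _)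

  ∑-+ : ∀ n f g → ∑ n (λ i → f i ℕ.+ g i) ≡ ∑ n f ℕ.+ ∑ n g
  ∑-+ zero    f g = refl
  ∑-+ (suc n) f g = trans (cong (ℕ._+ (f n ℕ.+ g n)) (∑-+ n f g))
    (solve 4 (λ a b c d → (a :+ b) :+ (c :+ d) := (a :+ c) :+ (b :+ d)) refl
      (∑ n f) (∑ n g) (f n) (g n))
    where
      open ℕ-Solver.+-*-Solver

  indicator-mono : {P Q : Set} (p? : Dec P) (q? : Dec Q) → (P → Q) →
                   indicator p? ℕ.≤ indicator q?
  indicator-mono (yes p) (yes q) f = ℕₚ.≤-refl
  indicator-mono (yes p) (no ¬q) f = ⊥-elim (¬q (f p))
  indicator-mono (no ¬p) q?      f = z≤n

  indicator≤1 : {P : Set} (p? : Dec P) → indicator p? ℕ.≤ 1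
  indicator≤1 (yes p) = ℕₚ.≤-refl
  indicator≤1 (no ¬p) = z≤n

  inDisc≤1 : ∀ N i j → inDisc N i j ℕ.≤ 1
  inDisc≤1 N i j = indicator≤1 (i ℕ.* i ℕ.+ j ℕ.* j ℕ.≤? N ℕ.* N)

  sq-scale : ∀ i j M → (i ℕ.* M) ℕ.* (i ℕ.* M) ℕ.+ (j ℕ.* M) ℕ.* (j ℕ.* M)
                     ≡ (i ℕ.* i ℕ.+ j ℕ.* j) ℕ.* (M ℕ.* M)
  sq-scale = solve 3 (λ i j M → (i :* M) :* (i :* M) :+ (j :* M) :* (j :* M)
                             := (i :* i :+ j :* j) :* (M :* M)) refl
    where
      open ℕ-Solver.+-*-Solver

  sq-scale₁ : ∀ N M → (N ℕ.* M) ℕ.* (N ℕ.* M) ≡ (N ℕ.* N) ℕ.* (M ℕ.* M)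
  sq-scale₁ = solve 2 (λ N M → (N :* M) :* (N :* M) := (N :* N) :* (M :* M)) refl
    where
      open ℕ-Solver.+-*-Solver

  sq-mono : ∀ {a b c d} → a ℕ.≤ b → c ℕ.≤ d → a ℕ.* a ℕ.+ c ℕ.* c ℕ.≤ b ℕ.* b ℕ.+ d ℕ.* d
  sq-mono p q = ℕₚ.+-mono-≤ (ℕₚ.*-mono-≤ p p) (ℕₚ.*-mono-≤ q q)

  inDisc-lower : ∀ N M i j {I J} → I ℕ.≤ i ℕ.* M → J ℕ.≤ j ℕ.* M →
                 inDisc N i j ℕ.≤ inDisc (N ℕ.* M) I J
  inDisc-lower N M i j {I} {J} I≤ J≤ = indicator-mono
    (i ℕ.* i ℕ.+ j ℕ.* j ℕ.≤? N ℕ.* N)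
    (I ℕ.* I ℕ.+ J ℕ.* J ℕ.≤? (N ℕ.* M) ℕ.* (N ℕ.* M)) λ h →
    ℕₚ.≤-trans (sq-mono I≤ J≤)
      (subst₂ ℕ._≤_ (sym (sq-scale i j M)) (sym (sq-scale₁ N M))
        (ℕₚ.*-monoˡ-≤ (M ℕ.* M) h))

  inDisc-upper : ∀ N M .{{_ : ℕ.NonZero M}} i j {I J} → i ℕ.* M ℕ.≤ I → j ℕ.* M ℕ.≤ J →
                 inDisc (N ℕ.* M) I J ℕ.≤ inDisc N i j
  inDisc-upper N M i j {I} {J} I≥ J≥ = indicator-mono
    (I ℕ.* I ℕ.+ J ℕ.* J ℕ.≤? (N ℕ.* M) ℕ.* (N ℕ.* M))
    (i ℕ.* i ℕ.+ j ℕ.* j ℕ.≤? N ℕ.* N) λ h →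
    ℕₚ.*-cancelʳ-≤ _ _ (M ℕ.* M) {{ℕₚ.m*n≢0 M M}}
      (subst₂ ℕ._≤_ (sq-scale i j M) (sq-scale₁ N M)
        (ℕₚ.≤-trans (sq-mono I≥ J≥) h))

  ∑-∑-const : ∀ N M (f : ℕ → ℕ → ℕ) →
    ∑ N (λ i → ∑ M (λ _ → ∑ N (λ j → ∑ M (λ _ → f i j)))) ≡
    ∑ N (λ i → ∑ N (f i)) ℕ.* (M ℕ.* M)
  ∑-∑-const N M f = trans
    (∑-cong N λ i → trans
      (∑-const M _)
      (trans (cong (ℕ._* M) (trans (∑-cong N (λ j → ∑-const M (f i j))) (∑-*ʳ N (f i) M)))
        (ℕₚ.*-assoc (∑ N (f i)) M M)))
    (∑-*ʳ N (λ i → ∑ N (f i)) (M ℕ.* M))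

  cells-blocks : ∀ N M → cells (N ℕ.* M) ≡
    ∑ N (λ i → ∑ M (λ a → ∑ N (λ j → ∑ M (λ b →
      inDisc (N ℕ.* M) (suc (a ℕ.+ i ℕ.* M)) (suc (b ℕ.+ j ℕ.* M))))))
  cells-blocks N M = trans (∑-blocks N M _)
    (∑-cong N λ i → ∑-cong M λ a → ∑-blocks N M _)

  ∑-mono< : ∀ n {f g} → (∀ i → i ℕ.< n → f i ℕ.≤ g i) → ∑ n f ℕ.≤ ∑ n g
  ∑-mono< zero    h = z≤n
  ∑-mono< (suc n) h = ℕₚ.+-mono-≤ (∑-mono< n (λ i i<n → h i (ℕₚ.m<n⇒m<1+n i<n)))
                                  (h n ℕₚ.≤-refl)

  cells-lower : ∀ N M → cells N ℕ.* (M ℕ.* M) ℕ.≤ cells (N ℕ.* M)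
  cells-lower N M = subst₂ ℕ._≤_
    (∑-∑-const N M (λ i j → inDisc N (suc i) (suc j))) (sym (cells-blocks N M))
    (∑-mono N λ i → ∑-mono< M λ a a<M → ∑-mono N λ j → ∑-mono< M λ b b<M →
      inDisc-lower N M (suc i) (suc j)
        (ℕₚ.+-monoˡ-≤ (i ℕ.* M) a<M) (ℕₚ.+-monoˡ-≤ (j ℕ.* M) b<M))

  touching : ∀ N → ∑ N (λ i → ∑ N (inDisc N i)) ℕ.≤ cells N ℕ.+ 2 ℕ.* N
  touching N = begin
    ∑ N (λ i → ∑ N (inDisc N i))
      ≤⟨ ∑-shift N _ ⟩
    ∑ N (inDisc N 0) ℕ.+ ∑ N (λ i → ∑ N (inDisc N (suc i)))
      ≤⟨ ℕₚ.+-mono-≤ (∑-mono N (inDisc≤1 N 0)) (∑-mono N λ i → ∑-shift N (inDisc N (suc i))) ⟩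
    ∑ N (λ _ → 1) ℕ.+ ∑ N (λ i → inDisc N (suc i) 0 ℕ.+ ∑ N (λ j → inDisc N (suc i) (suc j)))
      ≡⟨ cong (∑ N (λ _ → 1) ℕ.+_) (∑-+ N _ _) ⟩
    ∑ N (λ _ → 1) ℕ.+ (∑ N (λ i → inDisc N (suc i) 0) ℕ.+ cells N)
      ≤⟨ ℕₚ.+-monoʳ-≤ (∑ N (λ _ → 1)) (ℕₚ.+-monoˡ-≤ (cells N)
           (∑-mono N λ i → inDisc≤1 N (suc i) 0)) ⟩
    ∑ N (λ _ → 1) ℕ.+ (∑ N (λ _ → 1) ℕ.+ cells N)
      ≡⟨ cong (λ z → z ℕ.+ (z ℕ.+ cells N)) (trans (∑-const N 1) (ℕₚ.*-identityˡ N)) ⟩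
    N ℕ.+ (N ℕ.+ cells N)
      ≡⟨ solve 2 (λ N c → N :+ (N :+ c) := c :+ con 2 :* N) refl N (cells N) ⟩
    cells N ℕ.+ 2 ℕ.* N ∎
    where
      open ℕₚ.≤-Reasoning
      open ℕ-Solver.+-*-Solver

  cells-upper : ∀ N M .{{_ : ℕ.NonZero M}} →
                cells (N ℕ.* M) ℕ.≤ (cells N ℕ.+ 2 ℕ.* N) ℕ.* (M ℕ.* M)
  cells-upper N M = ℕₚ.≤-trans
    (subst₂ ℕ._≤_ (sym (cells-blocks N M)) (∑-∑-const N M (inDisc N))
      (∑-mono N λ i → ∑-mono M λ a → ∑-mono N λ j → ∑-mono M λ b →
        inDisc-upper N M i j
          (ℕₚ.m≤n⇒m≤1+n (ℕₚ.m≤n+m (i ℕ.* M) a)) (ℕₚ.m≤n⇒m≤1+n (ℕₚ.m≤n+m (j ℕ.* M) b))))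
    (ℕₚ.*-monoˡ-≤ (M ℕ.* M) (touching N))

  cells-compare : ∀ N M .{{_ : ℕ.NonZero N}} →
    cells N ℕ.* (M ℕ.* M) ℕ.≤ (cells M ℕ.+ 2 ℕ.* M) ℕ.* (N ℕ.* N)
  cells-compare N M = ℕₚ.≤-trans (cells-lower N M)
    (subst (λ z → cells z ℕ.≤ (cells M ℕ.+ 2 ℕ.* M) ℕ.* (N ℕ.* N)) (ℕₚ.*-comm M N)
      (cells-upper M N))

  toℚᵘ-/ : ∀ a b → ℚ.toℚᵘ (+ a ℚ./ suc b) ℚᵘ.≃ ℚᵘ.mkℚᵘ (+ a) b
  toℚᵘ-/ a b = ℚₚ.toℚᵘ-fromℚᵘ (ℚᵘ.mkℚᵘ (+ a) b)

  /-≤ : ∀ a b c d → a ℕ.* suc d ℕ.≤ c ℕ.* suc b → + a ℚ./ suc b ℚ.≤ + c ℚ./ suc d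
  /-≤ a b c d h = ℚₚ.toℚᵘ-cancel-≤
    (ℚᵘₚ.≤-respˡ-≃ (ℚᵘₚ.≃-sym (toℚᵘ-/ a b)) (ℚᵘₚ.≤-respʳ-≃ (ℚᵘₚ.≃-sym (toℚᵘ-/ c d))
      (ℚᵘ.*≤* (subst₂ ℤ._≤_ (ℤₚ.pos-* a (suc d)) (ℤₚ.pos-* c (suc b)) (ℤ.+≤+ h)))))

  /-< : ∀ a b c d → a ℕ.* suc d ℕ.< c ℕ.* suc b → + a ℚ./ suc b ℚ.< + c ℚ./ suc d
  /-< a b c d h = ℚₚ.toℚᵘ-cancel-<
    (ℚᵘₚ.<-respˡ-≃ (ℚᵘₚ.≃-sym (toℚᵘ-/ a b)) (ℚᵘₚ.<-respʳ-≃ (ℚᵘₚ.≃-sym (toℚᵘ-/ c d))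
      (ℚᵘ.*<* (subst₂ ℤ._<_ (ℤₚ.pos-* a (suc d)) (ℤₚ.pos-* c (suc b)) (ℤ.+<+ h)))))

  /-+ : ∀ a b c d → (+ a ℚ./ suc b) ℚ.+ (+ c ℚ./ suc d)
                  ≡ + (a ℕ.* suc d ℕ.+ c ℕ.* suc b) ℚ./ (suc b ℕ.* suc d)
  /-+ a b c d = ℚₚ.toℚᵘ-injective (ℚᵘₚ.≃-trans (ℚₚ.toℚᵘ-homo-+ (+ a ℚ./ suc b) (+ c ℚ./ suc d))
    (ℚᵘₚ.≃-trans (ℚᵘₚ.+-cong (toℚᵘ-/ a b) (toℚᵘ-/ c d))
      (ℚᵘₚ.≃-trans (ℚᵘₚ.≃-reflexive (cong (λ z → ℚᵘ.mkℚᵘ z (d ℕ.+ b ℕ.* suc d)) num))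
        (ℚᵘₚ.≃-sym (toℚᵘ-/ _ (d ℕ.+ b ℕ.* suc d))))))
    where
      num : (+ a) ℤ.* (+ suc d) ℤ.+ (+ c) ℤ.* (+ suc b) ≡ + (a ℕ.* suc d ℕ.+ c ℕ.* suc b)
      num = trans (cong₂ ℤ._+_ (sym (ℤₚ.pos-* a (suc d))) (sym (ℤₚ.pos-* c (suc b))))
              (sym (ℤₚ.pos-+ (a ℕ.* suc d) (c ℕ.* suc b)))

  discArea-compare : ∀ n m → discArea n ℚ.≤ discArea m ℚ.+ (+ 8 ℚ./ suc m)
  discArea-compare n m = subst (discArea n ℚ.≤_)
    (sym (/-+ (4 ℕ.* cells M) (m ℕ.+ m ℕ.* M) 8 m))
    (/-≤ (4 ℕ.* cells N) (n ℕ.+ n ℕ.* N)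
         (4 ℕ.* cells M ℕ.* M ℕ.+ 8 ℕ.* (M ℕ.* M)) (m ℕ.+ (m ℕ.+ m ℕ.* M) ℕ.* M)
      (begin
        4 ℕ.* cells N ℕ.* (M ℕ.* M ℕ.* M)
          ≡⟨ solve 2 (λ c M → con 4 :* c :* (M :* M :* M) := con 4 :* M :* (c :* (M :* M))) refl
               (cells N) M ⟩
        4 ℕ.* M ℕ.* (cells N ℕ.* (M ℕ.* M))
          ≤⟨ ℕₚ.*-monoʳ-≤ (4 ℕ.* M) (cells-compare N M) ⟩
        4 ℕ.* M ℕ.* ((cells M ℕ.+ 2 ℕ.* M) ℕ.* (N ℕ.* N))
          ≡⟨ solve 3 (λ c M N → con 4 :* M :* ((c :+ con 2 :* M) :* (N :* N))
                := (con 4 :* c :* M :+ con 8 :* (M :* M)) :* (N :* N)) refl (cells M) M N ⟩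
        (4 ℕ.* cells M ℕ.* M ℕ.+ 8 ℕ.* (M ℕ.* M)) ℕ.* (N ℕ.* N) ∎))
    where
      open ℕₚ.≤-Reasoning
      open ℕ-Solver.+-*-Solver
      N = suc n
      M = suc m

  archimedean : ∀ ε → 0ℚ ℚ.< ε → ∃ λ K → ∀ m → K ℕ.≤ m → + 8 ℚ./ suc m ℚ.< ε
  archimedean ε@(mkℚ (+ zero) d _) 0<ε with ℚ.positive 0<ε
  ... | ()
  archimedean ε@(mkℚ (-[1+ p ]) d _) 0<ε with ℚ.positive 0<ε
  ... | ()
  archimedean ε@(mkℚ (+[1+ p ]) d _) 0<ε = 8 ℕ.* suc d , λ m K≤m →
    subst (+ 8 ℚ./ suc m ℚ.<_) (ℚₚ.↥p/↧p≡p ε)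
      (/-< 8 m (suc p) d (ℕₚ.≤-trans (s≤s K≤m) (ℕₚ.m≤m+n (suc m) (p ℕ.* suc m))))

  discArea-diff : ∀ m n → discArea m ℚ.- discArea n ℚ.≤ + 8 ℚ./ suc n
  discArea-diff m n = subst (discArea m ℚ.- discArea n ℚ.≤_)
    (a+b-a (discArea n) (+ 8 ℚ./ suc n))
    (ℚₚ.+-monoˡ-≤ (ℚ.- discArea n) (discArea-compare m n))

  discArea-cauchy : IsCauchy discArea
  discArea-cauchy ε 0<ε =
    let K , h = archimedean ε 0<ε
    in K , λ m n K≤m K≤n → ∣p∣<-intro
      (ℚₚ.≤-<-trans (discArea-diff m n) (h n K≤n))
      (subst (ℚ._< ε) (sym (neg-sub (discArea m) (discArea n)))
        (ℚₚ.≤-<-trans (discArea-diff n m) (h m K≤m)))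

open DiscLemmas

-- Defined as the area (Jordan content) of the unit disc.
π : ℝ
π = record { seq = discArea ; cauchy = discArea-cauchy }

π>0 : fromℚ 0ℚ < π
π>0 = ½ , 0<½ , 15 , λ n 15≤n →
  subst (ℚ._≤ discArea n) (sym (ℚₚ.+-identityˡ ½))
    (subst₂ ℚ._≤_ refl
      (a+b-b (discArea n) ½)
      (ℚₚ.+-monoˡ-≤ (ℚ.- ½)
        (ℚₚ.≤-trans (discArea-compare 1 n)
          (ℚₚ.+-monoʳ-≤ (discArea n)
            (/-≤ 8 n 1 1 (subst (16 ℕ.≤_) (sym (ℕₚ.*-identityˡ (suc n))) (s≤s 15≤n)))))))

fromℕ : ℕ → ℚ
fromℕ n = + n ℚ./ 1

infixl 7 _/ℕ_

_/ℕ_ : ℚ → (d : ℕ) → .{{ℕ.NonZero d}} → ℚ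
q /ℕ d = q ℚ.* (+ 1 ℚ./ d)

rising : ℚ → ℕ → ℚ
rising x zero    = 1ℚ
rising x (suc n) = rising x n ℚ.* (x ℚ.+ fromℕ n)

falling : ℚ → ℕ → ℚ
falling x zero    = 1ℚ
falling x (suc n) = falling x n ℚ.* (x ℚ.- fromℕ n)

summand : ℕ → ℕ → ℕ → ℚ
summand m k n =
  ( rising  (fromℕ m ℚ.+ ½) n
  ℚ.* falling (fromℕ m ℚ.- ½) n
  ℚ.* rising  (fromℕ m ℚ.+ ½) (k ℕ.+ n)
  ℚ.* (fromℕ (k ℕ.+ m ℕ.+ 2 ℕ.* n) ℚ.+ ½) )
  /ℕ (n ! ℕ.* (k ℕ.+ n) ! ℕ.* (2 ℕ.* m ℕ.+ k ℕ.+ n) !)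
  where
    instance
      _ = ℕₚ.m*n≢0 (n ! ℕ.* (k ℕ.+ n) !) ((2 ℕ.* m ℕ.+ k ℕ.+ n) !)
            {{n ℕₚ.!* (k ℕ.+ n) !≢0}} {{(2 ℕ.* m ℕ.+ k ℕ.+ n) ℕₚ.!≢0}}

prefactor : ℕ → ℕ → ℚ
prefactor m k =
  (rising ½ (m ℕ.+ k) /ℕ (2 ℕ.^ (2 ℕ.* m))) ℚ.* (fromℕ ((2 ℕ.* m) !) /ℕ (m !))
  where
    instance
      _ = ℕₚ.m^n≢0 2 (2 ℕ.* m)
      _ = m ℕₚ.!≢0

{-# OPTIONS --safe #-}

-- Put t(k, n) = prefactor · summand / (k + m + 2n + 1/2) and F = prefactor · summand.
-- Then (F, n t(k, n)) is a Wilf–Zeilberger pair: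
--   F(k + 1, n) - F(k, n) = (n + 1) t(k, n + 1) - n t(k, n),
-- so the partial sums Q(k, M) of F satisfy Q(k + 1, M) - Q(k, M) = M t(k, M).
-- The sign of t(k, M) does not depend on k and alternates in M for M ≥ m, and
-- Q(k, M) → 1/π as k → ∞; hence 1/π lies between Q(k, M) and Q(k, M + 1), and
-- F(k, M) → 0 as M → ∞ gives the sum.
--
-- As k → ∞ only F(k, 0) contributes to Q(k, M), and its limit is given by the
-- Wallis product.  The latter is compared with the area of the disc following
-- Wästlund: with a_i = (1/2)_i / i! and s_i = a_0 + ... + a_(i-1) = 2 i a_i, the
-- staircase made of the rectangles a_i × a_j with i + j < n has area n, and it lies
-- between the quarter discs of radii s_(n-1) and s_(n+1).

module Submission where

open import Defs hiding (_+_; _*_; _-_; -_; ∣_∣; _<_)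
import Defs as D
import Data.Nat as ℕ
import Data.Nat.Properties as ℕₚ
import Data.Nat.Solver as ℕ-Solver
open import Data.Nat using (ℕ; zero; suc; z≤n; s≤s; _≤_; _!)
import Data.Integer as ℤ
import Data.Integer.Properties as ℤₚ
import Data.Rational as ℚ
open import Data.Rational using (ℚ; 0ℚ; 1ℚ; ½)
import Data.Rational.Properties as ℚₚ
import Data.Rational.Solver as ℚ-Solver
import Data.Rational.Unnormalised as ℚᵘ
import Data.Rational.Unnormalised.Properties as ℚᵘₚ
open import Data.Product using (∃; _×_; _,_)
open import Data.Sum using (_⊎_; inj₁; inj₂)
open import Data.Empty using (⊥-elim)
open import Relation.Nullary using (Dec; yes; no; ¬_)
open import Relation.Binary.PropositionalEquality
  using (_≡_; refl; sym; trans; cong; cong₂; subst; subst₂; module ≡-Reasoning)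

open RationalLemmas
open RecipLemmas
open DiscLemmas

-- Since π is given only through lattice counts, the Wallis limit has to come from cell counts as
-- well. The staircase is therefore placed on an integer grid: the a_i with i ≤ L are multiplied by
-- a common denominator, and the radius of the disc is one of the resulting partial sums. The real
-- 1/π is represented by the reciprocals `r j` of the content at mesh 1/(j + 1). Each comparison of
-- a rational with 1/π is stated against `r j` with an error `e j` = 8/(j + 1) for all large j, so
-- the argument stays in the rationals up to the last step. The sign of t(k, M) is that of the
-- falling factorial of m - 1/2, because its other factors are nonnegative; the new factor m - 1/2 -
-- M is negative once M ≥ m, which is the source of the alternation. For fixed M the sums Q(k, M)
-- are thus monotone in k, and their limit becomes a one-sided bound at every k. As Q(k, 0) = 0,
-- that limit is available for M ≥ 1 only.

module FiniteSums where

  -- Finite sums of natural numbers.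

  open import Data.Nat using (_+_; _*_; _∸_; _<_)

  ∑-cong< : ∀ n {f g} → (∀ i → i < n → f i ≡ g i) → ∑ n f ≡ ∑ n g
  ∑-cong< n h = ℕₚ.≤-antisym (∑-mono< n (λ i i<n → ℕₚ.≤-reflexive (h i i<n)))
                             (∑-mono< n (λ i i<n → ℕₚ.≤-reflexive (sym (h i i<n))))

  ∑-mono-length : ∀ {m n} f → m ≤ n → ∑ m f ≤ ∑ n f
  ∑-mono-length {m} {n} f m≤n =
    subst (λ z → ∑ m f ≤ ∑ z f) (ℕₚ.m∸n+n≡m m≤n)
      (ℕₚ.≤-trans (ℕₚ.m≤m+n _ _) (ℕₚ.≤-reflexive (sym (∑-append m (n ∸ m) f))))

  ∑-suc-left : ∀ n f → ∑ (suc n) f ≡ f 0 + ∑ n (λ i → f (suc i))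
  ∑-suc-left n f = trans (cong (λ z → ∑ z f) (sym (ℕₚ.+-comm n 1)))
    (trans (∑-append 1 n f)
      (cong (f 0 +_) (∑-cong n (λ i → cong f (ℕₚ.+-comm i 1)))))

  ∑-reverse : ∀ n f → ∑ (suc n) f ≡ ∑ (suc n) (λ i → f (n ∸ i))
  ∑-reverse zero    f = refl
  ∑-reverse (suc n) f = sym (trans (∑-suc-left (suc n) (λ i → f (suc n ∸ i)))
    (trans (cong (f (suc n) +_) (sym (∑-reverse n f))) (ℕₚ.+-comm (f (suc n)) _)))

  ∑-ones : ∀ n {f} → (∀ i → i < n → f i ≡ 1) → ∑ n f ≡ n
  ∑-ones n h = trans (∑-cong< n h) (trans (∑-const n 1) (ℕₚ.*-identityˡ n))

  -- Applied to the cells above a fixed abscissa: if none of height m or more lies in the disc, at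
  -- most m of them do.
  ∑-supported : ∀ n m {f} → (∀ i → f i ≤ 1) → (∀ i → m ≤ i → f i ≡ 0) → ∑ n f ≤ m
  ∑-supported zero    m f≤1 off = z≤n
  ∑-supported (suc n) m {f} f≤1 off with suc n ℕ.≤? m
  ... | yes n<m = ℕₚ.≤-trans (∑-mono (suc n) f≤1)
    (ℕₚ.≤-trans (ℕₚ.≤-reflexive (trans (∑-const (suc n) 1) (ℕₚ.*-identityˡ _))) n<m)
  ... | no n≮m = ℕₚ.≤-trans
    (ℕₚ.≤-reflexive (trans (cong (∑ n f +_) (off n (ℕₚ.≤-pred (ℕₚ.≰⇒> n≮m)))) (ℕₚ.+-identityʳ _)))
    (∑-supported n m f≤1 off)

  -- `∑-blocks` for blocks of unequal length: the i-th block has length `α i` and starts at `∑ i α`.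
  -- It groups the abscissae of the grid into the columns of the staircase.
  ∑-partition : ∀ n (α : ℕ → ℕ) f → ∑ (∑ n α) f ≡ ∑ n (λ i → ∑ (α i) (λ b → f (b + ∑ i α)))
  ∑-partition zero    α f = refl
  ∑-partition (suc n) α f = trans (cong (λ z → ∑ z f) (ℕₚ.+-comm (∑ n α) (α n)))
    (trans (∑-append (∑ n α) (α n) f) (cong (_+ ∑ (α n) (λ b → f (b + ∑ n α))) (∑-partition n α f)))

-- Lattice cells under a staircase compared with cells in a disc.

module StaircaseCounting where
  open import Data.Nat using (_+_; _*_; _∸_; _<_)
  open FiniteSums

  indicator-yes : {P : Set} (p? : Dec P) → P → indicator p? ≡ 1
  indicator-yes (yes _) p = refl
  indicator-yes (no ¬p) p = ⊥-elim (¬p p)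

  indicator-no : {P : Set} (p? : Dec P) → ¬ P → indicator p? ≡ 0
  indicator-no (yes p) ¬p = ⊥-elim (¬p p)
  indicator-no (no _)  ¬p = refl

  sq-cancel-≤ : ∀ {a b} → a * a ≤ b * b → a ≤ b
  sq-cancel-≤ {a} {b} h with a ℕ.≤? b
  ... | yes a≤b = a≤b
  ... | no a≰b = ⊥-elim (ℕₚ.<⇒≱ (ℕₚ.*-mono-< (ℕₚ.≰⇒> a≰b) (ℕₚ.≰⇒> a≰b)) h)

  module _ (α : ℕ → ℕ) where
    -- The area of the rectangles `α i` × `α j` with i < m and i + j < n, laid end to end along both
    -- axes. The number m of columns is kept apart from n because the covering of the disc uses a
    -- staircase without its last column.
    staircase : ℕ → ℕ → ℕ
    staircase m n = ∑ m (λ i → α i * ∑ (n ∸ i) α)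

    -- The hypothesis puts the outer corner of each column in the disc of radius N. The far corner
    -- of a unit cell in that column has coordinates no larger, so the cell is counted.
    staircase≤cells : ∀ n N →
      (∀ i → i < n → ∑ (suc i) α * ∑ (suc i) α + ∑ (n ∸ i) α * ∑ (n ∸ i) α ≤ N * N) →
      staircase n n ≤ cells N
    staircase≤cells n N corner = ℕₚ.≤-trans
      (∑-mono< n λ i i<n → ℕₚ.≤-trans (ℕₚ.≤-reflexive (trans (ℕₚ.*-comm (α i) _) (sym (∑-const (α i) _))))
        (∑-mono< (α i) λ b b<α → row i i<n b b<α))
      (ℕₚ.≤-trans (ℕₚ.≤-reflexive (sym (∑-partition n α (λ I → ∑ N λ J → inDisc N (suc I) (suc J)))))
        (∑-mono-length (λ I → ∑ N λ J → inDisc N (suc I) (suc J)) (width n ℕₚ.≤-refl)))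
      where
        -- A corner in the disc has both coordinates at most N, so the staircase fits into the N × N
        -- grid over which `cells` sums.
        width : ∀ i → i ≤ n → ∑ i α ≤ N
        width zero    _   = z≤n
        width (suc i) i<n = sq-cancel-≤ (ℕₚ.≤-trans (ℕₚ.m≤m+n _ _) (corner i i<n))
        height : ∀ i → i < n → ∑ (n ∸ i) α ≤ N
        height i i<n = sq-cancel-≤ (ℕₚ.≤-trans (ℕₚ.m≤n+m _ _) (corner i i<n))
        row : ∀ i → i < n → ∀ b → b < α i →
              ∑ (n ∸ i) α ≤ ∑ N (λ J → inDisc N (suc (b + ∑ i α)) (suc J))
        row i i<n b b<α = ℕₚ.≤-trans
          (ℕₚ.≤-reflexive (sym (∑-ones (∑ (n ∸ i) α) λ J J<h →
            indicator-yes (_ ℕ.≤? N * N)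
              (ℕₚ.≤-trans (sq-mono I≤ J<h) (corner i i<n)))))
          (∑-mono-length (λ J → inDisc N (suc (b + ∑ i α)) (suc J)) (height i i<n))
          where
            I≤ : suc (b + ∑ i α) ≤ ∑ (suc i) α
            I≤ = ℕₚ.≤-trans (ℕₚ.+-monoˡ-≤ (∑ i α) b<α) (ℕₚ.≤-reflexive (ℕₚ.+-comm (α i) _))

    -- Here the inner corners lie on or outside the circle. A cell is tested at its far corner,
    -- which for a cell above the staircase exceeds an inner corner strictly in both coordinates;
    -- hence the hypothesis need not be strict.
    cells≤staircase : ∀ m n →
      (∀ i → i < m → ∑ m α * ∑ m α ≤ ∑ i α * ∑ i α + ∑ (n ∸ i) α * ∑ (n ∸ i) α) →
      cells (∑ m α) ≤ staircase m n
    cells≤staircase m n corner = ℕₚ.≤-trans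
      (ℕₚ.≤-reflexive (∑-partition m α (λ I → ∑ N λ J → inDisc N (suc I) (suc J))))
      (∑-mono< m λ i i<m → ℕₚ.≤-trans
        (∑-mono (α i) λ b → ∑-supported N (∑ (n ∸ i) α) (λ J → inDisc≤1 N (suc (b + ∑ i α)) (suc J))
          λ J h≤J → indicator-no (_ ℕ.≤? N * N) (ℕₚ.<⇒≱ (ℕₚ.≤-<-trans (corner i i<m)
            (ℕₚ.+-mono-< (ℕₚ.*-mono-< (I> i b) (I> i b)) (ℕₚ.*-mono-< (s≤s h≤J) (s≤s h≤J))))))
        (ℕₚ.≤-reflexive (trans (∑-const (α i) _) (ℕₚ.*-comm _ (α i)))))
      where
        N = ∑ m α
        I> : ∀ i b → ∑ i α < suc (b + ∑ i α)
        I> i b = s≤s (ℕₚ.m≤n+m _ b)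

-- Scaled central binomial ratios: corner inequalities and area of the staircase.

module CentralBinomial where
  open import Data.Nat using (_+_; _*_; _∸_; _<_)
  open FiniteSums
  open ℕ-Solver.+-*-Solver
  open ℕₚ.≤-Reasoning

  -- α i / α 0 = (1/2)_i / i! as long as i ≤ L
  module _ (L : ℕ) (α : ℕ → ℕ)
           (rec : ∀ i → i < L → α (suc i) * (2 * suc i) ≡ α i * suc (2 * i)) where

    S : ℕ → ℕ
    S i = ∑ i α

    S-closed : ∀ i → i ≤ L → S i ≡ 2 * i * α i
    S-closed zero    _   = refl
    S-closed (suc i) i<L = begin-equality
      S i + α i            ≡⟨ cong (_+ α i) (S-closed i (ℕₚ.<⇒≤ i<L)) ⟩
      2 * i * α i + α i    ≡⟨ solve 2 (λ i a → con 2 :* i :* a :+ a := a :* (con 1 :+ con 2 :* i)) refl i (α i) ⟩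
      α i * suc (2 * i)    ≡⟨ rec i i<L ⟨
      α (suc i) * (2 * suc i) ≡⟨ ℕₚ.*-comm (α (suc i)) _ ⟩
      2 * suc i * α (suc i) ∎

    sq-rec : ∀ i → i < L → α (suc i) * α (suc i) * (4 * (suc i * suc i))
                         ≡ α i * α i * (suc (2 * i) * suc (2 * i))
    sq-rec i i<L = begin-equality
      α (suc i) * α (suc i) * (4 * (suc i * suc i))
        ≡⟨ solve 2 (λ i a → a :* a :* (con 4 :* (i :* i)) := (a :* (con 2 :* i)) :* (a :* (con 2 :* i)))
             refl (suc i) (α (suc i)) ⟩
      (α (suc i) * (2 * suc i)) * (α (suc i) * (2 * suc i))
        ≡⟨ cong (λ z → z * z) (rec i i<L) ⟩
      (α i * suc (2 * i)) * (α i * suc (2 * i))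
        ≡⟨ solve 2 (λ i a → (a :* i) :* (a :* i) := a :* a :* (i :* i)) refl (suc (2 * i)) (α i) ⟩
      α i * α i * (suc (2 * i) * suc (2 * i)) ∎

    -- The increment of S² at i, by `S²-step`.
    d : ℕ → ℕ
    d i = α i * α i * (4 * i + 1)

    -- After multiplication by 4(i + 1)² this is (4i + 1) · 4(i + 1)² + 1 = (2i + 1)² (4i + 5).
    d-step : ∀ i → i < L → d i ≤ d (suc i)
    d-step i i<L = ℕₚ.*-cancelʳ-≤ (d i) (d (suc i)) (4 * (suc i * suc i)) (begin
      α i * α i * (4 * i + 1) * (4 * (suc i * suc i))
        ≤⟨ ℕₚ.m≤m+n _ (α i * α i) ⟩
      α i * α i * (4 * i + 1) * (4 * (suc i * suc i)) + α i * α i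
        ≡⟨ solve 2 (λ i v → v :* (con 4 :* i :+ con 1) :* (con 4 :* ((con 1 :+ i) :* (con 1 :+ i))) :+ v
              := v :* ((con 1 :+ con 2 :* i) :* (con 1 :+ con 2 :* i)) :* (con 4 :* (con 1 :+ i) :+ con 1))
             refl i (α i * α i) ⟩
      α i * α i * (suc (2 * i) * suc (2 * i)) * (4 * suc i + 1)
        ≡⟨ cong (_* (4 * suc i + 1)) (sq-rec i i<L) ⟨
      α (suc i) * α (suc i) * (4 * (suc i * suc i)) * (4 * suc i + 1)
        ≡⟨ solve 3 (λ a b c → a :* b :* c := a :* c :* b) refl
             (α (suc i) * α (suc i)) (4 * (suc i * suc i)) (4 * suc i + 1) ⟩
      d (suc i) * (4 * (suc i * suc i)) ∎)

    -- Twice the Wallis quantity in scaled form: for the sequence used later, `W-α` gives v(N) = 2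
    -- W(N) (α 0)².
    v : ℕ → ℕ
    v i = α i * α i * (2 * i + 1)

    -- Rests on (2i + 1)(2i + 3) + 1 = 4(i + 1)².
    v-step : ∀ i → i < L → v (suc i) ≤ v i
    v-step i i<L = ℕₚ.*-cancelʳ-≤ (v (suc i)) (v i) (4 * (suc i * suc i)) (begin
      α (suc i) * α (suc i) * (2 * suc i + 1) * (4 * (suc i * suc i))
        ≡⟨ solve 3 (λ a b c → a :* c :* b := a :* b :* c) refl
             (α (suc i) * α (suc i)) (4 * (suc i * suc i)) (2 * suc i + 1) ⟩
      α (suc i) * α (suc i) * (4 * (suc i * suc i)) * (2 * suc i + 1)
        ≡⟨ cong (_* (2 * suc i + 1)) (sq-rec i i<L) ⟩
      α i * α i * (suc (2 * i) * suc (2 * i)) * (2 * suc i + 1)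
        ≤⟨ ℕₚ.m≤m+n _ (α i * α i * (2 * i + 1)) ⟩
      α i * α i * (suc (2 * i) * suc (2 * i)) * (2 * suc i + 1) + α i * α i * (2 * i + 1)
        ≡⟨ solve 2 (λ i v → v :* ((con 1 :+ con 2 :* i) :* (con 1 :+ con 2 :* i)) :* (con 2 :* (con 1 :+ i) :+ con 1) :+ v :* (con 2 :* i :+ con 1)
              := v :* (con 2 :* i :+ con 1) :* (con 4 :* ((con 1 :+ i) :* (con 1 :+ i))))
             refl i (α i * α i) ⟩
      v i * (4 * (suc i * suc i)) ∎)

    d-mono : ∀ i j → i + j ≤ L → d i ≤ d (j + i)
    d-mono i zero    _ = ℕₚ.≤-refl
    d-mono i (suc j) h = ℕₚ.≤-trans (d-mono i j (ℕₚ.≤-trans (ℕₚ.+-monoʳ-≤ i (ℕₚ.n≤1+n j)) h))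
      (d-step (j + i) (subst (_≤ L) (trans (ℕₚ.+-suc i j) (cong suc (ℕₚ.+-comm i j))) h))

    v-mono : ∀ i j → i + j ≤ L → v (j + i) ≤ v i
    v-mono i zero    _ = ℕₚ.≤-refl
    v-mono i (suc j) h = ℕₚ.≤-trans
      (v-step (j + i) (subst (_≤ L) (trans (ℕₚ.+-suc i j) (cong suc (ℕₚ.+-comm i j))) h))
      (v-mono i j (ℕₚ.≤-trans (ℕₚ.+-monoʳ-≤ i (ℕₚ.n≤1+n j)) h))

    S²-step : ∀ i → i ≤ L → S (suc i) * S (suc i) ≡ S i * S i + d i
    S²-step i i≤L = begin-equality
      (S i + α i) * (S i + α i)
        ≡⟨ cong (λ z → (z + α i) * (z + α i)) (S-closed i i≤L) ⟩
      (2 * i * α i + α i) * (2 * i * α i + α i)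
        ≡⟨ solve 2 (λ i a → (con 2 :* i :* a :+ a) :* (con 2 :* i :* a :+ a)
             := (con 2 :* i :* a) :* (con 2 :* i :* a) :+ a :* a :* (con 4 :* i :+ con 1)) refl i (α i) ⟩
      (2 * i * α i) * (2 * i * α i) + d i
        ≡⟨ cong (λ z → z * z + d i) (S-closed i i≤L) ⟨
      S i * S i + d i ∎

    -- A sequence that starts at 0 and has nondecreasing increments is superadditive; the increments
    -- are the `d i`.
    S²-superadditive : ∀ i j → i + j ≤ suc L → S i * S i + S j * S j ≤ S (i + j) * S (i + j)
    S²-superadditive i zero    _ = ℕₚ.≤-reflexive
      (trans (ℕₚ.+-identityʳ _) (cong (λ z → S z * S z) (sym (ℕₚ.+-identityʳ i))))
    S²-superadditive i (suc j) h = begin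
      S i * S i + S (suc j) * S (suc j)   ≡⟨ cong (S i * S i +_) (S²-step j (ℕₚ.≤-trans (ℕₚ.m≤n+m j i) i+j≤L)) ⟩
      S i * S i + (S j * S j + d j)       ≡⟨ ℕₚ.+-assoc (S i * S i) _ _ ⟨
      S i * S i + S j * S j + d j         ≤⟨ ℕₚ.+-mono-≤ (S²-superadditive i j (ℕₚ.m≤n⇒m≤1+n i+j≤L))
                                               (d-mono j i (subst (_≤ L) (ℕₚ.+-comm i j) i+j≤L)) ⟩
      S (i + j) * S (i + j) + d (i + j)   ≡⟨ S²-step (i + j) i+j≤L ⟨
      S (suc (i + j)) * S (suc (i + j))   ≡⟨ cong (λ z → S z * S z) (ℕₚ.+-suc i j) ⟨
      S (i + suc j) * S (i + suc j) ∎
      where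
        i+j≤L : i + j ≤ L
        i+j≤L = ℕₚ.≤-pred (subst (_≤ suc L) (ℕₚ.+-suc i j) h)

    -- By `S-closed` and 4(i + 1)² = (2i + 1)(2i + 3) + 1.
    S²≥ : ∀ i → suc i ≤ L → (2 * i + 1) * v (suc i) ≤ S (suc i) * S (suc i)
    S²≥ i h = begin
      (2 * i + 1) * (a * a * (2 * suc i + 1))       ≤⟨ ℕₚ.m≤m+n _ (a * a) ⟩
      (2 * i + 1) * (a * a * (2 * suc i + 1)) + a * a
        ≡⟨ solve 2 (λ i a → (con 2 :* i :+ con 1) :* (a :* a :* (con 2 :* (con 1 :+ i) :+ con 1)) :+ a :* a
             := con 2 :* (con 1 :+ i) :* a :* (con 2 :* (con 1 :+ i) :* a)) refl i a ⟩
      2 * suc i * a * (2 * suc i * a)               ≡⟨ cong (λ z → z * z) (S-closed (suc i) h) ⟨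
      S (suc i) * S (suc i) ∎
      where a = α (suc i)

    -- After multiplication by 4(n + 1)² the slack is 2n a² (4n² + 6n + 3) with a = `α n`. The index
    -- n + 1 of `v` is what `S²-almost-subadditive` can compare with both of its summands.
    S²≤ : ∀ n → suc n ≤ L → S n * S n ≤ 2 * n * v (suc n)
    S²≤ n h = ℕₚ.*-cancelʳ-≤ _ _ (4 * (suc n * suc n)) (begin
      S n * S n * (4 * (suc n * suc n))
        ≡⟨ cong (λ z → z * z * (4 * (suc n * suc n))) (S-closed n (ℕₚ.<⇒≤ h)) ⟩
      2 * n * a * (2 * n * a) * (4 * (suc n * suc n))
        ≤⟨ ℕₚ.m≤m+n _ _ ⟩
      2 * n * a * (2 * n * a) * (4 * (suc n * suc n)) + (2 * n * (a * a)) * (4 * n * n + 6 * n + 3)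
        ≡⟨ solve 2 (λ n a → con 2 :* n :* a :* (con 2 :* n :* a) :* (con 4 :* ((con 1 :+ n) :* (con 1 :+ n)))
               :+ (con 2 :* n :* (a :* a)) :* (con 4 :* n :* n :+ con 6 :* n :+ con 3)
             := con 2 :* n :* (a :* a :* ((con 1 :+ con 2 :* n) :* (con 1 :+ con 2 :* n)) :* (con 2 :* (con 1 :+ n) :+ con 1)))
             refl n a ⟩
      2 * n * (a * a * (suc (2 * n) * suc (2 * n)) * (2 * suc n + 1))
        ≡⟨ cong (λ z → 2 * n * (z * (2 * suc n + 1))) (sq-rec n h) ⟨
      2 * n * (b * b * (4 * (suc n * suc n)) * (2 * suc n + 1))
        ≡⟨ solve 4 (λ n b x y → con 2 :* n :* (b :* x :* y) := con 2 :* n :* (b :* y) :* x) refl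
             n (b * b) (4 * (suc n * suc n)) (2 * suc n + 1) ⟩
      2 * n * v (suc n) * (4 * (suc n * suc n)) ∎)
      where
        a = α n
        b = α (suc n)

    -- Reverses `S²-superadditive` at the cost of one index. With n = i + j + 1, the factor 2n of
    -- `S²≤` splits as (2i + 1) + (2j + 1); as `v` does not increase, the two parts are bounded
    -- through `S²≥` at i and at j.
    S²-almost-subadditive : ∀ i j → suc i + suc j ≤ L →
      S (suc i + j) * S (suc i + j) ≤ S (suc i) * S (suc i) + S (suc j) * S (suc j)
    S²-almost-subadditive i j h = begin
      S (suc i + j) * S (suc i + j)
        ≤⟨ S²≤ (suc i + j) h' ⟩
      2 * (suc i + j) * w
        ≡⟨ solve 3 (λ i j w → con 2 :* (con 1 :+ i :+ j) :* w := (con 2 :* i :+ con 1) :* w :+ (con 2 :* j :+ con 1) :* w) refl i j w ⟩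
      (2 * i + 1) * w + (2 * j + 1) * w
        ≤⟨ ℕₚ.+-mono-≤ (ℕₚ.*-monoʳ-≤ (2 * i + 1) w≤i) (ℕₚ.*-monoʳ-≤ (2 * j + 1) w≤j) ⟩
      (2 * i + 1) * v (suc i) + (2 * j + 1) * v (suc j)
        ≤⟨ ℕₚ.+-mono-≤ (S²≥ i (ℕₚ.≤-trans (ℕₚ.m≤m+n _ _) h)) (S²≥ j (ℕₚ.≤-trans (ℕₚ.m≤n+m (suc j) (suc i)) h)) ⟩
      S (suc i) * S (suc i) + S (suc j) * S (suc j) ∎
      where
        w = v (suc (suc i + j))
        h' : suc (suc i + j) ≤ L
        h' = subst (_≤ L) (ℕₚ.+-suc (suc i) j) h
        w≤i : w ≤ v (suc i)
        w≤i = subst (λ z → v z ≤ v (suc i)) (trans (ℕₚ.+-comm (suc j) (suc i)) (ℕₚ.+-suc (suc i) j))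
                (v-mono (suc i) (suc j) h)
        w≤j : w ≤ v (suc j)
        w≤j = subst (λ z → v z ≤ v (suc j)) (ℕₚ.+-suc (suc i) j)
                (v-mono (suc j) (suc i) (subst (_≤ L) (ℕₚ.+-comm (suc i) (suc j)) h))

    -- The rectangles on the antidiagonal i + j = n. That they add up to (α 0)² is the identity Σ
    -- a_i a_(n-i) = 1, which reflects the square of the power series of (1 - x)^(-1/2); below it
    -- follows from areas instead.
    convolution : ℕ → ℕ
    convolution n = ∑ (suc n) (λ i → α i * α (n ∸ i))

    area : ℕ → ℕ
    area n = ∑ n (λ i → α i * S (n ∸ i))

    area-suc-index : ∀ n → ∑ (suc n) (λ i → α i * S (n ∸ i)) ≡ area n
    area-suc-index n = trans (cong (λ z → area n + α n * S z) (ℕₚ.n∸n≡0 n))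
      (trans (cong (area n +_) (ℕₚ.*-zeroʳ (α n))) (ℕₚ.+-identityʳ _))

    area-step : ∀ n → area (suc n) ≡ area n + convolution n
    area-step n = begin-equality
      ∑ (suc n) (λ i → α i * S (suc n ∸ i))
        ≡⟨ ∑-cong< (suc n) (λ i i<sn → trans
             (cong (λ z → α i * S z) (ℕₚ.+-∸-assoc 1 (ℕₚ.≤-pred i<sn)))
             (ℕₚ.*-distribˡ-+ (α i) _ _)) ⟩
      ∑ (suc n) (λ i → α i * S (n ∸ i) + α i * α (n ∸ i))
        ≡⟨ ∑-+ (suc n) _ _ ⟩
      ∑ (suc n) (λ i → α i * S (n ∸ i)) + convolution n
        ≡⟨ cong (_+ convolution n) (area-suc-index n) ⟩
      area n + convolution n ∎

    -- Averaging α i S (n - i) over the reflection i ↦ n - i.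
    area-convolution : ∀ n → n ≤ L → area n ≡ convolution n * n
    area-convolution n n≤L = ℕₚ.*-cancelˡ-≡ _ _ 2 (begin-equality
      2 * area n
        ≡⟨ cong (area n +_) (ℕₚ.+-identityʳ _) ⟩
      area n + area n
        ≡⟨ cong₂ _+_ (sym (area-suc-index n))
             (trans (sym (area-suc-index n)) (∑-reverse n (λ i → α i * S (n ∸ i)))) ⟩
      ∑ (suc n) (λ i → α i * S (n ∸ i)) + ∑ (suc n) (λ i → α (n ∸ i) * S (n ∸ (n ∸ i)))
        ≡⟨ ∑-+ (suc n) _ _ ⟨
      ∑ (suc n) (λ i → α i * S (n ∸ i) + α (n ∸ i) * S (n ∸ (n ∸ i)))
        ≡⟨ ∑-cong< (suc n) (λ i i<sn → term i (ℕₚ.≤-pred i<sn)) ⟩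
      ∑ (suc n) (λ i → α i * α (n ∸ i) * (2 * n))
        ≡⟨ ∑-*ʳ (suc n) (λ i → α i * α (n ∸ i)) (2 * n) ⟩
      convolution n * (2 * n)
        ≡⟨ solve 2 (λ c n → c :* (con 2 :* n) := con 2 :* (c :* n)) refl (convolution n) n ⟩
      2 * (convolution n * n) ∎)
      where
        term : ∀ i → i ≤ n → α i * S (n ∸ i) + α (n ∸ i) * S (n ∸ (n ∸ i)) ≡ α i * α (n ∸ i) * (2 * n)
        term i i≤n = begin-equality
          α i * S (n ∸ i) + α (n ∸ i) * S (n ∸ (n ∸ i))
            ≡⟨ cong₂ (λ x y → α i * x + α (n ∸ i) * y)
                 (S-closed (n ∸ i) (ℕₚ.≤-trans (ℕₚ.m∸n≤m n i) n≤L))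
                 (trans (cong S (ℕₚ.m∸[m∸n]≡n i≤n)) (S-closed i (ℕₚ.≤-trans i≤n n≤L))) ⟩
          α i * (2 * (n ∸ i) * α (n ∸ i)) + α (n ∸ i) * (2 * i * α i)
            ≡⟨ solve 4 (λ a b i j → a :* (con 2 :* j :* b) :+ b :* (con 2 :* i :* a) := a :* b :* (con 2 :* (i :+ j)))
                 refl (α i) (α (n ∸ i)) i (n ∸ i) ⟩
          α i * α (n ∸ i) * (2 * (i + (n ∸ i)))
            ≡⟨ cong (λ z → α i * α (n ∸ i) * (2 * z)) (ℕₚ.m+[n∸m]≡n i≤n) ⟩
          α i * α (n ∸ i) * (2 * n) ∎

    convolution-value : ∀ n → suc n ≤ L → area (suc n) ≡ α 0 * α 0 * suc n → convolution (suc n) ≡ α 0 * α 0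
    convolution-value n n<L h = ℕₚ.*-cancelʳ-≡ _ _ (suc n) (trans (sym (area-convolution (suc n) n<L)) h)

    area-value-step : ∀ n → suc n ≤ L → area (suc n) ≡ α 0 * α 0 * suc n →
                      area (suc (suc n)) ≡ α 0 * α 0 * suc (suc n)
    area-value-step n n<L h = begin-equality
      area (suc (suc n))                   ≡⟨ area-step (suc n) ⟩
      area (suc n) + convolution (suc n)   ≡⟨ cong₂ _+_ h (convolution-value n n<L h) ⟩
      α 0 * α 0 * suc n + α 0 * α 0        ≡⟨ ℕₚ.+-comm _ (α 0 * α 0) ⟩
      α 0 * α 0 + α 0 * α 0 * suc n        ≡⟨ ℕₚ.*-suc (α 0 * α 0) (suc n) ⟨
      α 0 * α 0 * suc (suc n) ∎

    -- `area-convolution` finds the n-th antidiagonal from the n-th area by dividing by n, and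
    -- `area-step` adds it to reach the next area. The induction step starts at 1, since division by
    -- n says nothing at 0.
    area-value : ∀ n → n ≤ suc L → area n ≡ α 0 * α 0 * n
    area-value zero          _ = sym (ℕₚ.*-zeroʳ (α 0 * α 0))
    area-value (suc zero)    _ = sym (ℕₚ.*-identityʳ (α 0 * α 0))
    area-value (suc (suc n)) h =
      area-value-step n (ℕₚ.≤-pred h) (area-value (suc n) (ℕₚ.<⇒≤ h))

    open StaircaseCounting

    -- The outer corners have indices i + 1 and n - i, whose sum is n + 1; superadditivity puts them
    -- in the disc of radius S(n + 1).
    cells-lower-bound : ∀ n → n ≤ L → α 0 * α 0 * n ≤ cells (S (suc n))
    cells-lower-bound n n≤L = subst (_≤ cells (S (suc n))) (area-value n (ℕₚ.m≤n⇒m≤1+n n≤L))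
      (staircase≤cells α n (S (suc n)) λ i i<n →
        let e = cong suc (ℕₚ.m+[n∸m]≡n (ℕₚ.<⇒≤ i<n))
        in subst (λ z → S (suc i) * S (suc i) + S (n ∸ i) * S (n ∸ i) ≤ S z * S z) e
             (S²-superadditive (suc i) (n ∸ i) (subst (_≤ suc L) (sym e) (s≤s n≤L))))

    -- The inner corners of the staircase of order n + 1 have indices i and n + 1 - i. Their sum
    -- exceeds n by one, which pays for the index lost in `S²-almost-subadditive`.
    cells-upper-bound : ∀ n → suc n ≤ L → cells (S n) ≤ α 0 * α 0 * suc n
    cells-upper-bound n h = begin
      cells (S n)
        ≤⟨ cells≤staircase α n (suc n) corner ⟩
      staircase α n (suc n)
        ≤⟨ ℕₚ.m≤m+n _ _ ⟩
      area (suc n)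
        ≡⟨ area-value (suc n) (ℕₚ.m≤n⇒m≤1+n h) ⟩
      α 0 * α 0 * suc n ∎
      where
        corner : ∀ i → i < n → S n * S n ≤ S i * S i + S (suc n ∸ i) * S (suc n ∸ i)
        -- `S²-almost-subadditive` needs positive indices; for the corner on the axis S(n) ≤ S(n +
        -- 1) is enough.
        corner zero    i<n = ℕₚ.*-mono-≤ {S n} {S (suc n)} (ℕₚ.m≤m+n _ _) (ℕₚ.m≤m+n _ _)
        corner (suc i) i<n =
          let j = n ∸ suc i
              e : suc i + j ≡ n
              e = ℕₚ.m+[n∸m]≡n (ℕₚ.<⇒≤ i<n)
              e' : suc j ≡ n ∸ i
              e' = sym (ℕₚ.+-∸-assoc 1 (ℕₚ.<⇒≤ i<n))
          in subst₂ (λ x y → S x * S x ≤ S (suc i) * S (suc i) + S y * S y) e e'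
               (S²-almost-subadditive i j (subst (_≤ L) (sym (trans (ℕₚ.+-suc (suc i) j) (cong suc e))) h))

-- Order and sign rules for rationals.

module RationalOrder where
  open import Data.Rational using (_+_; _*_; _-_; -_; _<_) renaming (_≤_ to _≤ℚ_)
  open ℚₚ.≤-Reasoning

  ≤-scaleʳ : ∀ {p q} r → 0ℚ ≤ℚ r → p ≤ℚ q → p * r ≤ℚ q * r
  ≤-scaleʳ r 0≤r = ℚₚ.*-monoʳ-≤-nonNeg r {{ℚ.nonNegative 0≤r}}

  ≤-scaleˡ : ∀ {p q} r → 0ℚ ≤ℚ r → p ≤ℚ q → r * p ≤ℚ r * q
  ≤-scaleˡ r 0≤r = ℚₚ.*-monoˡ-≤-nonNeg r {{ℚ.nonNegative 0≤r}}

  ≤-unscaleʳ : ∀ {p q} r → 0ℚ < r → p * r ≤ℚ q * r → p ≤ℚ q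
  ≤-unscaleʳ r 0<r = ℚₚ.*-cancelʳ-≤-pos r {{ℚ.positive 0<r}}

  ≡-unscaleʳ : ∀ {p q} r → 0ℚ < r → p * r ≡ q * r → p ≡ q
  ≡-unscaleʳ r 0<r e = ℚₚ.≤-antisym (≤-unscaleʳ r 0<r (ℚₚ.≤-reflexive e))
                                    (≤-unscaleʳ r 0<r (ℚₚ.≤-reflexive (sym e)))

  p≤p+q : ∀ p {q} → 0ℚ ≤ℚ q → p ≤ℚ p + q
  p≤p+q p {q} 0≤q = subst (_≤ℚ p + q) (ℚₚ.+-identityʳ p) (ℚₚ.+-monoʳ-≤ p 0≤q)

  +-nonNeg : ∀ {p q} → 0ℚ ≤ℚ p → 0ℚ ≤ℚ q → 0ℚ ≤ℚ p + q
  +-nonNeg {p} 0≤p 0≤q = ℚₚ.≤-trans 0≤p (p≤p+q p 0≤q)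

  *-nonNeg : ∀ {p q} → 0ℚ ≤ℚ p → 0ℚ ≤ℚ q → 0ℚ ≤ℚ p * q
  *-nonNeg {p} {q} 0≤p 0≤q = subst (_≤ℚ p * q) (ℚₚ.*-zeroˡ q) (≤-scaleʳ q 0≤q 0≤p)

  0≤½ : 0ℚ ≤ℚ ½
  0≤½ = ℚₚ.<⇒≤ 0<½

  ∣p∣≤-intro : ∀ {p ε} → p ≤ℚ ε → - p ≤ℚ ε → ℚ.∣ p ∣ ≤ℚ ε
  ∣p∣≤-intro {p} p≤ε -p≤ε with ℚₚ.∣p∣≡p∨∣p∣≡-p p
  ... | inj₁ e = subst (_≤ℚ _) (sym e) p≤ε
  ... | inj₂ e = subst (_≤ℚ _) (sym e) -p≤ε

-- Fractions and the embedding of the natural numbers.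

module NaturalCasts where
  open import Data.Rational using (_+_; _*_; _-_; -_; _<_) renaming (_≤_ to _≤ℚ_)
  open RationalOrder

  /-* : ∀ a b c d → (ℤ.+ a ℚ./ suc b) * (ℤ.+ c ℚ./ suc d) ≡ ℤ.+ (a ℕ.* c) ℚ./ (suc b ℕ.* suc d)
  /-* a b c d = ℚₚ.toℚᵘ-injective (ℚᵘₚ.≃-trans (ℚₚ.toℚᵘ-homo-* (ℤ.+ a ℚ./ suc b) (ℤ.+ c ℚ./ suc d))
    (ℚᵘₚ.≃-trans (ℚᵘₚ.*-cong (toℚᵘ-/ a b) (toℚᵘ-/ c d))
      (ℚᵘₚ.≃-trans (ℚᵘₚ.≃-reflexive (cong (λ z → ℚᵘ.mkℚᵘ z (d ℕ.+ b ℕ.* suc d)) (sym (ℤₚ.pos-* a c))))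
        (ℚᵘₚ.≃-sym (toℚᵘ-/ _ (d ℕ.+ b ℕ.* suc d))))))

  /-≡ : ∀ a b c d → a ℕ.* suc d ≡ c ℕ.* suc b → ℤ.+ a ℚ./ suc b ≡ ℤ.+ c ℚ./ suc d
  /-≡ a b c d e = ℚₚ.≤-antisym (/-≤ a b c d (ℕₚ.≤-reflexive e)) (/-≤ c d a b (ℕₚ.≤-reflexive (sym e)))

  fromℕ-* : ∀ a b → fromℕ (a ℕ.* b) ≡ fromℕ a * fromℕ b
  fromℕ-* a b = sym (/-* a 0 b 0)

  fromℕ-+ : ∀ a b → fromℕ (a ℕ.+ b) ≡ fromℕ a + fromℕ b
  fromℕ-+ a b = sym (trans (/-+ a 0 b 0)
    (cong fromℕ (cong₂ ℕ._+_ (ℕₚ.*-identityʳ a) (ℕₚ.*-identityʳ b))))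

  fromℕ-suc : ∀ n → fromℕ (suc n) ≡ 1ℚ + fromℕ n
  fromℕ-suc = fromℕ-+ 1

  fromℕ-≤ : ∀ {a b} → a ≤ b → fromℕ a ≤ℚ fromℕ b
  fromℕ-≤ {a} {b} a≤b = /-≤ a 0 b 0 (ℕₚ.*-monoˡ-≤ 1 a≤b)

  fromℕ-pos : ∀ n → .{{ℕ.NonZero n}} → 0ℚ < fromℕ n
  fromℕ-pos (suc n) = /-< 0 0 (suc n) 0 (s≤s z≤n)

  fromℕ-nonNeg : ∀ n → 0ℚ ≤ℚ fromℕ n
  fromℕ-nonNeg n = fromℕ-≤ {0} {n} z≤n

  /-*-cancel : ∀ a b .{{_ : ℕ.NonZero b}} → (ℤ.+ a ℚ./ b) * fromℕ b ≡ fromℕ a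
  /-*-cancel a (suc b) = trans (/-* a b (suc b) 0)
    (/-≡ (a ℕ.* suc b) (b ℕ.* 1) a 0 (ℕₚ.*-assoc a (suc b) 1))

  /ℕ-*-cancel : ∀ q d .{{_ : ℕ.NonZero d}} → (q /ℕ d) * fromℕ d ≡ q
  /ℕ-*-cancel q d = trans (ℚₚ.*-assoc q (ℤ.+ 1 ℚ./ d) (fromℕ d))
    (trans (cong (q *_) (/-*-cancel 1 d)) (ℚₚ.*-identityʳ q))

open RationalOrder
open NaturalCasts

-- The Wallis product and its integer scaling.

module WallisProduct where
  open import Data.Rational using (_+_; _*_; _-_; -_; _<_) renaming (_≤_ to _≤ℚ_)

  oddProduct : ℕ → ℕ
  oddProduct zero    = 1
  oddProduct (suc i) = oddProduct i ℕ.* suc (2 ℕ.* i)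

  evenProduct : ℕ → ℕ → ℕ
  evenProduct i zero    = 1
  evenProduct i (suc d) = 2 ℕ.* suc i ℕ.* evenProduct (suc i) d

  -- For i ≤ L this is 1 · 3 ⋯ (2i - 1) times 2(i + 1) ⋯ 2L, that is, a_i multiplied by the common
  -- denominator 2^L L!. Being an integer, it makes the corners of the staircase lattice points.
  α : ℕ → ℕ → ℕ
  α L i = oddProduct i ℕ.* evenProduct i (L ℕ.∸ i)

  α-rec : ∀ L i → i ℕ.< L → α L (suc i) ℕ.* (2 ℕ.* suc i) ≡ α L i ℕ.* suc (2 ℕ.* i)
  α-rec L i i<L = trans
    (solve 4 (λ o x e c → o :* x :* e :* c := o :* (c :* e) :* x) refl
      (oddProduct i) (suc (2 ℕ.* i)) (evenProduct (suc i) (L ℕ.∸ suc i)) (2 ℕ.* suc i))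
    (cong (λ z → oddProduct i ℕ.* evenProduct i z ℕ.* suc (2 ℕ.* i)) (sym (ℕₚ.+-∸-assoc 1 i<L)))
    where open ℕ-Solver.+-*-Solver

  α-nonZero : ∀ L i → ℕ.NonZero (α L i)
  α-nonZero L i = ℕₚ.m*n≢0 (oddProduct i) (evenProduct i (L ℕ.∸ i)) {{odd i}} {{even i (L ℕ.∸ i)}}
    where
      odd : ∀ i → ℕ.NonZero (oddProduct i)
      odd zero    = _
      odd (suc i) = ℕₚ.m*n≢0 (oddProduct i) (suc (2 ℕ.* i)) {{odd i}}
      even : ∀ i d → ℕ.NonZero (evenProduct i d)
      even i zero    = _
      even i (suc d) = ℕₚ.m*n≢0 (2 ℕ.* suc i) (evenProduct (suc i) d) {{_}} {{even (suc i) d}}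

  rising-α : ∀ L i → i ≤ L → rising ½ i * fromℕ (α L 0) ≡ fromℕ (α L i) * fromℕ (i !)
  rising-α L zero    _   = ℚₚ.*-comm 1ℚ (fromℕ (α L 0))
  rising-α L (suc i) i<L = ≡-unscaleʳ (fromℕ 2) (fromℕ-pos 2) (begin
    rising ½ i * (½ + fromℕ i) * D * fromℕ 2
      ≡⟨ solve 3 (λ r x D → r :* (con ½ :+ x) :* D :* con (fromℕ 2) := r :* D :* (con 1ℚ :+ con (fromℕ 2) :* x))
           refl (rising ½ i) (fromℕ i) D ⟩
    rising ½ i * D * (1ℚ + fromℕ 2 * fromℕ i)
      ≡⟨ cong (_* (1ℚ + fromℕ 2 * fromℕ i)) (rising-α L i (ℕₚ.<⇒≤ i<L)) ⟩
    A * F * (1ℚ + fromℕ 2 * fromℕ i)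
      ≡⟨ solve 3 (λ A F x → A :* F :* x := A :* x :* F) refl A F (1ℚ + fromℕ 2 * fromℕ i) ⟩
    A * (1ℚ + fromℕ 2 * fromℕ i) * F
      ≡⟨ cong (_* F) rec ⟨
    B * (fromℕ 2 * fromℕ (suc i)) * F
      ≡⟨ solve 3 (λ B y F → B :* (con (fromℕ 2) :* y) :* F := B :* (y :* F) :* con (fromℕ 2))
           refl B (fromℕ (suc i)) F ⟩
    B * (fromℕ (suc i) * F) * fromℕ 2
      ≡⟨ cong (λ z → B * z * fromℕ 2) (fromℕ-* (suc i) (i !)) ⟨
    B * fromℕ (suc i !) * fromℕ 2 ∎)
    where
      open ℚ-Solver.+-*-Solver
      open ≡-Reasoning
      D = fromℕ (α L 0)
      A = fromℕ (α L i)
      B = fromℕ (α L (suc i))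
      F = fromℕ (i !)
      rec : B * (fromℕ 2 * fromℕ (suc i)) ≡ A * (1ℚ + fromℕ 2 * fromℕ i)
      rec = begin
        B * (fromℕ 2 * fromℕ (suc i))             ≡⟨ cong (B *_) (fromℕ-* 2 (suc i)) ⟨
        B * fromℕ (2 ℕ.* suc i)                   ≡⟨ fromℕ-* (α L (suc i)) (2 ℕ.* suc i) ⟨
        fromℕ (α L (suc i) ℕ.* (2 ℕ.* suc i))     ≡⟨ cong fromℕ (α-rec L i i<L) ⟩
        fromℕ (α L i ℕ.* suc (2 ℕ.* i))           ≡⟨ fromℕ-* (α L i) (suc (2 ℕ.* i)) ⟩
        A * fromℕ (suc (2 ℕ.* i))                 ≡⟨ cong (A *_) (trans (fromℕ-suc (2 ℕ.* i)) (cong (λ z → 1ℚ + z) (fromℕ-* 2 i))) ⟩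
        A * (1ℚ + fromℕ 2 * fromℕ i) ∎

  -- The limit as K → ∞ is 1/π for every m; m = 0 is the Wallis product.
  wallis : ℕ → ℕ → ℚ
  wallis m K =
    (rising ½ (m ℕ.+ K) * rising ½ (m ℕ.+ K) * (fromℕ (m ℕ.+ K) + ½))
    /ℕ (K ! ℕ.* (2 ℕ.* m ℕ.+ K) !)
    where
      instance
        _ = K ℕₚ.!* (2 ℕ.* m ℕ.+ K) !≢0

  wallis-* : ∀ m K → wallis m K * (fromℕ (K !) * fromℕ ((2 ℕ.* m ℕ.+ K) !))
                   ≡ rising ½ (m ℕ.+ K) * rising ½ (m ℕ.+ K) * (fromℕ (m ℕ.+ K) + ½)
  wallis-* m K = trans (cong (wallis m K *_) (sym (fromℕ-* (K !) ((2 ℕ.* m ℕ.+ K) !))))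
    (/ℕ-*-cancel _ (K ! ℕ.* (2 ℕ.* m ℕ.+ K) !))
    where
      instance
        _ = K ℕₚ.!* (2 ℕ.* m ℕ.+ K) !≢0

  W : ℕ → ℚ
  W = wallis 0

  fromℕ-!-pos : ∀ n → 0ℚ < fromℕ (n !)
  fromℕ-!-pos n = fromℕ-pos (n !) {{n ℕₚ.!≢0}}

  W-α : ∀ L N → N ≤ L → W N * (fromℕ (α L 0) * fromℕ (α L 0))
                      ≡ fromℕ (α L N) * fromℕ (α L N) * (fromℕ N + ½)
  W-α L N N≤L = ≡-unscaleʳ (F * F) (*-pos (fromℕ-!-pos N) (fromℕ-!-pos N)) (begin
    W N * (D * D) * (F * F)
      ≡⟨ solve 3 (λ w D F → w :* (D :* D) :* (F :* F) := w :* (F :* F) :* (D :* D)) refl (W N) D F ⟩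
    W N * (F * F) * (D * D)
      ≡⟨ cong (_* (D * D)) (wallis-* 0 N) ⟩
    ρ * ρ * x * (D * D)
      ≡⟨ solve 3 (λ r x D → r :* r :* x :* (D :* D) := (r :* D) :* (r :* D) :* x) refl ρ x D ⟩
    (ρ * D) * (ρ * D) * x
      ≡⟨ cong (λ z → z * z * x) (rising-α L N N≤L) ⟩
    (A * F) * (A * F) * x
      ≡⟨ solve 3 (λ A F x → (A :* F) :* (A :* F) :* x := A :* A :* x :* (F :* F)) refl A F x ⟩
    A * A * x * (F * F) ∎)
    where
      open ℚ-Solver.+-*-Solver
      open ≡-Reasoning
      D = fromℕ (α L 0)
      A = fromℕ (α L N)
      F = fromℕ (N !)
      ρ = rising ½ N
      x = fromℕ N + ½

  rising½-pos : ∀ n → 0ℚ < rising ½ n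
  rising½-pos zero    = ℚₚ.positive⁻¹ 1ℚ
  rising½-pos (suc n) = *-pos (rising½-pos n) (ℚₚ.<-≤-trans 0<½ (p≤p+q ½ (fromℕ-nonNeg n)))

  rising½-nonNeg : ∀ n → 0ℚ ≤ℚ rising ½ n
  rising½-nonNeg n = ℚₚ.<⇒≤ (rising½-pos n)

  wallis-nonNeg : ∀ m K → 0ℚ ≤ℚ wallis m K
  wallis-nonNeg m K = ≤-unscaleʳ F (*-pos (fromℕ-!-pos K) (fromℕ-!-pos (2 ℕ.* m ℕ.+ K)))
    (ℚₚ.≤-trans (ℚₚ.≤-reflexive (ℚₚ.*-zeroˡ F)) (subst (0ℚ ≤ℚ_) (sym (wallis-* m K))
      (*-nonNeg (*-nonNeg (rising½-nonNeg (m ℕ.+ K)) (rising½-nonNeg (m ℕ.+ K)))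
        (+-nonNeg (fromℕ-nonNeg (m ℕ.+ K)) 0≤½))))
    where
      F = fromℕ (K !) * fromℕ ((2 ℕ.* m ℕ.+ K) !)

  -- The identity behind `v-step`, halved: (x + 1/2)(x + 3/2) + 1/4 = (x + 1)².
  W-step : ∀ N → W (suc N) ≤ℚ W N
  W-step N = ≤-unscaleʳ (F' * F') (*-pos (fromℕ-!-pos (suc N)) (fromℕ-!-pos (suc N))) (begin
    W (suc N) * (F' * F')
      ≡⟨ wallis-* 0 (suc N) ⟩
    ρ * (½ + x) * (ρ * (½ + x)) * (fromℕ (suc N) + ½)
      ≡⟨ cong (λ z → ρ * (½ + x) * (ρ * (½ + x)) * (z + ½)) (fromℕ-suc N) ⟩
    ρ * (½ + x) * (ρ * (½ + x)) * (1ℚ + x + ½)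
      ≤⟨ p≤p+q _ (*-nonNeg (*-nonNeg (*-nonNeg ρ≥0 ρ≥0) (+-nonNeg (fromℕ-nonNeg N) 0≤½)) (*-nonNeg 0≤½ 0≤½)) ⟩
    ρ * (½ + x) * (ρ * (½ + x)) * (1ℚ + x + ½) + ρ * ρ * (x + ½) * (½ * ½)
      ≡⟨ solve 2 (λ r x → r :* (con ½ :+ x) :* (r :* (con ½ :+ x)) :* (con 1ℚ :+ x :+ con ½) :+ r :* r :* (x :+ con ½) :* (con ½ :* con ½)
           := r :* r :* (x :+ con ½) :* ((con 1ℚ :+ x) :* (con 1ℚ :+ x))) refl ρ x ⟩
    ρ * ρ * (x + ½) * ((1ℚ + x) * (1ℚ + x))
      ≡⟨ cong₂ _*_ (wallis-* 0 N) (cong (λ z → z * z) (fromℕ-suc N)) ⟨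
    W N * (F * F) * (fromℕ (suc N) * fromℕ (suc N))
      ≡⟨ solve 3 (λ w F y → w :* (F :* F) :* (y :* y) := w :* (y :* F :* (y :* F))) refl (W N) F (fromℕ (suc N)) ⟩
    W N * (fromℕ (suc N) * F * (fromℕ (suc N) * F))
      ≡⟨ cong (λ z → W N * (z * z)) (fromℕ-* (suc N) (N !)) ⟨
    W N * (F' * F') ∎)
    where
      open ℚ-Solver.+-*-Solver
      open ℚₚ.≤-Reasoning
      F = fromℕ (N !)
      F' = fromℕ (suc N !)
      ρ = rising ½ N
      x = fromℕ N
      ρ≥0 = rising½-nonNeg N

  W≤½ : ∀ N → W N ≤ℚ ½
  W≤½ zero    = ℚₚ.≤-refl
  W≤½ (suc N) = ℚₚ.≤-trans (W-step N) (W≤½ N)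

open WallisProduct

-- The Wallis product against the content of the disc.

module WallisLimit where
  open import Data.Rational using (_+_; _*_; _-_; -_; _<_) renaming (_≤_ to _≤ℚ_)
  open CentralBinomial

  discArea-* : ∀ s .{{_ : ℕ.NonZero s}} →
    discArea (ℕ.pred s) * (fromℕ s * fromℕ s) ≡ fromℕ 4 * fromℕ (cells s)
  discArea-* (suc s) = begin
    discArea s * (fromℕ (suc s) * fromℕ (suc s))  ≡⟨ cong (discArea s *_) (fromℕ-* (suc s) (suc s)) ⟨
    discArea s * fromℕ (suc s ℕ.* suc s)          ≡⟨ /-*-cancel (4 ℕ.* cells (suc s)) (suc s ℕ.* suc s) ⟩
    fromℕ (4 ℕ.* cells (suc s))                   ≡⟨ fromℕ-* 4 (cells (suc s)) ⟩
    fromℕ 4 * fromℕ (cells (suc s)) ∎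
    where open ≡-Reasoning

  module _ (n : ℕ) where
    private
      -- One disc of radius S(N) serves both estimates: it contains the staircase of order n, and
      -- the staircase of order N + 1 covers it. The latter requires L to be at least N + 1.
      N L : ℕ
      N = suc n
      L = suc N

    side : ℕ
    side = S L (α L) (α-rec L) N

    private
      D = fromℕ (α L 0)
      A = fromℕ (α L N)
      x = fromℕ N
      w = W N

    -- Bounds the mesh width 1/`side` by 1/N, so the discretisation error of `content` vanishes as n
    -- grows.
    N≤side : N ≤ side
    N≤side = ℕₚ.≤-trans
      (ℕₚ.≤-reflexive (sym (trans (∑-const N 1) (ℕₚ.*-identityˡ N))))
      (∑-mono N λ i → ℕ.>-nonZero⁻¹ (α L i) {{α-nonZero L i}})

    instance
      side-nonZero : ℕ.NonZero side
      side-nonZero = ℕ.>-nonZero (ℕₚ.≤-trans (s≤s z≤n) N≤side)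

    content : ℚ
    content = discArea (ℕ.pred side)

    side-value : fromℕ side ≡ fromℕ 2 * x * A
    side-value = begin
      fromℕ side                        ≡⟨ cong fromℕ (S-closed L (α L) (α-rec L) N (ℕₚ.n≤1+n N)) ⟩
      fromℕ (2 ℕ.* N ℕ.* α L N)         ≡⟨ fromℕ-* (2 ℕ.* N) (α L N) ⟩
      fromℕ (2 ℕ.* N) * A               ≡⟨ cong (_* A) (fromℕ-* 2 N) ⟩
      fromℕ 2 * x * A ∎
      where open ≡-Reasoning

    0<D : 0ℚ < D
    0<D = fromℕ-pos (α L 0) {{α-nonZero L 0}}

    0≤x+½ : 0ℚ ≤ℚ x + ½
    0≤x+½ = +-nonNeg (fromℕ-nonNeg N) 0≤½

    -- Four times the cell count is `content` times the square of the side, the side is 2 N a_N, and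
    -- a_N² (N + 1/2) = W(N), all up to the scaling `D`. Bounds on the cell count thus become bounds
    -- on `content` · `w`, whose limit should be 1.
    cells-W : fromℕ (cells side) * (x + ½) ≡ content * w * x * x * (D * D)
    cells-W = ≡-unscaleʳ (fromℕ 4) (fromℕ-pos 4) (begin
      fromℕ (cells side) * (x + ½) * fromℕ 4
        ≡⟨ solve 3 (λ c y f → c :* y :* f := f :* c :* y) refl (fromℕ (cells side)) (x + ½) (fromℕ 4) ⟩
      fromℕ 4 * fromℕ (cells side) * (x + ½)
        ≡⟨ cong (_* (x + ½)) (discArea-* side) ⟨
      content * (fromℕ side * fromℕ side) * (x + ½)
        ≡⟨ cong (λ z → content * (z * z) * (x + ½)) side-value ⟩
      content * (fromℕ 2 * x * A * (fromℕ 2 * x * A)) * (x + ½)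
        ≡⟨ solve 4 (λ d x A y → d :* (con (fromℕ 2) :* x :* A :* (con (fromℕ 2) :* x :* A)) :* y
             := d :* (x :* x) :* (A :* A :* y) :* con (fromℕ 4)) refl content x A (x + ½) ⟩
      content * (x * x) * (A * A * (x + ½)) * fromℕ 4
        ≡⟨ cong (λ z → content * (x * x) * z * fromℕ 4) (W-α L N (ℕₚ.n≤1+n N)) ⟨
      content * (x * x) * (w * (D * D)) * fromℕ 4
        ≡⟨ solve 5 (λ d x w D f → d :* (x :* x) :* (w :* (D :* D)) :* f := d :* w :* x :* x :* (D :* D) :* f)
             refl content x w D (fromℕ 4) ⟩
      content * w * x * x * (D * D) * fromℕ 4 ∎)
      where
        open ℚ-Solver.+-*-Solver
        open ≡-Reasoning

    cast-DDn : ∀ k → fromℕ (α L 0 ℕ.* α L 0 ℕ.* k) ≡ D * D * fromℕ k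
    cast-DDn k = trans (fromℕ-* (α L 0 ℕ.* α L 0) k) (cong (_* fromℕ k) (fromℕ-* (α L 0) (α L 0)))

    content-lower : fromℕ n ≤ℚ content * w * x
    content-lower = ≤-unscaleʳ x (fromℕ-pos N) (≤-unscaleʳ (D * D) (*-pos 0<D 0<D) (begin
      fromℕ n * x * (D * D)
        ≤⟨ p≤p+q _ (*-nonNeg (*-nonNeg (fromℕ-nonNeg n) 0≤½) (ℚₚ.<⇒≤ (*-pos 0<D 0<D))) ⟩
      fromℕ n * x * (D * D) + fromℕ n * ½ * (D * D)
        ≡⟨ solve 3 (λ n x D → n :* x :* (D :* D) :+ n :* con ½ :* (D :* D) := D :* D :* n :* (x :+ con ½))
             refl (fromℕ n) x D ⟩
      D * D * fromℕ n * (x + ½)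
        ≡⟨ cong (_* (x + ½)) (cast-DDn n) ⟨
      fromℕ (α L 0 ℕ.* α L 0 ℕ.* n) * (x + ½)
        ≤⟨ ≤-scaleʳ (x + ½) 0≤x+½ (fromℕ-≤ {α L 0 ℕ.* α L 0 ℕ.* n} {cells side}
             (cells-lower-bound L (α L) (α-rec L) n (ℕₚ.≤-trans (ℕₚ.n≤1+n n) (ℕₚ.n≤1+n N)))) ⟩
      fromℕ (cells side) * (x + ½)
        ≡⟨ cells-W ⟩
      content * w * x * x * (D * D) ∎))
      where
        open ℚ-Solver.+-*-Solver
        open ℚₚ.≤-Reasoning

    -- The cell count is at most (N + 1) D², and (N + 1)(N + 1/2) ≤ (N + 2) N for N = n + 1, with
    -- slack n/2.
    content-upper : content * w * x ≤ℚ x + fromℕ 2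
    content-upper = ≤-unscaleʳ x (fromℕ-pos N) (≤-unscaleʳ (D * D) (*-pos 0<D 0<D) (begin
      content * w * x * x * (D * D)
        ≡⟨ cells-W ⟨
      fromℕ (cells side) * (x + ½)
        ≤⟨ ≤-scaleʳ (x + ½) 0≤x+½ (fromℕ-≤ {cells side} {α L 0 ℕ.* α L 0 ℕ.* suc N}
             (cells-upper-bound L (α L) (α-rec L) N ℕₚ.≤-refl)) ⟩
      fromℕ (α L 0 ℕ.* α L 0 ℕ.* suc N) * (x + ½)
        ≡⟨ cong (_* (x + ½)) (cast-DDn (suc N)) ⟩
      D * D * fromℕ (suc N) * (x + ½)
        ≡⟨ cong (λ z → D * D * z * (x + ½)) (trans (fromℕ-suc N) (cong (λ z → 1ℚ + z) (fromℕ-suc n))) ⟩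
      D * D * (1ℚ + (1ℚ + fromℕ n)) * (x + ½)
        ≡⟨ cong (λ z → D * D * (1ℚ + (1ℚ + fromℕ n)) * (z + ½)) (fromℕ-suc n) ⟩
      D * D * (1ℚ + (1ℚ + fromℕ n)) * (1ℚ + fromℕ n + ½)
        ≤⟨ p≤p+q _ (*-nonNeg (ℚₚ.<⇒≤ (*-pos 0<D 0<D)) (*-nonNeg (fromℕ-nonNeg n) 0≤½)) ⟩
      D * D * (1ℚ + (1ℚ + fromℕ n)) * (1ℚ + fromℕ n + ½) + D * D * (fromℕ n * ½)
        ≡⟨ solve 2 (λ n D → D :* D :* (con 1ℚ :+ (con 1ℚ :+ n)) :* (con 1ℚ :+ n :+ con ½) :+ D :* D :* (n :* con ½)
             := (con 1ℚ :+ n :+ con (fromℕ 2)) :* (con 1ℚ :+ n) :* (D :* D)) refl (fromℕ n) D ⟩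
      (1ℚ + fromℕ n + fromℕ 2) * (1ℚ + fromℕ n) * (D * D)
        ≡⟨ cong (λ z → (z + fromℕ 2) * z * (D * D)) (fromℕ-suc n) ⟨
      (x + fromℕ 2) * x * (D * D) ∎))
      where
        open ℚ-Solver.+-*-Solver
        open ℚₚ.≤-Reasoning

open WallisLimit

-- Rate of convergence of the Wallis product to 1/π.

module WallisRate where
  open import Data.Rational using (_+_; _*_; _-_; -_; _<_) renaming (_≤_ to _≤ℚ_)

  /-nonNeg : ∀ a n → 0ℚ ≤ℚ ℤ.+ a ℚ./ suc n
  /-nonNeg a n = /-≤ 0 0 a n z≤n

  inv : ℕ → ℚ
  inv n = ℤ.+ 1 ℚ./ suc n

  r : ℕ → ℚ
  r = seq (recip π π>0)

  module _ (n j : ℕ) where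
    private
      x = fromℕ (suc n)
      w = W (suc n)
      d = discArea j
      e = ℤ.+ 8 ℚ./ suc j

    w≥0 : 0ℚ ≤ℚ w
    w≥0 = wallis-nonNeg 0 (suc n)

    discArea-W-lower : fromℕ n ≤ℚ (d + e) * w * x
    discArea-W-lower = ℚₚ.≤-trans (content-lower n) (≤-scaleʳ x (fromℕ-nonNeg (suc n))
      (≤-scaleʳ w w≥0 (discArea-compare (ℕ.pred (side n)) j)))

    discArea-W-upper : d * w * x ≤ℚ x + fromℕ 6
    discArea-W-upper = begin
      d * w * x
        ≤⟨ ≤-scaleʳ x (fromℕ-nonNeg (suc n)) (≤-scaleʳ w w≥0 (discArea-compare j p)) ⟩
      (content n + f) * w * x
        ≡⟨ solve 4 (λ c f w x → (c :+ f) :* w :* x := c :* w :* x :+ w :* (f :* x)) refl (content n) f w x ⟩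
      content n * w * x + w * (f * x)
        ≤⟨ ℚₚ.+-mono-≤ (content-upper n) (*-mono-≤₀ (*-nonNeg (/-nonNeg 8 p) (fromℕ-nonNeg (suc n))) 0≤½ (W≤½ (suc n)) f*x≤8) ⟩
      -- The 2 is that of `content-upper`; changing the mesh adds at most 8/`side`, hence at most 8
      -- after multiplication by `x`, and `w` ≤ 1/2 halves this. Together they give the 6.
      x + fromℕ 2 + ½ * fromℕ 8
        ≡⟨ solve 1 (λ x → x :+ con (fromℕ 2) :+ con (½ * fromℕ 8) := x :+ con (fromℕ 6)) refl x ⟩
      x + fromℕ 6 ∎
      where
        open ℚ-Solver.+-*-Solver
        open ℚₚ.≤-Reasoning
        p = ℕ.pred (side n)
        f = ℤ.+ 8 ℚ./ suc p
        f*x≤8 : f * x ≤ℚ fromℕ 8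
        f*x≤8 = ℚₚ.≤-trans
          (≤-scaleˡ f (/-nonNeg 8 p) (fromℕ-≤ {suc n} {suc p}
            (ℕₚ.≤-trans (N≤side n) (ℕₚ.≤-reflexive (sym (ℕₚ.suc-pred (side n) {{side-nonZero n}}))))))
          (ℚₚ.≤-reflexive (/-*-cancel 8 (suc p)))

  ½≤discArea : ∀ j → 15 ≤ j → ½ ≤ℚ discArea j
  ½≤discArea j 15≤j = let _ , _ , _ , h = π>0 in
    subst (_≤ℚ discArea j) (ℚₚ.+-identityˡ ½) (h j 15≤j)

  -- The proof of `π>0` guarantees a content of at least 1/2 from index 15 on, so from there the
  -- truncation at 1/2 in `recip` has no effect.
  r-*-discArea : ∀ j → 15 ≤ j → r j * discArea j ≡ 1ℚ
  r-*-discArea j 15≤j = trans (cong (r j *_) (sym (ℚₚ.p≥q⇒p⊔q≡p (½≤discArea j 15≤j))))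
    (ℚₚ.*-inverseˡ (discArea j ℚ.⊔ ½) {{ℚₚ.pos⇒nonZero (discArea j ℚ.⊔ ½) {{⊔-pos (discArea j) 0<½}}}})

  r-nonNeg : ∀ j → 0ℚ ≤ℚ r j
  r-nonNeg j = ℚₚ.<⇒≤ (ℚₚ.positive⁻¹ (r j)
    {{ℚₚ.1/pos⇒pos (discArea j ℚ.⊔ ½) {{⊔-pos (discArea j) 0<½}}}})

  r≤2 : ∀ j → 15 ≤ j → r j ≤ℚ fromℕ 2
  r≤2 j 15≤j = ≤-unscaleʳ ½ 0<½ (ℚₚ.≤-trans (≤-scaleˡ (r j) (r-nonNeg j) (½≤discArea j 15≤j))
    (ℚₚ.≤-reflexive (r-*-discArea j 15≤j)))

  -- Write w - r = r (d w - 1) with r ≤ 2. The last factor is at most 6/(n + 1), and its negative is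
  -- at most 1/(n + 1) + e/2; the constant 12 = 2 · 6 covers both sides.
  W-rate : ∀ n j → 15 ≤ j → ℚ.∣ W (suc n) - r j ∣ ≤ℚ fromℕ 12 * inv n + (ℤ.+ 8 ℚ./ suc j)
  W-rate n j 15≤j = ∣p∣≤-intro
    (begin
      w - r j                     ≡⟨ cong (λ z → z - r j) w≡ ⟩
      r j * (d * w) - r j         ≡⟨ solve 2 (λ r y → r :* y :- r := r :* (y :- con 1ℚ)) refl (r j) (d * w) ⟩
      r j * (d * w - 1ℚ)          ≤⟨ ≤-scaleˡ (r j) (r-nonNeg j) upper ⟩
      r j * (fromℕ 6 * u)         ≤⟨ ≤-scaleʳ (fromℕ 6 * u) (*-nonNeg (fromℕ-nonNeg 6) u≥0) (r≤2 j 15≤j) ⟩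
      fromℕ 2 * (fromℕ 6 * u)     ≡⟨ solve 1 (λ u → con (fromℕ 2) :* (con (fromℕ 6) :* u) := con (fromℕ 12) :* u) refl u ⟩
      fromℕ 12 * u                ≤⟨ p≤p+q _ e≥0 ⟩
      fromℕ 12 * u + e ∎)
    (begin
      - (w - r j)                 ≡⟨ cong (λ z → - (z - r j)) w≡ ⟩
      - (r j * (d * w) - r j)     ≡⟨ solve 2 (λ r y → :- (r :* y :- r) := r :* (con 1ℚ :- y)) refl (r j) (d * w) ⟩
      r j * (1ℚ - d * w)          ≤⟨ ≤-scaleˡ (r j) (r-nonNeg j) lower ⟩
      r j * (u + e * ½)           ≤⟨ ≤-scaleʳ (u + e * ½) (+-nonNeg u≥0 (*-nonNeg e≥0 0≤½)) (r≤2 j 15≤j) ⟩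
      fromℕ 2 * (u + e * ½)       ≤⟨ p≤p+q _ (*-nonNeg (fromℕ-nonNeg 10) u≥0) ⟩
      fromℕ 2 * (u + e * ½) + fromℕ 10 * u
        ≡⟨ solve 2 (λ u e → con (fromℕ 2) :* (u :+ e :* con ½) :+ con (fromℕ 10) :* u := con (fromℕ 12) :* u :+ e) refl u e ⟩
      fromℕ 12 * u + e ∎)
    where
      open ℚ-Solver.+-*-Solver
      open ℚₚ.≤-Reasoning
      w = W (suc n)
      d = discArea j
      e = ℤ.+ 8 ℚ./ suc j
      u = inv n
      x = fromℕ (suc n)
      u≥0 = /-nonNeg 1 n
      e≥0 = /-nonNeg 8 j
      u*x : u * x ≡ 1ℚ
      u*x = /-*-cancel 1 (suc n)
      w≡ : w ≡ r j * (d * w)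
      w≡ = trans (sym (ℚₚ.*-identityˡ w)) (trans (cong (_* w) (sym (r-*-discArea j 15≤j))) (ℚₚ.*-assoc (r j) d w))
      upper : d * w - 1ℚ ≤ℚ fromℕ 6 * u
      upper = ≤-unscaleʳ x (fromℕ-pos (suc n)) (begin
        (d * w - 1ℚ) * x         ≡⟨ solve 2 (λ y x → (y :- con 1ℚ) :* x := y :* x :- x) refl (d * w) x ⟩
        d * w * x - x            ≤⟨ ℚₚ.+-monoˡ-≤ (- x) (discArea-W-upper n j) ⟩
        x + fromℕ 6 - x          ≡⟨ a+b-a x (fromℕ 6) ⟩
        fromℕ 6 * 1ℚ             ≡⟨ cong (fromℕ 6 *_) u*x ⟨
        fromℕ 6 * (u * x)        ≡⟨ ℚₚ.*-assoc (fromℕ 6) u x ⟨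
        fromℕ 6 * u * x ∎)
      lower : 1ℚ - d * w ≤ℚ u + e * ½
      lower = ≤-unscaleʳ x (fromℕ-pos (suc n)) (begin
        (1ℚ - d * w) * x         ≡⟨ solve 3 (λ d w x → (con 1ℚ :- d :* w) :* x := x :- d :* w :* x) refl d w x ⟩
        x - d * w * x            ≡⟨ cong (λ z → z - d * w * x) (fromℕ-suc n) ⟩
        1ℚ + fromℕ n - d * w * x
          ≤⟨ ℚₚ.+-monoˡ-≤ (- (d * w * x)) (ℚₚ.+-monoʳ-≤ 1ℚ (discArea-W-lower n j)) ⟩
        1ℚ + (d + e) * w * x - d * w * x
          ≡⟨ solve 4 (λ d e w x → con 1ℚ :+ (d :+ e) :* w :* x :- d :* w :* x := con 1ℚ :+ e :* w :* x) refl d e w x ⟩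
        1ℚ + e * w * x
          ≤⟨ ℚₚ.+-monoʳ-≤ 1ℚ (≤-scaleʳ x (fromℕ-nonNeg (suc n)) (≤-scaleˡ e e≥0 (W≤½ (suc n)))) ⟩
        1ℚ + e * ½ * x
          ≡⟨ cong (λ z → z + e * ½ * x) u*x ⟨
        u * x + e * ½ * x
          ≡⟨ ℚₚ.*-distribʳ-+ x u (e * ½) ⟨
        (u + e * ½) * x ∎)

-- The terms of the series and their shifts in n and k.

module SeriesTerms (m : ℕ) where
  open import Data.Rational using (_+_; _*_; _-_; -_; _<_) renaming (_≤_ to _≤ℚ_)
  open ℚ-Solver.+-*-Solver
  open ℚₚ.≤-Reasoning

  μ : ℚ
  μ = fromℕ m

  ρ : ℕ → ℚ
  ρ = rising ½

  P : ℕ → ℚ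
  P = rising (μ + ½)

  fall : ℕ → ℚ
  fall = falling (μ - ½)

  -- The term t(k, n) is cofactor k n (k + n) · fall n; the index l = k + n is
  -- kept separate so that the shifts of n and of k do not mix.
  cofactor : ℕ → ℕ → ℕ → ℚ
  cofactor k n l = (ρ (m ℕ.+ k) * ρ (m ℕ.+ l) * P n) /ℕ (n ! ℕ.* (l ! ℕ.* (2 ℕ.* m ℕ.+ l) !))
    where
      instance
        _ = ℕₚ.m*n≢0 (n !) (l ! ℕ.* (2 ℕ.* m ℕ.+ l) !) {{n ℕₚ.!≢0}} {{l ℕₚ.!* (2 ℕ.* m ℕ.+ l) !≢0}}

  denominator : ℕ → ℕ → ℚ
  denominator n l = fromℕ (n !) * (fromℕ (l !) * fromℕ ((2 ℕ.* m ℕ.+ l) !))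

  0<denominator : ∀ n l → 0ℚ < denominator n l
  0<denominator n l = *-pos (fromℕ-!-pos n) (*-pos (fromℕ-!-pos l) (fromℕ-!-pos (2 ℕ.* m ℕ.+ l)))

  denominator-cast : ∀ n l → fromℕ (n ! ℕ.* (l ! ℕ.* (2 ℕ.* m ℕ.+ l) !)) ≡ denominator n l
  denominator-cast n l = trans (fromℕ-* (n !) _) (cong (fromℕ (n !) *_) (fromℕ-* (l !) _))

  cofactor-* : ∀ k n l → cofactor k n l * denominator n l ≡ ρ (m ℕ.+ k) * ρ (m ℕ.+ l) * P n
  cofactor-* k n l = trans (cong (cofactor k n l *_) (sym (denominator-cast n l)))
    (/ℕ-*-cancel _ (n ! ℕ.* (l ! ℕ.* (2 ℕ.* m ℕ.+ l) !)))
    where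
      instance
        _ = ℕₚ.m*n≢0 (n !) (l ! ℕ.* (2 ℕ.* m ℕ.+ l) !) {{n ℕₚ.!≢0}} {{l ℕₚ.!* (2 ℕ.* m ℕ.+ l) !≢0}}

  fromℕ-suc! : ∀ n → fromℕ (suc n !) ≡ (1ℚ + fromℕ n) * fromℕ (n !)
  fromℕ-suc! n = trans (fromℕ-* (suc n) (n !)) (cong (_* fromℕ (n !)) (fromℕ-suc n))

  fromℕ-2m+l : ∀ l → fromℕ (2 ℕ.* m ℕ.+ l) ≡ fromℕ 2 * μ + fromℕ l
  fromℕ-2m+l l = trans (fromℕ-+ (2 ℕ.* m) l) (cong (_+ fromℕ l) (fromℕ-* 2 m))

  -- The factor by which l! (2m + l)! grows when l becomes l + 1.
  E : ℚ → ℚ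
  E y = (1ℚ + y) * (1ℚ + (fromℕ 2 * μ + y))

  tail-suc : ∀ l → fromℕ (suc l !) * fromℕ ((2 ℕ.* m ℕ.+ suc l) !)
                 ≡ E (fromℕ l) * (fromℕ (l !) * fromℕ ((2 ℕ.* m ℕ.+ l) !))
  tail-suc l = begin-equality
    fromℕ (suc l !) * fromℕ ((2 ℕ.* m ℕ.+ suc l) !)
      ≡⟨ cong₂ _*_ (fromℕ-suc! l) (trans (cong (λ z → fromℕ (z !)) (ℕₚ.+-suc (2 ℕ.* m) l))
           (trans (fromℕ-suc! (2 ℕ.* m ℕ.+ l)) (cong (λ z → (1ℚ + z) * G) (fromℕ-2m+l l)))) ⟩
    (1ℚ + fromℕ l) * F * ((1ℚ + (fromℕ 2 * μ + fromℕ l)) * G)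
      ≡⟨ solve 4 (λ a F b G → a :* F :* (b :* G) := a :* b :* (F :* G)) refl
           (1ℚ + fromℕ l) F (1ℚ + (fromℕ 2 * μ + fromℕ l)) G ⟩
    E (fromℕ l) * (F * G) ∎
    where
      F = fromℕ (l !)
      G = fromℕ ((2 ℕ.* m ℕ.+ l) !)

  ρ-suc : ∀ l → ρ (m ℕ.+ suc l) ≡ ρ (m ℕ.+ l) * (½ + (μ + fromℕ l))
  ρ-suc l = trans (cong ρ (ℕₚ.+-suc m l)) (cong (λ z → ρ (m ℕ.+ l) * (½ + z)) (fromℕ-+ m l))

  cofactor-suc-n : ∀ k n l → cofactor k (suc n) (suc l) * ((1ℚ + fromℕ n) * E (fromℕ l))
    ≡ cofactor k n l * ((½ + (μ + fromℕ l)) * (μ + ½ + fromℕ n))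
  cofactor-suc-n k n l = ≡-unscaleʳ (denominator n l) (0<denominator n l) (begin-equality
    c' * ((1ℚ + fromℕ n) * E (fromℕ l)) * (fromℕ (n !) * G)
      ≡⟨ solve 5 (λ c a e f G → c :* (a :* e) :* (f :* G) := c :* (a :* f :* (e :* G))) refl
           c' (1ℚ + fromℕ n) (E (fromℕ l)) (fromℕ (n !)) G ⟩
    c' * ((1ℚ + fromℕ n) * fromℕ (n !) * (E (fromℕ l) * G))
      ≡⟨ cong₂ (λ y z → c' * (y * z)) (fromℕ-suc! n) (tail-suc l) ⟨
    c' * denominator (suc n) (suc l)
      ≡⟨ cofactor-* k (suc n) (suc l) ⟩
    ρ (m ℕ.+ k) * ρ (m ℕ.+ suc l) * (P n * (μ + ½ + fromℕ n))
      ≡⟨ cong (λ z → ρ (m ℕ.+ k) * z * (P n * (μ + ½ + fromℕ n))) (ρ-suc l) ⟩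
    ρ (m ℕ.+ k) * (ρ (m ℕ.+ l) * (½ + (μ + fromℕ l))) * (P n * (μ + ½ + fromℕ n))
      ≡⟨ solve 5 (λ a b x c y → a :* (b :* x) :* (c :* y) := a :* b :* c :* (x :* y)) refl
           (ρ (m ℕ.+ k)) (ρ (m ℕ.+ l)) (½ + (μ + fromℕ l)) (P n) (μ + ½ + fromℕ n) ⟩
    ρ (m ℕ.+ k) * ρ (m ℕ.+ l) * P n * ((½ + (μ + fromℕ l)) * (μ + ½ + fromℕ n))
      ≡⟨ cong (_* ((½ + (μ + fromℕ l)) * (μ + ½ + fromℕ n))) (cofactor-* k n l) ⟨
    c * D * ((½ + (μ + fromℕ l)) * (μ + ½ + fromℕ n))
      ≡⟨ solve 3 (λ c D x → c :* D :* x := c :* x :* D) refl c D ((½ + (μ + fromℕ l)) * (μ + ½ + fromℕ n)) ⟩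
    c * ((½ + (μ + fromℕ l)) * (μ + ½ + fromℕ n)) * D ∎)
    where
      c = cofactor k n l
      c' = cofactor k (suc n) (suc l)
      D = denominator n l
      G = fromℕ (l !) * fromℕ ((2 ℕ.* m ℕ.+ l) !)

  cofactor-suc-k : ∀ k n l → cofactor (suc k) n (suc l) * E (fromℕ l)
    ≡ cofactor k n l * ((½ + (μ + fromℕ k)) * (½ + (μ + fromℕ l)))
  cofactor-suc-k k n l = ≡-unscaleʳ (denominator n l) (0<denominator n l) (begin-equality
    c' * E (fromℕ l) * (fromℕ (n !) * G)
      ≡⟨ solve 4 (λ c e f G → c :* e :* (f :* G) := c :* (f :* (e :* G))) refl
           c' (E (fromℕ l)) (fromℕ (n !)) G ⟩
    c' * (fromℕ (n !) * (E (fromℕ l) * G))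
      ≡⟨ cong (λ z → c' * (fromℕ (n !) * z)) (tail-suc l) ⟨
    c' * denominator n (suc l)
      ≡⟨ cofactor-* (suc k) n (suc l) ⟩
    ρ (m ℕ.+ suc k) * ρ (m ℕ.+ suc l) * P n
      ≡⟨ cong₂ (λ y z → y * z * P n) (ρ-suc k) (ρ-suc l) ⟩
    ρ (m ℕ.+ k) * (½ + (μ + fromℕ k)) * (ρ (m ℕ.+ l) * (½ + (μ + fromℕ l))) * P n
      ≡⟨ solve 5 (λ a y b x c → a :* y :* (b :* x) :* c := a :* b :* c :* (y :* x)) refl
           (ρ (m ℕ.+ k)) (½ + (μ + fromℕ k)) (ρ (m ℕ.+ l)) (½ + (μ + fromℕ l)) (P n) ⟩
    ρ (m ℕ.+ k) * ρ (m ℕ.+ l) * P n * ((½ + (μ + fromℕ k)) * (½ + (μ + fromℕ l)))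
      ≡⟨ cong (_* ((½ + (μ + fromℕ k)) * (½ + (μ + fromℕ l)))) (cofactor-* k n l) ⟨
    c * D * ((½ + (μ + fromℕ k)) * (½ + (μ + fromℕ l)))
      ≡⟨ solve 3 (λ c D x → c :* D :* x := c :* x :* D) refl c D ((½ + (μ + fromℕ k)) * (½ + (μ + fromℕ l))) ⟩
    c * ((½ + (μ + fromℕ k)) * (½ + (μ + fromℕ l))) * D ∎)
    where
      c = cofactor k n l
      c' = cofactor (suc k) n (suc l)
      D = denominator n l
      G = fromℕ (l !) * fromℕ ((2 ℕ.* m ℕ.+ l) !)

  t : ℕ → ℕ → ℚ
  t k n = fall n * cofactor k n (k ℕ.+ n)

  b : ℕ → ℕ → ℚ
  b k n = fromℕ (k ℕ.+ m ℕ.+ 2 ℕ.* n) + ½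

  F : ℕ → ℕ → ℚ
  F k n = t k n * b k n

-- The Wilf-Zeilberger identity and its summation.

module Telescoping (m : ℕ) where
  open import Data.Rational using (_+_; _*_; _-_; -_; _<_) renaming (_≤_ to _≤ℚ_)
  open ℚ-Solver.+-*-Solver
  open ℚₚ.≤-Reasoning
  open SeriesTerms m

  -- Explains the shape of `cofactor`: the factor (1/2)_m of the prefactor merges with (m +
  -- 1/2)_(k+n) into one rising factorial.
  ρ-+ : ∀ l → ρ (m ℕ.+ l) ≡ ρ m * P l
  ρ-+ zero    = trans (cong ρ (ℕₚ.+-identityʳ m)) (sym (ℚₚ.*-identityʳ (ρ m)))
  ρ-+ (suc l) = begin-equality
    ρ (m ℕ.+ suc l)                       ≡⟨ ρ-suc l ⟩
    ρ (m ℕ.+ l) * (½ + (μ + fromℕ l))     ≡⟨ cong (_* (½ + (μ + fromℕ l))) (ρ-+ l) ⟩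
    ρ m * P l * (½ + (μ + fromℕ l))
      ≡⟨ solve 4 (λ r p u l → r :* p :* (con ½ :+ (u :+ l)) := r :* (p :* (u :+ con ½ :+ l))) refl (ρ m) (P l) μ (fromℕ l) ⟩
    ρ m * (P l * (μ + ½ + fromℕ l)) ∎

  b-value : ∀ k n → b k n ≡ fromℕ k + μ + fromℕ 2 * fromℕ n + ½
  b-value k n = cong (_+ ½) (trans (fromℕ-+ (k ℕ.+ m) (2 ℕ.* n)) (cong₂ _+_ (fromℕ-+ k m) (fromℕ-* 2 n)))

  t-suc-n : ∀ k n → t k (suc n) * ((1ℚ + fromℕ n) * E (fromℕ (k ℕ.+ n)))
    ≡ t k n * ((½ + (μ + fromℕ (k ℕ.+ n))) * (μ + ½ + fromℕ n) * (μ - ½ - fromℕ n))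
  t-suc-n k n = begin-equality
    fall n * g * cofactor k (suc n) (k ℕ.+ suc n) * d
      ≡⟨ cong (λ l → fall n * g * cofactor k (suc n) l * d) (ℕₚ.+-suc k n) ⟩
    fall n * g * c' * d
      ≡⟨ solve 4 (λ f g c d → f :* g :* c :* d := f :* g :* (c :* d)) refl (fall n) g c' d ⟩
    fall n * g * (c' * d)
      ≡⟨ cong (fall n * g *_) (cofactor-suc-n k n (k ℕ.+ n)) ⟩
    fall n * g * (c * z)
      ≡⟨ solve 4 (λ f g c z → f :* g :* (c :* z) := f :* c :* (z :* g)) refl (fall n) g c z ⟩
    t k n * (z * g) ∎
    where
      g = μ - ½ - fromℕ n
      d = (1ℚ + fromℕ n) * E (fromℕ (k ℕ.+ n))
      c = cofactor k n (k ℕ.+ n)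
      c' = cofactor k (suc n) (suc (k ℕ.+ n))
      z = (½ + (μ + fromℕ (k ℕ.+ n))) * (μ + ½ + fromℕ n)

  t-suc-k : ∀ k n → t (suc k) n * E (fromℕ (k ℕ.+ n))
    ≡ t k n * ((½ + (μ + fromℕ k)) * (½ + (μ + fromℕ (k ℕ.+ n))))
  t-suc-k k n = trans (ℚₚ.*-assoc (fall n) _ _)
    (trans (cong (fall n *_) (cofactor-suc-k k n (k ℕ.+ n))) (sym (ℚₚ.*-assoc (fall n) _ _)))

  0<1+ : ∀ {q} → 0ℚ ≤ℚ q → 0ℚ < 1ℚ + q
  0<1+ {q} 0≤q = ℚₚ.<-≤-trans (ℚₚ.positive⁻¹ 1ℚ) (p≤p+q 1ℚ 0≤q)

  0<e : ∀ l → 0ℚ < 1ℚ + (fromℕ 2 * μ + fromℕ l)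
  0<e l = 0<1+ (+-nonNeg (*-nonNeg (fromℕ-nonNeg 2) (fromℕ-nonNeg m)) (fromℕ-nonNeg l))

  0<E : ∀ l → 0ℚ < E (fromℕ l)
  0<E l = *-pos (0<1+ (fromℕ-nonNeg l)) (0<e l)

  -- Multiplied by E(k + n), both shifted terms become polynomial multiples of t(k, n): the factor n
  -- + 1 in front of t(k, n + 1) is exactly what `t-suc-n` asks for in addition. There remains a
  -- cubic polynomial identity in m, k and n. Moving the subtracted terms across keeps it free of
  -- differences of terms.
  wz : ∀ k n → F (suc k) n + fromℕ n * t k n ≡ F k n + fromℕ (suc n) * t k (suc n)
  wz k n = ≡-unscaleʳ (E (fromℕ (k ℕ.+ n))) (0<E (k ℕ.+ n)) (begin-equality
    (t (suc k) n * b (suc k) n + x * T) * e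
      ≡⟨ cong (λ z → (t (suc k) n * z + x * T) * e) (trans (b-value (suc k) n)
           (cong (λ z → z + μ + fromℕ 2 * x + ½) (fromℕ-suc k))) ⟩
    (t (suc k) n * (1ℚ + κ + μ + fromℕ 2 * x + ½) + x * T) * e
      ≡⟨ solve 5 (λ t b x T e → (t :* b :+ x :* T) :* e := t :* e :* b :+ x :* T :* e) refl
           (t (suc k) n) (1ℚ + κ + μ + fromℕ 2 * x + ½) x T e ⟩
    t (suc k) n * e * (1ℚ + κ + μ + fromℕ 2 * x + ½) + x * T * e
      ≡⟨ cong (λ z → z * (1ℚ + κ + μ + fromℕ 2 * x + ½) + x * T * e) (t-suc-k k n) ⟩
    T * ((½ + (μ + κ)) * (½ + (μ + y))) * (1ℚ + κ + μ + fromℕ 2 * x + ½) + x * T * e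
      ≡⟨ cong (λ z → T * ((½ + (μ + κ)) * (½ + (μ + z))) * (1ℚ + κ + μ + fromℕ 2 * x + ½) + x * T * E z) y≡ ⟩
    T * ((½ + (μ + κ)) * (½ + (μ + (κ + x)))) * (1ℚ + κ + μ + fromℕ 2 * x + ½) + x * T * E (κ + x)
      ≡⟨ solve 4 (λ T u k x →
           T :* ((con ½ :+ (u :+ k)) :* (con ½ :+ (u :+ (k :+ x)))) :* (con 1ℚ :+ k :+ u :+ con (fromℕ 2) :* x :+ con ½)
             :+ x :* T :* ((con 1ℚ :+ (k :+ x)) :* (con 1ℚ :+ (con (fromℕ 2) :* u :+ (k :+ x))))
           := T :* (k :+ u :+ con (fromℕ 2) :* x :+ con ½) :* ((con 1ℚ :+ (k :+ x)) :* (con 1ℚ :+ (con (fromℕ 2) :* u :+ (k :+ x))))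
             :+ T :* ((con ½ :+ (u :+ (k :+ x))) :* (u :+ con ½ :+ x) :* (u :- con ½ :- x))) refl T μ κ x ⟩
    T * (κ + μ + fromℕ 2 * x + ½) * E (κ + x) + T * ((½ + (μ + (κ + x))) * (μ + ½ + x) * (μ - ½ - x))
      ≡⟨ cong₂ (λ y β → T * β * E y + T * ((½ + (μ + y)) * (μ + ½ + x) * (μ - ½ - x))) y≡ (b-value k n) ⟨
    T * b k n * e + T * ((½ + (μ + y)) * (μ + ½ + x) * (μ - ½ - x))
      ≡⟨ cong (T * b k n * e +_) (t-suc-n k n) ⟨
    T * b k n * e + t k (suc n) * ((1ℚ + x) * e)
      ≡⟨ solve 4 (λ f t a e → f :* e :+ t :* (a :* e) := (f :+ a :* t) :* e) refl (F k n) (t k (suc n)) (1ℚ + x) e ⟩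
    (F k n + (1ℚ + x) * t k (suc n)) * e
      ≡⟨ cong (λ z → (F k n + z * t k (suc n)) * e) (fromℕ-suc n) ⟨
    (F k n + fromℕ (suc n) * t k (suc n)) * e ∎)
    where
      T = t k n
      x = fromℕ n
      κ = fromℕ k
      y = fromℕ (k ℕ.+ n)
      e = E y
      y≡ : y ≡ κ + x
      y≡ = fromℕ-+ k n

  Q : ℕ → ℕ → ℚ
  Q k = partialSum (F k)

  -- The sum of `wz` over n < M telescopes, and the factor n removes the lower boundary term.
  Q-suc-k : ∀ k M → Q (suc k) M ≡ Q k M + fromℕ M * t k M
  Q-suc-k k zero    = sym (trans (ℚₚ.+-identityˡ (0ℚ * t k 0)) (ℚₚ.*-zeroˡ (t k 0)))
  Q-suc-k k (suc M) = begin-equality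
    Q (suc k) M + F (suc k) M                        ≡⟨ cong (_+ F (suc k) M) (Q-suc-k k M) ⟩
    Q k M + fromℕ M * t k M + F (suc k) M
      ≡⟨ solve 3 (λ q a f → q :+ a :+ f := q :+ (f :+ a)) refl (Q k M) (fromℕ M * t k M) (F (suc k) M) ⟩
    Q k M + (F (suc k) M + fromℕ M * t k M)          ≡⟨ cong (Q k M +_) (wz k M) ⟩
    Q k M + (F k M + fromℕ (suc M) * t k (suc M))    ≡⟨ ℚₚ.+-assoc (Q k M) _ _ ⟨
    Q k M + F k M + fromℕ (suc M) * t k (suc M) ∎

-- Identification with the stated prefactor and summand.

module Identification (m : ℕ) where
  open import Data.Rational using (_+_; _*_; _-_; -_; _<_) renaming (_≤_ to _≤ℚ_)
  open ℚ-Solver.+-*-Solver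
  open ℚₚ.≤-Reasoning
  open SeriesTerms m
  open Telescoping m

  2*suc : ∀ m → 2 ℕ.* suc m ≡ suc (suc (2 ℕ.* m))
  2*suc = ℕₚ.*-suc 2

  -- The odd factors of (2m)! multiply to 2^m (1/2)_m and the even ones to 2^m m!. This cancels the
  -- powers of 2 and the factorials in the prefactor.
  centralFactor : ∀ m → fromℕ ((2 ℕ.* m) !) ≡ ρ m * (fromℕ (2 ℕ.^ (2 ℕ.* m)) * fromℕ (m !))
  centralFactor zero    = refl
  centralFactor (suc m) = begin-equality
    fromℕ ((2 ℕ.* suc m) !)
      ≡⟨ cong (λ z → fromℕ (z !)) (2*suc m) ⟩
    fromℕ (suc (suc (2 ℕ.* m)) !)
      ≡⟨ trans (fromℕ-suc! (suc (2 ℕ.* m))) (cong₂ (λ y z → (1ℚ + y) * z)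
           (trans (fromℕ-suc (2 ℕ.* m)) (cong (1ℚ +_) (fromℕ-* 2 m)))
           (trans (fromℕ-suc! (2 ℕ.* m)) (cong₂ (λ y z → (1ℚ + y) * z) (fromℕ-* 2 m) (centralFactor m)))) ⟩
    (1ℚ + (1ℚ + fromℕ 2 * x)) * ((1ℚ + fromℕ 2 * x) * (ρ m * (p * f)))
      ≡⟨ solve 4 (λ x r p f → (con 1ℚ :+ (con 1ℚ :+ con (fromℕ 2) :* x)) :* ((con 1ℚ :+ con (fromℕ 2) :* x) :* (r :* (p :* f)))
           := r :* (con ½ :+ x) :* (con (fromℕ 2) :* (con (fromℕ 2) :* p) :* ((con 1ℚ :+ x) :* f))) refl x (ρ m) p f ⟩
    ρ m * (½ + x) * (fromℕ 2 * (fromℕ 2 * p) * ((1ℚ + x) * f))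
      ≡⟨ cong₂ (λ y z → ρ m * (½ + x) * (y * z))
           (trans (cong (λ z → fromℕ (2 ℕ.^ z)) (2*suc m)) (trans (fromℕ-* 2 (2 ℕ.* 2 ℕ.^ (2 ℕ.* m)))
             (cong (fromℕ 2 *_) (fromℕ-* 2 (2 ℕ.^ (2 ℕ.* m))))))
           (fromℕ-suc! m) ⟨
    ρ m * (½ + x) * (fromℕ (2 ℕ.^ (2 ℕ.* suc m)) * fromℕ (suc m !)) ∎
    where
      x = fromℕ m
      p = fromℕ (2 ℕ.^ (2 ℕ.* m))
      f = fromℕ (m !)

  prefactor-value : ∀ k → prefactor m k ≡ ρ (m ℕ.+ k) * ρ m
  prefactor-value k = ≡-unscaleʳ (p * f) (*-pos (fromℕ-pos (2 ℕ.^ (2 ℕ.* m))) (fromℕ-!-pos m)) (begin-equality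
    A * B * (p * f)
      ≡⟨ solve 4 (λ A B p f → A :* B :* (p :* f) := A :* p :* (B :* f)) refl A B p f ⟩
    A * p * (B * f)
      ≡⟨ cong₂ _*_ (/ℕ-*-cancel (ρ (m ℕ.+ k)) (2 ℕ.^ (2 ℕ.* m))) (/ℕ-*-cancel (fromℕ ((2 ℕ.* m) !)) (m !)) ⟩
    ρ (m ℕ.+ k) * fromℕ ((2 ℕ.* m) !)
      ≡⟨ cong (ρ (m ℕ.+ k) *_) (centralFactor m) ⟩
    ρ (m ℕ.+ k) * (ρ m * (p * f))
      ≡⟨ ℚₚ.*-assoc (ρ (m ℕ.+ k)) (ρ m) (p * f) ⟨
    ρ (m ℕ.+ k) * ρ m * (p * f) ∎)
    where
      instance
        _ = ℕₚ.m^n≢0 2 (2 ℕ.* m)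
        _ = m ℕₚ.!≢0
      p = fromℕ (2 ℕ.^ (2 ℕ.* m))
      f = fromℕ (m !)
      A = ρ (m ℕ.+ k) /ℕ (2 ℕ.^ (2 ℕ.* m))
      B = fromℕ ((2 ℕ.* m) !) /ℕ (m !)

  summand-* : ∀ k n → summand m k n * denominator n (k ℕ.+ n) ≡ P n * fall n * P (k ℕ.+ n) * b k n
  summand-* k n = begin-equality
    summand m k n * denominator n (k ℕ.+ n)
      ≡⟨ cong (λ z → summand m k n * (fromℕ (n !) * (fromℕ ((k ℕ.+ n) !) * fromℕ (z !)))) (sym (ℕₚ.+-assoc (2 ℕ.* m) k n)) ⟩
    summand m k n * (fromℕ (n !) * (fromℕ ((k ℕ.+ n) !) * fromℕ ((2 ℕ.* m ℕ.+ k ℕ.+ n) !)))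
      ≡⟨ cong (summand m k n *_) (trans (fromℕ-* (n ! ℕ.* (k ℕ.+ n) !) ((2 ℕ.* m ℕ.+ k ℕ.+ n) !))
           (trans (cong (_* fromℕ ((2 ℕ.* m ℕ.+ k ℕ.+ n) !)) (fromℕ-* (n !) ((k ℕ.+ n) !)))
             (ℚₚ.*-assoc (fromℕ (n !)) (fromℕ ((k ℕ.+ n) !)) (fromℕ ((2 ℕ.* m ℕ.+ k ℕ.+ n) !))))) ⟨
    summand m k n * fromℕ (n ! ℕ.* (k ℕ.+ n) ! ℕ.* (2 ℕ.* m ℕ.+ k ℕ.+ n) !)
      ≡⟨ /ℕ-*-cancel (P n * fall n * P (k ℕ.+ n) * b k n) (n ! ℕ.* (k ℕ.+ n) ! ℕ.* (2 ℕ.* m ℕ.+ k ℕ.+ n) !) ⟩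
    P n * fall n * P (k ℕ.+ n) * b k n ∎
    where
      instance
        _ = ℕₚ.m*n≢0 (n ! ℕ.* (k ℕ.+ n) !) ((2 ℕ.* m ℕ.+ k ℕ.+ n) !)
              {{n ℕₚ.!* (k ℕ.+ n) !≢0}} {{(2 ℕ.* m ℕ.+ k ℕ.+ n) ℕₚ.!≢0}}

  F-summand : ∀ k n → F k n ≡ prefactor m k * summand m k n
  F-summand k n = ≡-unscaleʳ D (0<denominator n (k ℕ.+ n)) (begin-equality
    fall n * c * β * D
      ≡⟨ solve 4 (λ f c b D → f :* c :* b :* D := c :* D :* f :* b) refl (fall n) c β D ⟩
    c * D * fall n * β
      ≡⟨ cong (λ z → z * fall n * β) (cofactor-* k n (k ℕ.+ n)) ⟩
    ρ (m ℕ.+ k) * ρ (m ℕ.+ (k ℕ.+ n)) * P n * fall n * β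
      ≡⟨ cong (λ z → ρ (m ℕ.+ k) * z * P n * fall n * β) (ρ-+ (k ℕ.+ n)) ⟩
    ρ (m ℕ.+ k) * (ρ m * P (k ℕ.+ n)) * P n * fall n * β
      ≡⟨ solve 6 (λ r s q p f b → r :* (s :* q) :* p :* f :* b := r :* s :* (p :* f :* q :* b)) refl
           (ρ (m ℕ.+ k)) (ρ m) (P (k ℕ.+ n)) (P n) (fall n) β ⟩
    ρ (m ℕ.+ k) * ρ m * (P n * fall n * P (k ℕ.+ n) * β)
      ≡⟨ cong₂ _*_ (prefactor-value k) (summand-* k n) ⟨
    prefactor m k * (summand m k n * D)
      ≡⟨ ℚₚ.*-assoc (prefactor m k) (summand m k n) D ⟨
    prefactor m k * summand m k n * D ∎)
    where
      D = denominator n (k ℕ.+ n)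
      c = cofactor k n (k ℕ.+ n)
      β = b k n

  Q-summand : ∀ k M → Q k M ≡ prefactor m k * partialSum (summand m k) M
  Q-summand k zero    = sym (ℚₚ.*-zeroʳ (prefactor m k))
  Q-summand k (suc M) = trans (cong₂ _+_ (Q-summand k M) (F-summand k M))
    (sym (ℚₚ.*-distribˡ-+ (prefactor m k) _ _))

  -- At n = 0 all products indexed by n are empty; `wallis` is defined for general m in order to
  -- match what is left.
  F-wallis : ∀ k → F k 0 ≡ wallis m k
  F-wallis k = ≡-unscaleʳ G (*-pos (fromℕ-!-pos k) (fromℕ-!-pos (2 ℕ.* m ℕ.+ k))) (begin-equality
    1ℚ * cofactor k 0 (k ℕ.+ 0) * b k 0 * G
      ≡⟨ cong₂ (λ z y → 1ℚ * cofactor k 0 z * y * G) (ℕₚ.+-identityʳ k) (b-value k 0) ⟩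
    1ℚ * c * (fromℕ k + μ + fromℕ 2 * fromℕ 0 + ½) * G
      ≡⟨ solve 4 (λ c k u G → con 1ℚ :* c :* (k :+ u :+ con (fromℕ 2) :* con (fromℕ 0) :+ con ½) :* G
           := c :* (con 1ℚ :* G) :* (u :+ k :+ con ½)) refl c (fromℕ k) μ G ⟩
    c * (1ℚ * G) * (μ + fromℕ k + ½)
      ≡⟨ cong₂ (λ z y → z * (y + ½)) (cofactor-* k 0 k) (sym (fromℕ-+ m k)) ⟩
    ρ (m ℕ.+ k) * ρ (m ℕ.+ k) * 1ℚ * (fromℕ (m ℕ.+ k) + ½)
      ≡⟨ cong (_* (fromℕ (m ℕ.+ k) + ½)) (ℚₚ.*-identityʳ (ρ (m ℕ.+ k) * ρ (m ℕ.+ k))) ⟩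
    ρ (m ℕ.+ k) * ρ (m ℕ.+ k) * (fromℕ (m ℕ.+ k) + ½)
      ≡⟨ wallis-* m k ⟨
    wallis m k * G ∎)
    where
      G = fromℕ (k !) * fromℕ ((2 ℕ.* m ℕ.+ k) !)
      c = cofactor k 0 k

-- Signs and ratio bounds of the terms.

module TermBounds (m : ℕ) where
  open import Data.Rational using (_+_; _*_; _-_; -_; _<_) renaming (_≤_ to _≤ℚ_)
  open ℚ-Solver.+-*-Solver
  open ℚₚ.≤-Reasoning
  open SeriesTerms m
  open Telescoping m

  0≤μ : 0ℚ ≤ℚ μ
  0≤μ = fromℕ-nonNeg m

  ∣*∣-nonNegʳ : ∀ p {q} → 0ℚ ≤ℚ q → ℚ.∣ p * q ∣ ≡ ℚ.∣ p ∣ * q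
  ∣*∣-nonNegʳ p {q} 0≤q = trans (ℚₚ.∣p*q∣≡∣p∣*∣q∣ p q) (cong (ℚ.∣ p ∣ *_) (ℚₚ.0≤p⇒∣p∣≡p 0≤q))

  P-nonNeg : ∀ n → 0ℚ ≤ℚ P n
  P-nonNeg zero    = ℚₚ.<⇒≤ (ℚₚ.positive⁻¹ 1ℚ)
  P-nonNeg (suc n) = *-nonNeg (P-nonNeg n) (+-nonNeg (+-nonNeg 0≤μ 0≤½) (fromℕ-nonNeg n))

  cofactor-nonNeg : ∀ k n l → 0ℚ ≤ℚ cofactor k n l
  cofactor-nonNeg k n l = ≤-unscaleʳ (denominator n l) (0<denominator n l)
    (ℚₚ.≤-trans (ℚₚ.≤-reflexive (ℚₚ.*-zeroˡ (denominator n l)))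
      (subst (0ℚ ≤ℚ_) (sym (cofactor-* k n l))
        (*-nonNeg (*-nonNeg (rising½-nonNeg (m ℕ.+ k)) (rising½-nonNeg (m ℕ.+ l))) (P-nonNeg n))))

  t-nonNeg : ∀ k n → 0ℚ ≤ℚ fall n → 0ℚ ≤ℚ t k n
  t-nonNeg k n 0≤f = *-nonNeg 0≤f (cofactor-nonNeg k n (k ℕ.+ n))

  t-nonPos : ∀ k n → fall n ≤ℚ 0ℚ → t k n ≤ℚ 0ℚ
  t-nonPos k n f≤0 = ℚₚ.≤-trans (≤-scaleʳ _ (cofactor-nonNeg k n (k ℕ.+ n)) f≤0)
    (ℚₚ.≤-reflexive (ℚₚ.*-zeroˡ (cofactor k n (k ℕ.+ n))))

  b-nonNeg : ∀ k n → 0ℚ ≤ℚ b k n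
  b-nonNeg k n = +-nonNeg (fromℕ-nonNeg (k ℕ.+ m ℕ.+ 2 ℕ.* n)) 0≤½

  b-suc : ∀ k n → b k (suc n) ≡ b k n + fromℕ 2
  b-suc k n = begin-equality
    b k (suc n)                                    ≡⟨ b-value k (suc n) ⟩
    fromℕ k + μ + fromℕ 2 * fromℕ (suc n) + ½      ≡⟨ cong (λ z → fromℕ k + μ + fromℕ 2 * z + ½) (fromℕ-suc n) ⟩
    fromℕ k + μ + fromℕ 2 * (1ℚ + fromℕ n) + ½
      ≡⟨ solve 3 (λ k u x → k :+ u :+ con (fromℕ 2) :* (con 1ℚ :+ x) :+ con ½
           := k :+ u :+ con (fromℕ 2) :* x :+ con ½ :+ con (fromℕ 2)) refl (fromℕ k) μ (fromℕ n) ⟩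
    fromℕ k + μ + fromℕ 2 * fromℕ n + ½ + fromℕ 2  ≡⟨ cong (_+ fromℕ 2) (b-value k n) ⟨
    b k n + fromℕ 2 ∎

  ∣F∣ : ∀ k n → ℚ.∣ F k n ∣ ≡ ℚ.∣ t k n ∣ * b k n
  ∣F∣ k n = ∣*∣-nonNegʳ (t k n) (b-nonNeg k n)

  c : ℕ → ℚ
  c n = μ + ½ + fromℕ n

  c-nonNeg : ∀ n → 0ℚ ≤ℚ c n
  c-nonNeg n = +-nonNeg (+-nonNeg 0≤μ 0≤½) (fromℕ-nonNeg n)

  g : ℕ → ℚ
  g n = μ - ½ - fromℕ n

  -- With l = k + n, the exact ratio contains the further factor (m + l + 1/2)/(2m + l + 1), which
  -- is at most 1 and is dropped.
  t-ratio : ∀ k n → ℚ.∣ t k (suc n) ∣ * ((1ℚ + fromℕ n) * (1ℚ + fromℕ (k ℕ.+ n)))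
                  ≤ℚ ℚ.∣ t k n ∣ * (c n * ℚ.∣ g n ∣)
  t-ratio k n = ≤-unscaleʳ e (0<e (k ℕ.+ n)) (begin
    T' * ((1ℚ + x) * (1ℚ + y)) * e
      ≡⟨ solve 4 (λ t a b e → t :* (a :* b) :* e := t :* (a :* (b :* e))) refl T' (1ℚ + x) (1ℚ + y) e ⟩
    T' * ((1ℚ + x) * E y)
      ≡⟨ ∣*∣-nonNegʳ (t k (suc n)) (ℚₚ.<⇒≤ (*-pos (0<1+ (fromℕ-nonNeg n)) (0<E (k ℕ.+ n)))) ⟨
    ℚ.∣ t k (suc n) * ((1ℚ + x) * E y) ∣
      ≡⟨ cong ℚ.∣_∣ (t-suc-n k n) ⟩
    ℚ.∣ t k n * (z * c n * g n) ∣
      ≡⟨ trans (ℚₚ.∣p*q∣≡∣p∣*∣q∣ (t k n) _) (cong (T *_) (trans (cong ℚ.∣_∣ (ℚₚ.*-comm (z * c n) (g n)))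
           (∣*∣-nonNegʳ (g n) (*-nonNeg z≥0 (c-nonNeg n))))) ⟩
    T * (ℚ.∣ g n ∣ * (z * c n))
      ≡⟨ solve 4 (λ T g z c → T :* (g :* (z :* c)) := T :* (c :* g) :* z) refl T ℚ.∣ g n ∣ z (c n) ⟩
    T * (c n * ℚ.∣ g n ∣) * z
      ≤⟨ ≤-scaleˡ _ (*-nonNeg (ℚₚ.0≤∣p∣ (t k n)) (*-nonNeg (c-nonNeg n) (ℚₚ.0≤∣p∣ (g n)))) z≤e ⟩
    T * (c n * ℚ.∣ g n ∣) * e ∎)
    where
      x = fromℕ n
      y = fromℕ (k ℕ.+ n)
      e = 1ℚ + (fromℕ 2 * μ + y)
      z = ½ + (μ + y)
      T = ℚ.∣ t k n ∣
      T' = ℚ.∣ t k (suc n) ∣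
      z≥0 : 0ℚ ≤ℚ z
      z≥0 = +-nonNeg 0≤½ (+-nonNeg 0≤μ (fromℕ-nonNeg (k ℕ.+ n)))
      z≤e : z ≤ℚ e
      z≤e = ℚₚ.≤-trans (p≤p+q z (+-nonNeg 0≤½ 0≤μ)) (ℚₚ.≤-reflexive
        (solve 2 (λ u y → con ½ :+ (u :+ y) :+ (con ½ :+ u) := con 1ℚ :+ (con (fromℕ 2) :* u :+ y)) refl μ y))

  ∣g∣≤c : ∀ n → ℚ.∣ g n ∣ ≤ℚ c n
  ∣g∣≤c n = ∣p∣≤-intro
    (ℚₚ.≤-trans (p≤p+q (g n) (+-nonNeg (ℚₚ.<⇒≤ (ℚₚ.positive⁻¹ 1ℚ)) (+-nonNeg x≥0 x≥0))) (ℚₚ.≤-reflexive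
      (solve 2 (λ u x → u :- con ½ :- x :+ (con 1ℚ :+ (x :+ x)) := u :+ con ½ :+ x) refl μ (fromℕ n))))
    (ℚₚ.≤-trans (p≤p+q (- g n) (+-nonNeg 0≤μ 0≤μ)) (ℚₚ.≤-reflexive
      (solve 2 (λ u x → :- (u :- con ½ :- x) :+ (u :+ u) := u :+ con ½ :+ x) refl μ (fromℕ n))))
    where x≥0 = fromℕ-nonNeg n

  -- A crude bound for fixed n and growing k: its right-hand factor is independent of k, while the
  -- left side gains 1 + k + n.
  F-ratio : ∀ k n → ℚ.∣ F k (suc n) ∣ * (1ℚ + fromℕ (k ℕ.+ n)) ≤ℚ ℚ.∣ F k n ∣ * (fromℕ 5 * (c n * c n))
  F-ratio k n = begin
    ℚ.∣ F k (suc n) ∣ * (1ℚ + y)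
      ≡⟨ cong (_* (1ℚ + y)) (∣F∣ k (suc n)) ⟩
    T' * b' * (1ℚ + y)
      ≤⟨ p≤p+q _ (*-nonNeg (*-nonNeg (*-nonNeg (ℚₚ.0≤∣p∣ (t k (suc n))) (b-nonNeg k (suc n))) (ℚₚ.<⇒≤ (0<1+ (fromℕ-nonNeg (k ℕ.+ n)))))
           (fromℕ-nonNeg n)) ⟩
    T' * b' * (1ℚ + y) + T' * b' * (1ℚ + y) * x
      ≡⟨ solve 4 (λ t b y x → t :* b :* y :+ t :* b :* y :* x := t :* ((con 1ℚ :+ x) :* y) :* b) refl T' b' (1ℚ + y) x ⟩
    T' * ((1ℚ + x) * (1ℚ + y)) * b'
      ≤⟨ ≤-scaleʳ b' (b-nonNeg k (suc n)) (t-ratio k n) ⟩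
    T * (c n * ℚ.∣ g n ∣) * b'
      ≤⟨ ≤-scaleʳ b' (b-nonNeg k (suc n)) (≤-scaleˡ T (ℚₚ.0≤∣p∣ (t k n)) (≤-scaleˡ (c n) (c-nonNeg n) (∣g∣≤c n))) ⟩
    T * (c n * c n) * b'
      ≤⟨ ≤-scaleˡ _ (*-nonNeg (ℚₚ.0≤∣p∣ (t k n)) (*-nonNeg (c-nonNeg n) (c-nonNeg n))) b'≤5b ⟩
    T * (c n * c n) * (fromℕ 5 * b k n)
      ≡⟨ solve 4 (λ T c f b → T :* c :* (f :* b) := T :* b :* (f :* c)) refl T (c n * c n) (fromℕ 5) (b k n) ⟩
    T * b k n * (fromℕ 5 * (c n * c n))
      ≡⟨ cong (_* (fromℕ 5 * (c n * c n))) (∣F∣ k n) ⟨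
    ℚ.∣ F k n ∣ * (fromℕ 5 * (c n * c n)) ∎
    where
      x = fromℕ n
      y = fromℕ (k ℕ.+ n)
      T = ℚ.∣ t k n ∣
      T' = ℚ.∣ t k (suc n) ∣
      b' = b k (suc n)
      h = fromℕ (k ℕ.+ m ℕ.+ 2 ℕ.* n)
      -- As b is at least 1/2, adding 2 multiplies it by at most 5.
      b'≤5b : b' ≤ℚ fromℕ 5 * b k n
      b'≤5b = ℚₚ.≤-trans (ℚₚ.≤-reflexive (b-suc k n))
        (ℚₚ.≤-trans (p≤p+q _ (*-nonNeg (fromℕ-nonNeg 4) (fromℕ-nonNeg (k ℕ.+ m ℕ.+ 2 ℕ.* n))))
          (ℚₚ.≤-reflexive (solve 1 (λ h → h :+ con ½ :+ con (fromℕ 2) :+ con (fromℕ 4) :* h := con (fromℕ 5) :* (h :+ con ½)) refl h)))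

  ≤⇒0≤- : ∀ {p q} → p ≤ℚ q → 0ℚ ≤ℚ q - p
  ≤⇒0≤- {p} {q} p≤q = subst (_≤ℚ q - p) (ℚₚ.+-inverseʳ p) (ℚₚ.+-monoˡ-≤ (- p) p≤q)

  ∣g∣≤ : ∀ n → m ≤ n → ℚ.∣ g n ∣ ≤ℚ fromℕ n + ½ - μ
  ∣g∣≤ n m≤n = ∣p∣≤-intro
    (ℚₚ.≤-trans (p≤p+q (g n) (+-nonNeg (ℚₚ.<⇒≤ (ℚₚ.positive⁻¹ 1ℚ)) (*-nonNeg (fromℕ-nonNeg 2) (≤⇒0≤- (fromℕ-≤ {m} {n} m≤n)))))
      (ℚₚ.≤-reflexive
        (solve 2 (λ u x → u :- con ½ :- x :+ (con 1ℚ :+ con (fromℕ 2) :* (x :- u)) := x :+ con ½ :- u) refl μ (fromℕ n))))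
    (ℚₚ.≤-reflexive (solve 2 (λ u x → :- (u :- con ½ :- x) := x :+ con ½ :- u) refl μ (fromℕ n)))

  -- A difference of squares: (n + 1/2 + m)(n + 1/2 - m) = (n + 1/2)² - m².
  c*∣g∣≤ : ∀ n → m ≤ n → c n * ℚ.∣ g n ∣ ≤ℚ (fromℕ n + ½) * (fromℕ n + ½)
  c*∣g∣≤ n m≤n = begin
    c n * ℚ.∣ g n ∣              ≤⟨ ≤-scaleˡ (c n) (c-nonNeg n) (∣g∣≤ n m≤n) ⟩
    c n * (fromℕ n + ½ - μ)      ≤⟨ p≤p+q _ (*-nonNeg 0≤μ 0≤μ) ⟩
    c n * (fromℕ n + ½ - μ) + μ * μ
      ≡⟨ solve 2 (λ u x → (u :+ con ½ :+ x) :* (x :+ con ½ :- u) :+ u :* u := (x :+ con ½) :* (x :+ con ½)) refl μ (fromℕ n) ⟩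
    (fromℕ n + ½) * (fromℕ n + ½) ∎

  -- Says that n |F(k, n)| does not increase, so F(k, n) is O(1/n). The ratio of the t-terms is at
  -- most (n + 1/2)²/((n + 1)(k + n + 1)), and b grows by at most the factor (n + 1)/n.
  F-decay : ∀ k n → 2 ≤ k → 2 ℕ.+ m ≤ n → ℚ.∣ F k (suc n) ∣ * (1ℚ + fromℕ n) ≤ℚ ℚ.∣ F k n ∣ * fromℕ n
  F-decay k n 2≤k m+2≤n = ≤-unscaleʳ ((1ℚ + y) * (x * x)) (*-pos 0<1+y (*-pos 0<x 0<x)) (begin
    ℚ.∣ F k (suc n) ∣ * (1ℚ + x) * ((1ℚ + y) * (x * x))
      ≡⟨ cong (λ z → z * (1ℚ + x) * ((1ℚ + y) * (x * x))) (trans (∣F∣ k (suc n)) (cong (T' *_) (b-suc k n))) ⟩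
    T' * (β + fromℕ 2) * (1ℚ + x) * ((1ℚ + y) * (x * x))
      ≡⟨ solve 4 (λ t b x y → t :* b :* (con 1ℚ :+ x) :* ((con 1ℚ :+ y) :* (x :* x))
           := t :* ((con 1ℚ :+ x) :* (con 1ℚ :+ y)) :* (b :* x :* x)) refl T' (β + fromℕ 2) x y ⟩
    T' * ((1ℚ + x) * (1ℚ + y)) * ((β + fromℕ 2) * x * x)
      ≤⟨ *-mono-≤₀ (*-nonNeg (*-nonNeg (+-nonNeg (b-nonNeg k n) (fromℕ-nonNeg 2)) x≥0) x≥0)
           (*-nonNeg T≥0 (*-nonNeg x+½≥0 x+½≥0))
           (ℚₚ.≤-trans (t-ratio k n) (≤-scaleˡ T T≥0 (c*∣g∣≤ n m≤n)))
           (≤-scaleʳ x x≥0 shift) ⟩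
    T * ((x + ½) * (x + ½)) * (β * (1ℚ + x) * x)
      ≡⟨ solve 3 (λ T b x → T :* ((x :+ con ½) :* (x :+ con ½)) :* (b :* (con 1ℚ :+ x) :* x)
           := T :* b :* x :* ((x :+ con ½) :* (x :+ con ½) :* (con 1ℚ :+ x))) refl T β x ⟩
    T * β * x * ((x + ½) * (x + ½) * (1ℚ + x))
      ≤⟨ ≤-scaleˡ (T * β * x) (*-nonNeg (*-nonNeg T≥0 (b-nonNeg k n)) x≥0) cubic ⟩
    T * β * x * ((1ℚ + y) * (x * x))
      ≡⟨ cong (λ z → z * x * ((1ℚ + y) * (x * x))) (∣F∣ k n) ⟨
    ℚ.∣ F k n ∣ * x * ((1ℚ + y) * (x * x)) ∎)
    where
      x = fromℕ n
      y = fromℕ (k ℕ.+ n)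
      κ = fromℕ k
      β = b k n
      T = ℚ.∣ t k n ∣
      T' = ℚ.∣ t k (suc n) ∣
      T≥0 = ℚₚ.0≤∣p∣ (t k n)
      x≥0 = fromℕ-nonNeg n
      m≤n : m ≤ n
      m≤n = ℕₚ.≤-trans (ℕₚ.m≤n+m m 2) m+2≤n
      2≤n : 2 ≤ n
      2≤n = ℕₚ.≤-trans (ℕₚ.m≤m+n 2 m) m+2≤n
      0≤x-2 = ≤⇒0≤- (fromℕ-≤ {2} {n} 2≤n)
      0<x : 0ℚ < x
      0<x = ℚₚ.<-≤-trans (fromℕ-pos 2) (fromℕ-≤ {2} {n} 2≤n)
      0<1+y : 0ℚ < 1ℚ + y
      0<1+y = 0<1+ (fromℕ-nonNeg (k ℕ.+ n))
      x+½≥0 = +-nonNeg x≥0 0≤½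
      shift : (β + fromℕ 2) * x ≤ℚ β * (1ℚ + x)
      shift = begin
        (β + fromℕ 2) * x
          ≤⟨ p≤p+q _ (+-nonNeg (+-nonNeg (fromℕ-nonNeg k) 0≤μ) 0≤½) ⟩
        (β + fromℕ 2) * x + (κ + μ + ½)
          ≡⟨ cong (λ z → (z + fromℕ 2) * x + (κ + μ + ½)) (b-value k n) ⟩
        (κ + μ + fromℕ 2 * x + ½ + fromℕ 2) * x + (κ + μ + ½)
          ≡⟨ solve 3 (λ k u x → (k :+ u :+ con (fromℕ 2) :* x :+ con ½ :+ con (fromℕ 2)) :* x :+ (k :+ u :+ con ½)
               := (k :+ u :+ con (fromℕ 2) :* x :+ con ½) :* (con 1ℚ :+ x)) refl κ μ x ⟩
        (κ + μ + fromℕ 2 * x + ½) * (1ℚ + x)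
          ≡⟨ cong (_* (1ℚ + x)) (b-value k n) ⟨
        β * (1ℚ + x) ∎
      -- As k ≥ 2, the right side is at least (x + 3) x². The difference is then x² - 5x/4 - 1/4 =
      -- (x + 3/4)(x - 2) + 5/4, which is positive for x ≥ 2.
      cubic : (x + ½) * (x + ½) * (1ℚ + x) ≤ℚ (1ℚ + y) * (x * x)
      cubic = begin
        (x + ½) * (x + ½) * (1ℚ + x)
          ≤⟨ p≤p+q _ (+-nonNeg (+-nonNeg (*-nonNeg (+-nonNeg x≥0 (*-nonNeg (fromℕ-nonNeg 3) (*-nonNeg 0≤½ 0≤½))) 0≤x-2) (fromℕ-nonNeg 1)) (*-nonNeg 0≤½ 0≤½)) ⟩
        (x + ½) * (x + ½) * (1ℚ + x) + ((x + fromℕ 3 * (½ * ½)) * (x - fromℕ 2) + fromℕ 1 + ½ * ½)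
          ≡⟨ solve 1 (λ x → (x :+ con ½) :* (x :+ con ½) :* (con 1ℚ :+ x) :+ ((x :+ con (fromℕ 3) :* (con ½ :* con ½)) :* (x :- con (fromℕ 2)) :+ con (fromℕ 1) :+ con ½ :* con ½)
               := (con 1ℚ :+ (con (fromℕ 2) :+ x)) :* (x :* x)) refl x ⟩
        (1ℚ + (fromℕ 2 + x)) * (x * x)
          ≤⟨ ≤-scaleʳ (x * x) (*-nonNeg x≥0 x≥0) (ℚₚ.+-monoʳ-≤ 1ℚ (ℚₚ.+-monoˡ-≤ x (fromℕ-≤ {2} {k} 2≤k))) ⟩
        (1ℚ + (κ + x)) * (x * x)
          ≡⟨ cong (λ z → (1ℚ + z) * (x * x)) (fromℕ-+ k n) ⟨
        (1ℚ + y) * (x * x) ∎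

open WallisRate

-- Limits with explicit rates; the generalised Wallis products.

module Convergence where
  open import Data.Rational using (_+_; _*_; _-_; -_; _<_) renaming (_≤_ to _≤ℚ_)
  open ℚ-Solver.+-*-Solver
  open ℚₚ.≤-Reasoning

  inv-* : ∀ n → inv n * fromℕ (suc n) ≡ 1ℚ
  inv-* n = /-*-cancel 1 (suc n)

  inv-nonNeg : ∀ n → 0ℚ ≤ℚ inv n
  inv-nonNeg = /-nonNeg 1

  inv-suc : ∀ n → inv (suc n) ≤ℚ inv n
  inv-suc n = /-≤ 1 (suc n) 1 n (ℕₚ.*-monoʳ-≤ 1 (ℕₚ.n≤1+n (suc n)))

  -p≤∣p∣ : ∀ p → - p ≤ℚ ℚ.∣ p ∣
  -p≤∣p∣ p = subst (- p ≤ℚ_) (ℚₚ.∣-p∣≡∣p∣ p) (p≤∣p∣ (- p))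

  ∣p-r∣≤ : ∀ p q r → ℚ.∣ p - r ∣ ≤ℚ ℚ.∣ p - q ∣ + ℚ.∣ q - r ∣
  ∣p-r∣≤ p q r = subst (λ z → ℚ.∣ z ∣ ≤ℚ ℚ.∣ p - q ∣ + ℚ.∣ q - r ∣)
    (solve 3 (λ p q r → p :- q :+ (q :- r) := p :- r) refl p q r)
    (ℚₚ.∣p+q∣≤∣p∣+∣q∣ (p - q) (q - r))

  *-inv-vanishes : ∀ C ε → 0ℚ ≤ℚ C → 0ℚ < ε → ∃ λ N → ∀ n → N ≤ n → C * inv n ≤ℚ ε
  *-inv-vanishes C ε 0≤C 0<ε =
    -- `scale` divides by its first argument, which must be positive; `C` itself may be 0.
    let 0<1+C = ℚₚ.<-≤-trans (ℚₚ.positive⁻¹ 1ℚ) (p≤p+q 1ℚ 0≤C)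
        δ , 0<δ , e = BoundLemmas.scale (1ℚ + C) 0<1+C ε 0<ε
        N , h = archimedean δ 0<δ
    in N , λ n N≤n → begin
      C * inv n             ≤⟨ ≤-scaleʳ (inv n) (inv-nonNeg n)
                                 (ℚₚ.≤-trans (p≤p+q C (ℚₚ.<⇒≤ (ℚₚ.positive⁻¹ 1ℚ))) (ℚₚ.≤-reflexive (ℚₚ.+-comm C 1ℚ))) ⟩
      (1ℚ + C) * inv n      ≤⟨ ≤-scaleˡ (1ℚ + C) (ℚₚ.<⇒≤ 0<1+C) (ℚₚ.≤-trans
                                 (/-≤ 1 n 8 n (ℕₚ.*-monoˡ-≤ (suc n) {1} {8} (s≤s z≤n))) (ℚₚ.<⇒≤ (h n N≤n))) ⟩
      (1ℚ + C) * δ          ≡⟨ e ⟩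
      ε ∎

  -- If q < p, some n ≥ k has C/(n + 1) ≤ (p - q)/2, and the hypothesis at n gives p - q ≤ (p -
  -- q)/2.
  ≤-limit : ∀ k C p q → 0ℚ ≤ℚ C → (∀ n → k ≤ n → p ≤ℚ C * inv n + q) → p ≤ℚ q
  ≤-limit k C p q 0≤C h = ℚₚ.≮⇒≥ λ q<p →
    let 0<p-q : 0ℚ < p - q
        0<p-q = subst (_< p - q) (ℚₚ.+-inverseʳ q) (ℚₚ.+-monoˡ-< (- q) q<p)
        N , v = *-inv-vanishes C ((p - q) * ½) 0≤C (half-pos 0<p-q)
        n = k ℕ.⊔ N
        ε≤½ε : p - q ≤ℚ (p - q) * ½
        ε≤½ε = begin
          p - q                 ≤⟨ ℚₚ.+-monoˡ-≤ (- q) (h n (ℕₚ.m≤m⊔n k N)) ⟩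
          C * inv n + q - q     ≡⟨ a+b-b (C * inv n) q ⟩
          C * inv n             ≤⟨ v n (ℕₚ.m≤n⊔m k N) ⟩
          (p - q) * ½ ∎
    in ℚₚ.<-irrefl refl (begin-strict
      p - q                         ≤⟨ ε≤½ε ⟩
      (p - q) * ½                   ≡⟨ ℚₚ.+-identityʳ _ ⟨
      (p - q) * ½ + 0ℚ              <⟨ ℚₚ.+-monoʳ-< ((p - q) * ½) (half-pos 0<p-q) ⟩
      (p - q) * ½ + (p - q) * ½     ≡⟨ half+half (p - q) ⟩
      p - q ∎)

  -- Since (m + 1) + K = m + (K + 1), the numerators agree, and the factorials in the denominators
  -- differ by one factor each.
  wallis-shift : ∀ m K → wallis (suc m) K * fromℕ (suc (2 ℕ.* m ℕ.+ suc K)) ≡ wallis m (suc K) * fromℕ (suc K)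
  wallis-shift m K = ≡-unscaleʳ (f * g) (*-pos (fromℕ-!-pos K) (fromℕ-!-pos N)) (begin-equality
    wallis (suc m) K * s * (f * g)
      ≡⟨ solve 4 (λ w s f g → w :* s :* (f :* g) := w :* (f :* (s :* g))) refl (wallis (suc m) K) s f g ⟩
    wallis (suc m) K * (f * (s * g))
      ≡⟨ cong (λ z → wallis (suc m) K * (f * z)) (trans (cong (λ z → fromℕ (z !)) index) (fromℕ-* (suc N) (N !))) ⟨
    wallis (suc m) K * (f * fromℕ ((2 ℕ.* suc m ℕ.+ K) !))
      ≡⟨ wallis-* (suc m) K ⟩
    num (suc m ℕ.+ K)
      ≡⟨ cong num (ℕₚ.+-suc m K) ⟨
    num (m ℕ.+ suc K)
      ≡⟨ wallis-* m (suc K) ⟨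
    wallis m (suc K) * (fromℕ (suc K !) * g)
      ≡⟨ cong (λ z → wallis m (suc K) * (z * g)) (fromℕ-* (suc K) (K !)) ⟩
    wallis m (suc K) * (fromℕ (suc K) * f * g)
      ≡⟨ solve 4 (λ w s f g → w :* (s :* f :* g) := w :* s :* (f :* g)) refl (wallis m (suc K)) (fromℕ (suc K)) f g ⟩
    wallis m (suc K) * fromℕ (suc K) * (f * g) ∎)
    where
      N = 2 ℕ.* m ℕ.+ suc K
      s = fromℕ (suc N)
      f = fromℕ (K !)
      g = fromℕ (N !)
      num : ℕ → ℚ
      num i = rising ½ i * rising ½ i * (fromℕ i + ½)
      index : 2 ℕ.* suc m ℕ.+ K ≡ suc N
      index = trans (cong (ℕ._+ K) (ℕₚ.*-suc 2 m)) (cong suc (sym (ℕₚ.+-suc (2 ℕ.* m) K)))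

  shift-≥ : ∀ m K → fromℕ (suc K) ≤ℚ fromℕ (suc (2 ℕ.* m ℕ.+ suc K))
  shift-≥ m K = fromℕ-≤ {suc K} {suc (2 ℕ.* m ℕ.+ suc K)} (ℕₚ.m≤n⇒m≤1+n (ℕₚ.m≤n+m (suc K) (2 ℕ.* m)))

  wallis≤½ : ∀ m K → wallis m K ≤ℚ ½
  wallis≤½ zero    K = W≤½ K
  wallis≤½ (suc m) K = ≤-unscaleʳ s (fromℕ-pos (suc (2 ℕ.* m ℕ.+ suc K))) (begin
    wallis (suc m) K * s              ≡⟨ wallis-shift m K ⟩
    wallis m (suc K) * fromℕ (suc K)  ≤⟨ *-mono-≤₀ (fromℕ-nonNeg (suc K)) 0≤½ (wallis≤½ m (suc K)) (shift-≥ m K) ⟩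
    ½ * s ∎)
    where s = fromℕ (suc (2 ℕ.* m ℕ.+ suc K))

  -- By `wallis-shift` the two values have ratio (K + 1)/(2m + K + 2), so they differ by `w` (2m +
  -- 1)/(2m + K + 2).
  wallis-difference : ∀ m K → ℚ.∣ wallis (suc m) K - wallis m (suc K) ∣ ≤ℚ fromℕ (suc (2 ℕ.* m)) * inv K
  wallis-difference m K = ∣p∣≤-intro
    (ℚₚ.≤-trans (≤-unscaleʳ s 0<s (begin
      (w' - w) * s               ≡⟨ solve 3 (λ w' w s → (w' :- w) :* s := w' :* s :- w :* s) refl w' w s ⟩
      w' * s - w * s             ≡⟨ cong (λ z → z - w * s) (wallis-shift m K) ⟩
      w * x - w * s              ≤⟨ ℚₚ.+-monoˡ-≤ (- (w * s)) (≤-scaleˡ w 0≤w (shift-≥ m K)) ⟩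
      w * s - w * s              ≡⟨ solve 2 (λ w s → w :* s :- w :* s := con 0ℚ :* s) refl w s ⟩
      0ℚ * s ∎))
      (*-nonNeg a≥0 (inv-nonNeg K)))
    (≤-unscaleʳ s 0<s (begin
      - (w' - w) * s             ≡⟨ solve 3 (λ w' w s → :- (w' :- w) :* s := w :* s :- w' :* s) refl w' w s ⟩
      w * s - w' * s             ≡⟨ cong₂ (λ y z → w * y - z) s≡ (wallis-shift m K) ⟩
      w * (a + x) - w * x        ≡⟨ solve 3 (λ w a x → w :* (a :+ x) :- w :* x := w :* a) refl w a x ⟩
      w * a                      ≤⟨ ≤-scaleʳ a a≥0 (ℚₚ.≤-trans (wallis≤½ m (suc K)) ½≤1) ⟩
      1ℚ * a                     ≡⟨ cong (_* a) (inv-* K) ⟨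
      inv K * x * a              ≤⟨ ≤-scaleʳ a a≥0 (≤-scaleˡ (inv K) (inv-nonNeg K) (shift-≥ m K)) ⟩
      inv K * s * a              ≡⟨ solve 3 (λ u s a → u :* s :* a := a :* u :* s) refl (inv K) s a ⟩
      a * inv K * s ∎))
    where
      w' = wallis (suc m) K
      w = wallis m (suc K)
      s = fromℕ (suc (2 ℕ.* m ℕ.+ suc K))
      x = fromℕ (suc K)
      a = fromℕ (suc (2 ℕ.* m))
      a≥0 = fromℕ-nonNeg (suc (2 ℕ.* m))
      0≤w = wallis-nonNeg m (suc K)
      0<s = fromℕ-pos (suc (2 ℕ.* m ℕ.+ suc K))
      ½≤1 : ½ ≤ℚ 1ℚ
      ½≤1 = p≤p+q ½ 0≤½
      s≡ : s ≡ a + x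
      s≡ = fromℕ-+ (suc (2 ℕ.* m)) (suc K)

  e : ℕ → ℚ
  e j = ℤ.+ 8 ℚ./ suc j

  -- Convergence to 1/π at rate O(1/K), tested against every approximant `r j` of 1/π. Because `C`
  -- depends neither on K nor on j, K can go to infinity while j stays fixed.
  TendsTo1/π : (ℕ → ℚ) → Set
  TendsTo1/π X = ∃ λ C → 0ℚ ≤ℚ C × (∀ K j → 15 ≤ j → ℚ.∣ X (suc K) - r j ∣ ≤ℚ C * inv K + e j)

  perturb : ∀ {X Y D} → TendsTo1/π X → 0ℚ ≤ℚ D → (∀ K → ℚ.∣ Y (suc K) - X (suc K) ∣ ≤ℚ D * inv K) → TendsTo1/π Y
  perturb {X} {Y} {D} (C , 0≤C , h) 0≤D near = D + C , +-nonNeg 0≤D 0≤C , λ K j 15≤j → begin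
    ℚ.∣ Y (suc K) - r j ∣                                      ≤⟨ ∣p-r∣≤ (Y (suc K)) (X (suc K)) (r j) ⟩
    ℚ.∣ Y (suc K) - X (suc K) ∣ + ℚ.∣ X (suc K) - r j ∣        ≤⟨ ℚₚ.+-mono-≤ (near K) (h K j 15≤j) ⟩
    D * inv K + (C * inv K + e j)
      ≡⟨ solve 4 (λ D C u e → D :* u :+ (C :* u :+ e) := (D :+ C) :* u :+ e) refl D C (inv K) (e j) ⟩
    (D + C) * inv K + e j ∎

  tendsTo1/π-suc : ∀ {X} → TendsTo1/π X → TendsTo1/π (λ K → X (suc K))
  tendsTo1/π-suc (C , 0≤C , h) = C , 0≤C , λ K j 15≤j →
    ℚₚ.≤-trans (h (suc K) j 15≤j) (ℚₚ.+-monoˡ-≤ (e j) (≤-scaleˡ C 0≤C (inv-suc K)))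

  wallis-tendsTo1/π : ∀ m → TendsTo1/π (wallis m)
  wallis-tendsTo1/π zero    = fromℕ 12 , fromℕ-nonNeg 12 , W-rate
  wallis-tendsTo1/π (suc m) = perturb {λ K → wallis m (suc K)} {wallis (suc m)}
    (tendsTo1/π-suc {wallis m} (wallis-tendsTo1/π m)) (fromℕ-nonNeg (suc (2 ℕ.* m)))
    λ K → ℚₚ.≤-trans (wallis-difference m (suc K)) (≤-scaleˡ (fromℕ (suc (2 ℕ.* m))) (fromℕ-nonNeg (suc (2 ℕ.* m))) (inv-suc K))

-- Monotonicity in k and the enclosure of 1/π.

module Bracketing (m : ℕ) where
  open import Data.Rational using (_+_; _*_; _-_; -_; _<_) renaming (_≤_ to _≤ℚ_)
  open ℚ-Solver.+-*-Solver
  open ℚₚ.≤-Reasoning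
  open Convergence
  open SeriesTerms m
  open Telescoping m
  open Identification m
  open TermBounds m

  ratioBound : ℕ → ℚ
  ratioBound n = fromℕ 5 * (c n * c n)

  ratioBound-nonNeg : ∀ n → 0ℚ ≤ℚ ratioBound n
  ratioBound-nonNeg n = *-nonNeg (fromℕ-nonNeg 5) (*-nonNeg (c-nonNeg n) (c-nonNeg n))

  -- Uniform in k: at n = 0 by `wallis≤½`, then by `F-ratio` with the factor 1 + k + n discarded.
  F-bounded : ∀ n → ∃ λ B → 0ℚ ≤ℚ B × (∀ k → ℚ.∣ F k n ∣ ≤ℚ B)
  F-bounded zero    = ½ , 0≤½ , λ k → subst (_≤ℚ ½)
    (sym (trans (cong ℚ.∣_∣ (F-wallis k)) (ℚₚ.0≤p⇒∣p∣≡p (wallis-nonNeg m k)))) (wallis≤½ m k)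
  F-bounded (suc n) = let B , 0≤B , h = F-bounded n in
    B * ratioBound n , *-nonNeg 0≤B (ratioBound-nonNeg n) , λ k → begin
      ℚ.∣ F k (suc n) ∣
        ≤⟨ p≤p+q _ (*-nonNeg (ℚₚ.0≤∣p∣ (F k (suc n))) (fromℕ-nonNeg (k ℕ.+ n))) ⟩
      ℚ.∣ F k (suc n) ∣ + ℚ.∣ F k (suc n) ∣ * fromℕ (k ℕ.+ n)
        ≡⟨ solve 2 (λ f y → f :+ f :* y := f :* (con 1ℚ :+ y)) refl ℚ.∣ F k (suc n) ∣ (fromℕ (k ℕ.+ n)) ⟩
      ℚ.∣ F k (suc n) ∣ * (1ℚ + fromℕ (k ℕ.+ n))
        ≤⟨ F-ratio k n ⟩
      ℚ.∣ F k n ∣ * ratioBound n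
        ≤⟨ ≤-scaleʳ (ratioBound n) (ratioBound-nonNeg n) (h k) ⟩
      B * ratioBound n ∎

  -- The same step as in `F-bounded`, now keeping 1 + k + n ≥ k + 1 as the gain.
  F-vanishes-in-k : ∀ n → ∃ λ C → 0ℚ ≤ℚ C × (∀ k → ℚ.∣ F k (suc n) ∣ ≤ℚ C * inv k)
  F-vanishes-in-k n = let B , 0≤B , h = F-bounded n in
    B * ratioBound n , *-nonNeg 0≤B (ratioBound-nonNeg n) , λ k →
      ≤-unscaleʳ (fromℕ (suc k)) (fromℕ-pos (suc k)) (begin
        ℚ.∣ F k (suc n) ∣ * fromℕ (suc k)
          ≤⟨ ≤-scaleˡ _ (ℚₚ.0≤∣p∣ (F k (suc n))) (fromℕ-≤ {suc k} {suc (k ℕ.+ n)} (s≤s (ℕₚ.m≤m+n k n))) ⟩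
        ℚ.∣ F k (suc n) ∣ * fromℕ (suc (k ℕ.+ n))
          ≡⟨ cong (ℚ.∣ F k (suc n) ∣ *_) (fromℕ-suc (k ℕ.+ n)) ⟩
        ℚ.∣ F k (suc n) ∣ * (1ℚ + fromℕ (k ℕ.+ n))
          ≤⟨ F-ratio k n ⟩
        ℚ.∣ F k n ∣ * ratioBound n
          ≤⟨ ≤-scaleʳ (ratioBound n) (ratioBound-nonNeg n) (h k) ⟩
        B * ratioBound n
          ≡⟨ trans (cong (B * ratioBound n *_) (inv-* k)) (ℚₚ.*-identityʳ (B * ratioBound n)) ⟨
        B * ratioBound n * (inv k * fromℕ (suc k))
          ≡⟨ ℚₚ.*-assoc (B * ratioBound n) (inv k) (fromℕ (suc k)) ⟨
        B * ratioBound n * inv k * fromℕ (suc k) ∎)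

  -- One term alone is `wallis m`; every further term is a perturbation of size O(1/k).
  Q-tendsTo1/π : ∀ M → TendsTo1/π (λ k → Q k (suc M))
  Q-tendsTo1/π zero    = let C , 0≤C , h = wallis-tendsTo1/π m in
    C , 0≤C , λ K j 15≤j → subst (λ z → ℚ.∣ z - r j ∣ ≤ℚ C * inv K + e j)
      (sym (trans (ℚₚ.+-identityˡ (F (suc K) 0)) (F-wallis (suc K)))) (h K j 15≤j)
  Q-tendsTo1/π (suc M) = let D , 0≤D , h = F-vanishes-in-k M in
    perturb {λ k → Q k (suc M)} {λ k → Q k (suc (suc M))} (Q-tendsTo1/π M) 0≤D λ K →
      subst (λ z → ℚ.∣ z ∣ ≤ℚ D * inv K) (sym (a+b-a (Q (suc K) (suc M)) (F (suc K) (suc M))))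
        (ℚₚ.≤-trans (h (suc K)) (≤-scaleˡ D 0≤D (inv-suc K)))

  Q-increasing : ∀ M → 0ℚ ≤ℚ fall M → ∀ k i → Q k M ≤ℚ Q (i ℕ.+ k) M
  Q-increasing M 0≤f k zero    = ℚₚ.≤-refl
  Q-increasing M 0≤f k (suc i) = ℚₚ.≤-trans (Q-increasing M 0≤f k i)
    (ℚₚ.≤-trans (p≤p+q _ (*-nonNeg (fromℕ-nonNeg M) (t-nonNeg (i ℕ.+ k) M 0≤f)))
      (ℚₚ.≤-reflexive (sym (Q-suc-k (i ℕ.+ k) M))))

  Q-decreasing : ∀ M → fall M ≤ℚ 0ℚ → ∀ k i → Q (i ℕ.+ k) M ≤ℚ Q k M
  Q-decreasing M f≤0 k zero    = ℚₚ.≤-refl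
  Q-decreasing M f≤0 k (suc i) = begin
    Q (suc i ℕ.+ k) M                                   ≡⟨ Q-suc-k (i ℕ.+ k) M ⟩
    Q (i ℕ.+ k) M + fromℕ M * t (i ℕ.+ k) M             ≤⟨ ℚₚ.+-monoʳ-≤ (Q (i ℕ.+ k) M)
                                                            (≤-scaleˡ (fromℕ M) (fromℕ-nonNeg M) (t-nonPos (i ℕ.+ k) M f≤0)) ⟩
    Q (i ℕ.+ k) M + fromℕ M * 0ℚ                        ≡⟨ trans (cong (Q (i ℕ.+ k) M +_) (ℚₚ.*-zeroʳ (fromℕ M)))
                                                            (ℚₚ.+-identityʳ (Q (i ℕ.+ k) M)) ⟩
    Q (i ℕ.+ k) M                                       ≤⟨ Q-decreasing M f≤0 k i ⟩
    Q k M ∎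

  -- Here the sum increases in k, so its value at k is at most that at any n + 1 > k; `≤-limit` then
  -- sends n to infinity with j fixed, and only the mesh error remains.
  Q-below : ∀ M → 0ℚ ≤ℚ fall (suc M) → ∀ k j → 15 ≤ j → Q k (suc M) - r j ≤ℚ e j
  Q-below M 0≤f k j 15≤j = let C , 0≤C , h = Q-tendsTo1/π M in
    ≤-limit k C (Q k (suc M) - r j) (e j) 0≤C λ n k≤n → begin
      Q k (suc M) - r j
        ≤⟨ ℚₚ.+-monoˡ-≤ (- r j) (subst (λ z → Q k (suc M) ≤ℚ Q (suc z) (suc M)) (ℕₚ.m∸n+n≡m k≤n)
             (Q-increasing (suc M) 0≤f k (suc (n ℕ.∸ k)))) ⟩
      Q (suc n) (suc M) - r j       ≤⟨ p≤∣p∣ _ ⟩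
      ℚ.∣ Q (suc n) (suc M) - r j ∣ ≤⟨ h n j 15≤j ⟩
      C * inv n + e j ∎

  Q-above : ∀ M → fall (suc M) ≤ℚ 0ℚ → ∀ k j → 15 ≤ j → r j - Q k (suc M) ≤ℚ e j
  Q-above M f≤0 k j 15≤j = let C , 0≤C , h = Q-tendsTo1/π M in
    ≤-limit k C (r j - Q k (suc M)) (e j) 0≤C λ n k≤n → begin
      r j - Q k (suc M)
        ≤⟨ ℚₚ.+-monoʳ-≤ (r j) (ℚₚ.neg-antimono-≤ (subst (λ z → Q (suc z) (suc M) ≤ℚ Q k (suc M)) (ℕₚ.m∸n+n≡m k≤n)
             (Q-decreasing (suc M) f≤0 k (suc (n ℕ.∸ k))))) ⟩
      r j - Q (suc n) (suc M)       ≡⟨ neg-sub (Q (suc n) (suc M)) (r j) ⟨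
      - (Q (suc n) (suc M) - r j)   ≤⟨ -p≤∣p∣ _ ⟩
      ℚ.∣ Q (suc n) (suc M) - r j ∣ ≤⟨ h n j 15≤j ⟩
      C * inv n + e j ∎

  g-nonPos : ∀ n → m ≤ n → g n ≤ℚ 0ℚ
  g-nonPos n m≤n = begin
    g n                          ≤⟨ p≤p+q (g n) (+-nonNeg 0≤½ (≤⇒0≤- (fromℕ-≤ {m} {n} m≤n))) ⟩
    g n + (½ + (fromℕ n - μ))    ≡⟨ solve 2 (λ u x → u :- con ½ :- x :+ (con ½ :+ (x :- u)) := con 0ℚ) refl μ (fromℕ n) ⟩
    0ℚ ∎

  fall-suc-nonPos : ∀ n → m ≤ n → 0ℚ ≤ℚ fall n → fall (suc n) ≤ℚ 0ℚ
  fall-suc-nonPos n m≤n 0≤f = ℚₚ.≤-trans (≤-scaleˡ (fall n) 0≤f (g-nonPos n m≤n)) (ℚₚ.≤-reflexive (ℚₚ.*-zeroʳ (fall n)))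

  fall-suc-nonNeg : ∀ n → m ≤ n → fall n ≤ℚ 0ℚ → 0ℚ ≤ℚ fall (suc n)
  fall-suc-nonNeg n m≤n f≤0 = ℚₚ.≤-trans (*-nonNeg (ℚₚ.neg-antimono-≤ f≤0) (ℚₚ.neg-antimono-≤ (g-nonPos n m≤n)))
    (ℚₚ.≤-reflexive (solve 2 (λ f g → (:- f) :* (:- g) := f :* g) refl (fall n) (g n)))

  -- 1/π lies between Q k n and Q k (n + 1) up to e j.
  Q-error : ∀ k n j → m ≤ suc n → 15 ≤ j → ℚ.∣ Q k (suc n) - r j ∣ ≤ℚ ℚ.∣ F k (suc n) ∣ + e j
  Q-error k n j m≤sn 15≤j = split (ℚₚ.≤-total 0ℚ (fall (suc n)))
    where
      q = Q k (suc n)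
      f = F k (suc n)
      e≤ : e j ≤ℚ ℚ.∣ f ∣ + e j
      e≤ = ℚₚ.≤-trans (p≤p+q (e j) (ℚₚ.0≤∣p∣ f)) (ℚₚ.≤-reflexive (ℚₚ.+-comm (e j) ℚ.∣ f ∣))
      split : 0ℚ ≤ℚ fall (suc n) ⊎ fall (suc n) ≤ℚ 0ℚ → ℚ.∣ q - r j ∣ ≤ℚ ℚ.∣ f ∣ + e j
      split (inj₁ 0≤f) = ∣p∣≤-intro
        (ℚₚ.≤-trans (Q-below n 0≤f k j 15≤j) e≤)
        (begin
          -- The distance is expressed through the next partial sum q + f, which is on the other
          -- side of 1/π.
          - (q - r j)            ≡⟨ solve 3 (λ q f r → :- (q :- r) := f :+ (r :- (q :+ f))) refl q f (r j) ⟩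
          f + (r j - (q + f))    ≤⟨ ℚₚ.+-mono-≤ (p≤∣p∣ f)
                                      (Q-above (suc n) (fall-suc-nonPos (suc n) m≤sn 0≤f) k j 15≤j) ⟩
          ℚ.∣ f ∣ + e j ∎)
      split (inj₂ f≤0) = ∣p∣≤-intro
        (begin
          q - r j                ≡⟨ solve 3 (λ q f r → q :- r := :- f :+ (q :+ f :- r)) refl q f (r j) ⟩
          - f + (q + f - r j)    ≤⟨ ℚₚ.+-mono-≤ (-p≤∣p∣ f)
                                      (Q-below (suc n) (fall-suc-nonNeg (suc n) m≤sn f≤0) k j 15≤j) ⟩
          ℚ.∣ f ∣ + e j ∎)
        (ℚₚ.≤-trans (ℚₚ.≤-reflexive (neg-sub q (r j))) (ℚₚ.≤-trans (Q-above n f≤0 k j 15≤j) e≤))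

  module _ (k : ℕ) (2≤k : 2 ≤ k) where
    -- The start of the decay: m for the bound on |m - 1/2 - n|, and 2 for the cubic inequality in
    -- `F-decay`.
    n₀ : ℕ
    n₀ = 2 ℕ.+ m

    B₀ : ℚ
    B₀ = ℚ.∣ F k n₀ ∣ * fromℕ n₀

    n*F-bounded : ∀ i → ℚ.∣ F k (i ℕ.+ n₀) ∣ * fromℕ (i ℕ.+ n₀) ≤ℚ B₀
    n*F-bounded zero    = ℚₚ.≤-refl
    n*F-bounded (suc i) = ℚₚ.≤-trans
      (ℚₚ.≤-reflexive (cong (ℚ.∣ F k (suc i ℕ.+ n₀) ∣ *_) (fromℕ-suc (i ℕ.+ n₀))))
      (ℚₚ.≤-trans (F-decay k (i ℕ.+ n₀) 2≤k (ℕₚ.m≤n+m n₀ i)) (n*F-bounded i))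

    F-vanishes-in-n : ∀ n → n₀ ≤ n → ℚ.∣ F k (suc n) ∣ ≤ℚ B₀ * inv n
    F-vanishes-in-n n n₀≤n = ≤-unscaleʳ (fromℕ (suc n)) (fromℕ-pos (suc n)) (begin
      ℚ.∣ F k (suc n) ∣ * fromℕ (suc n)
        ≤⟨ subst (λ z → ℚ.∣ F k (suc z) ∣ * fromℕ (suc z) ≤ℚ B₀) (ℕₚ.m∸n+n≡m n₀≤n) (n*F-bounded (suc (n ℕ.∸ n₀))) ⟩
      B₀                              ≡⟨ trans (cong (B₀ *_) (inv-* n)) (ℚₚ.*-identityʳ B₀) ⟨
      B₀ * (inv n * fromℕ (suc n))    ≡⟨ ℚₚ.*-assoc B₀ (inv n) (fromℕ (suc n)) ⟨
      B₀ * inv n * fromℕ (suc n) ∎)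

-- Convergence and value of the series.

module Summation (m k : ℕ) (2≤k : 2 ≤ k) where
  open import Data.Rational using (_+_; _*_; _-_; -_; _<_) renaming (_≤_ to _≤ℚ_)
  open ℚ-Solver.+-*-Solver
  open ℚₚ.≤-Reasoning
  open Convergence
  open Identification m
  open SeriesTerms m using (ρ; F)
  open Telescoping m using (Q)
  open Bracketing m

  prefactor-pos : 0ℚ < prefactor m k
  prefactor-pos = subst (0ℚ <_) (sym (prefactor-value k)) (*-pos (rising½-pos (m ℕ.+ k)) (rising½-pos m))

  prefactor-inverse : ∃ λ δ → 0ℚ < δ × prefactor m k * δ ≡ 1ℚ
  prefactor-inverse = BoundLemmas.scale (prefactor m k) prefactor-pos 1ℚ (ℚₚ.positive⁻¹ 1ℚ)

  module _ (δ : ℚ) (0<δ : 0ℚ < δ) (inverse : prefactor m k * δ ≡ 1ℚ) where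
    0≤δ : 0ℚ ≤ℚ δ
    0≤δ = ℚₚ.<⇒≤ 0<δ

    partialSum-Q : ∀ M → partialSum (summand m k) M ≡ δ * Q k M
    partialSum-Q M = begin-equality
      p                           ≡⟨ ℚₚ.*-identityˡ p ⟨
      1ℚ * p                      ≡⟨ cong (_* p) inverse ⟨
      prefactor m k * δ * p       ≡⟨ solve 3 (λ c d p → c :* d :* p := d :* (c :* p)) refl (prefactor m k) δ p ⟩
      δ * (prefactor m k * p)     ≡⟨ cong (δ *_) (Q-summand k M) ⟨
      δ * Q k M ∎
      where p = partialSum (summand m k) M

    error : ∀ n j → m ≤ suc n → 15 ≤ j →
      ℚ.∣ partialSum (summand m k) (suc n) - δ * r j ∣ ≤ℚ δ * ℚ.∣ F k (suc n) ∣ + δ * e j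
    error n j m≤sn 15≤j = begin
      ℚ.∣ partialSum (summand m k) (suc n) - δ * r j ∣
        ≡⟨ cong (λ z → ℚ.∣ z - δ * r j ∣) (partialSum-Q (suc n)) ⟩
      ℚ.∣ δ * Q k (suc n) - δ * r j ∣
        ≡⟨ cong ℚ.∣_∣ (solve 3 (λ d q r → d :* q :- d :* r := d :* (q :- r)) refl δ (Q k (suc n)) (r j)) ⟩
      ℚ.∣ δ * (Q k (suc n) - r j) ∣
        ≡⟨ trans (ℚₚ.∣p*q∣≡∣p∣*∣q∣ δ (Q k (suc n) - r j)) (cong (_* ℚ.∣ Q k (suc n) - r j ∣) (ℚₚ.0≤p⇒∣p∣≡p 0≤δ)) ⟩
      δ * ℚ.∣ Q k (suc n) - r j ∣
        ≤⟨ ≤-scaleˡ δ 0≤δ (Q-error k n j m≤sn 15≤j) ⟩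
      δ * (ℚ.∣ F k (suc n) ∣ + e j)
        ≡⟨ ℚₚ.*-distribˡ-+ δ ℚ.∣ F k (suc n) ∣ (e j) ⟩
      δ * ℚ.∣ F k (suc n) ∣ + δ * e j ∎

    B₀-nonNeg : 0ℚ ≤ℚ B₀ k 2≤k
    B₀-nonNeg = *-nonNeg (ℚₚ.0≤∣p∣ (F k (n₀ k 2≤k))) (fromℕ-nonNeg (n₀ k 2≤k))

    e-inv : ∀ j → e j ≡ fromℕ 8 * inv j
    e-inv j = ≡-unscaleʳ (fromℕ (suc j)) (fromℕ-pos (suc j)) (begin-equality
      e j * fromℕ (suc j)                  ≡⟨ /-*-cancel 8 (suc j) ⟩
      fromℕ 8 * 1ℚ                         ≡⟨ cong (fromℕ 8 *_) (inv-* j) ⟨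
      fromℕ 8 * (inv j * fromℕ (suc j))    ≡⟨ ℚₚ.*-assoc (fromℕ 8) (inv j) (fromℕ (suc j)) ⟨
      fromℕ 8 * inv j * fromℕ (suc j) ∎)

    sum : ℝ
    sum = D.fromℚ δ D.* recip π π>0

    converges : summand m k sumsTo sum
    converges ε 0<ε =
      -- A strict inequality of reals needs a rational margin valid for all late j. Half of ε serves
      -- as the margin; the first omitted term and the mesh error receive a quarter each.
      let η = ε * ½ * ½
          0<η = half-pos (half-pos 0<ε)
          N , small-F = *-inv-vanishes (δ * B₀ k 2≤k) η (*-nonNeg 0≤δ B₀-nonNeg) 0<η
          J , small-e = *-inv-vanishes (δ * fromℕ 8) η (*-nonNeg 0≤δ (fromℕ-nonNeg 8)) 0<η
      -- `error` covers only partial sums with at least one term, so the threshold is a successor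
      -- and the index is matched as `suc n`.
      in suc (n₀ k 2≤k ℕ.⊔ N) , λ where
        (suc n) (s≤s h) → ε * ½ , half-pos 0<ε , 15 ℕ.⊔ J , λ j h′ →
          let n₀≤n = ℕₚ.m⊔n≤o⇒m≤o (n₀ k 2≤k) N h
              m≤sn = ℕₚ.m≤n⇒m≤1+n (ℕₚ.≤-trans (ℕₚ.m≤n+m m 2) n₀≤n)
          in begin
            ℚ.∣ partialSum (summand m k) (suc n) - δ * r j ∣ + ε * ½
              ≤⟨ ℚₚ.+-monoˡ-≤ (ε * ½) (error n j m≤sn (ℕₚ.m⊔n≤o⇒m≤o 15 J h′)) ⟩
            δ * ℚ.∣ F k (suc n) ∣ + δ * e j + ε * ½
              ≤⟨ ℚₚ.+-monoˡ-≤ (ε * ½) (ℚₚ.+-mono-≤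
                   (ℚₚ.≤-trans (≤-scaleˡ δ 0≤δ (F-vanishes-in-n k 2≤k n n₀≤n))
                     (ℚₚ.≤-trans (ℚₚ.≤-reflexive (sym (ℚₚ.*-assoc δ (B₀ k 2≤k) (inv n))))
                       (small-F n (ℕₚ.m⊔n≤o⇒n≤o (n₀ k 2≤k) N h))))
                   (ℚₚ.≤-trans (ℚₚ.≤-reflexive (trans (cong (δ *_) (e-inv j)) (sym (ℚₚ.*-assoc δ (fromℕ 8) (inv j)))))
                     (small-e j (ℕₚ.m⊔n≤o⇒n≤o 15 J h′)))) ⟩
            η + η + ε * ½
              ≡⟨ cong (_+ ε * ½) (half+half (ε * ½)) ⟩
            ε * ½ + ε * ½
              ≡⟨ half+half ε ⟩
            ε ∎

    value : recip π π>0 ≃ D.fromℚ (prefactor m k) D.* sum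
    -- The two representing sequences agree at every index, hence the threshold 0.
    value ε 0<ε = 0 , λ j _ → subst (λ z → ℚ.∣ z ∣ < ε) (sym (vanish j)) 0<ε
      where
        vanish : ∀ j → r j - prefactor m k * (δ * r j) ≡ 0ℚ
        vanish j = begin-equality
          r j - prefactor m k * (δ * r j)    ≡⟨ cong (λ z → r j - z) (ℚₚ.*-assoc (prefactor m k) δ (r j)) ⟨
          r j - prefactor m k * δ * r j      ≡⟨ cong (λ z → r j - z * r j) inverse ⟩
          r j - 1ℚ * r j                     ≡⟨ solve 1 (λ r → r :- con 1ℚ :* r := con 0ℚ) refl (r j) ⟩
          0ℚ ∎

open import Defs using (_*_)

mainTheorem1 : (m k : ℕ) → 2 ≤ k →
    ∃ λ (s : ℝ) → (summand m k sumsTo s) × (recip π π>0 ≃ fromℚ (prefactor m k) * s)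
mainTheorem1 m k 2≤k =
  let δ , 0<δ , inverse = Summation.prefactor-inverse m k 2≤k
  in Summation.sum m k 2≤k δ 0<δ inverse
   , Summation.converges m k 2≤k δ 0<δ inverse
   , Summation.value m k 2≤k δ 0<δ inverse
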